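{- For an integer $p\ge 1$ let $\mathrm{TW}(p)$ be the family of all graphs of treewidth at most $p$. There exist absolute constants $c,C>0$ such that for all integers $p\ge 1$ and $k\ge p$, $$c\,pk\;\le\; f^*(k,\mathrm{TW}(p))\;\le\; C\,p^3k .$$
   Context: All graphs are finite and undirected, with nonnegative edge lengths $\ell:E(G)\to\mathbb{R}_{\ge 0}$; $d_H$ denotes shortest-path distance in a graph $H$ with respect to its edge lengths. Given a graph $G=(V,E,\ell)$ and a set of terminals $R\subseteq V$, a distance-preserving minor of $G$ with respect to $R$ is a graph $G'$ with edge lengths $\ell'$ (which may differ from $\ell$) such that $G'$ is a minor of $G$ in which the terminals survive (terminals are never deleted and no two terminals are merged; a terminal may be merged with non-terminals by edge contraction, and the resulting vertex is identified with that terminal), so $R\subseteq V(G')$, and $d_{G'}(u,v)=d_G(u,v)$ for all $u,v\in R$. For a family $\mathcal{F}$ of graphs (defined irrespective of edge lengths), $f^*(k,\mathcal{F})$ is the minimum number such that every graph in $\mathcal{F}$, with any nonnegative edge lengths and any set of $k$ terminals, admits a distance-preserving minor with at most $f^*(k,\mathcal{F})$ vertices.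
   Formalization: Edge lengths, both of the given graph and of the distance-preserving minor, are nonnegative rationals instead of nonnegative reals. -}

module Defs where

open import Data.Nat using (ℕ; zero; suc; _^_) renaming (_≤_ to _≤ℕ_; _<_ to _<ℕ_)
open import Data.Integer using (+_)
open import Data.Rational using (ℚ; 0ℚ; _/_; _+_; _*_; _≤_; _<_)
open import Data.Fin using (Fin; zero; suc; toℕ)
open import Data.Fin.Subset using (Subset; _∈_; ∣_∣)
open import Data.Bool using (Bool; true; false; T)
open import Data.Maybe using (Maybe; just; nothing)
open import Data.Product using (Σ; _×_; _,_; ∃; ∃₂)
open import Data.Sum using (_⊎_)
open import Data.Unit using (⊤)
open import Relation.Binary.PropositionalEquality using (_≡_)

ℕ→ℚ : ℕ → ℚ
ℕ→ℚ n = + n / 1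

record Graph : Set where
  field
    size   : ℕ
    adj    : Fin size → Fin size → Bool
    adj-sym    : ∀ u v → adj u v ≡ adj v u
    adj-irrefl : ∀ u → adj u u ≡ false

  Adj : Fin size → Fin size → Set
  Adj u v = T (adj u v)

open Graph public

-- nonnegative, symmetric edge lengths (only values on edges matter)
record Lengths (G : Graph) : Set where
  field
    len        : Fin (size G) → Fin (size G) → ℚ
    len-sym    : ∀ u v → len u v ≡ len v u
    len-nonneg : ∀ u v → 0ℚ ≤ len u v

open Lengths public

data WalkIn {n : ℕ} (E : Fin n → Fin n → Set) (S : Fin n → Set) : Fin n → Fin n → Set where
  stop : ∀ {u} → S u → WalkIn E S u u
  step : ∀ {u w v} → S u → E u w → WalkIn E S w v → WalkIn E S u v

Walk : (G : Graph) → Fin (size G) → Fin (size G) → Set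
Walk G = WalkIn (Adj G) (λ _ → ⊤)

walkLength : {n : ℕ} {E : Fin n → Fin n → Set} {S : Fin n → Set}
             (ℓ : Fin n → Fin n → ℚ) {u v : Fin n} → WalkIn E S u v → ℚ
walkLength ℓ (stop _) = 0ℚ
walkLength ℓ (step {u} {w} _ _ rest) = ℓ u w + walkLength ℓ rest

-- d is the shortest-path distance d_G(u,v)  (no such d iff d_G(u,v) = ∞)
IsDist : (G : Graph) → Lengths G → Fin (size G) → Fin (size G) → ℚ → Set
IsDist G ℓ u v d =
  (Σ (Walk G u v) λ w → walkLength (len ℓ) w ≡ d)
  × (∀ (w : Walk G u v) → d ≤ walkLength (len ℓ) w)

-- d_G(u,v) = d_G'(u',v')  (as values in ℚ ∪ {∞})
SameDist : (G : Graph) (ℓ : Lengths G) (u v : Fin (size G))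
           (G' : Graph) (ℓ' : Lengths G') (u' v' : Fin (size G')) → Set
SameDist G ℓ u v G' ℓ' u' v' =
  ∀ d → (IsDist G ℓ u v d → IsDist G' ℓ' u' v' d)
      × (IsDist G' ℓ' u' v' d → IsDist G ℓ u v d)

-- G' is a minor of G in which the terminals R survive, given by a
-- minor model: vertex x of G' is the contraction of the nonempty,
-- connected branch set { v | branch v ≡ just x } of G (branch sets are
-- disjoint; vertices with branch v ≡ nothing are deleted); every edge of
-- G' comes from an edge of G between the two branch sets.  Terminal R i
-- lies in the branch set of G'-vertex τ i (identified with R i), and
-- distinct terminals are not merged.

record TerminalMinor (G G' : Graph) {k : ℕ} (R : Fin k → Fin (size G)) : Set where
  field
    branch    : Fin (size G) → Maybe (Fin (size G'))
    nonempty  : ∀ x → ∃ λ v → branch v ≡ just x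
    connected : ∀ x u v → branch u ≡ just x → branch v ≡ just x →
                WalkIn (Adj G) (λ w → branch w ≡ just x) u v
    edges     : ∀ x y → Adj G' x y →
                ∃₂ λ u v → branch u ≡ just x × branch v ≡ just y × Adj G u v
    τ         : Fin k → Fin (size G')
    terminal  : ∀ i → branch (R i) ≡ just (τ i)
    τ-inj     : ∀ i j → τ i ≡ τ j → i ≡ j

record DPM (G : Graph) (ℓ : Lengths G) {k : ℕ} (R : Fin k → Fin (size G)) : Set where
  field
    G'       : Graph
    ℓ'       : Lengths G'
    minor    : TerminalMinor G G' R
  open TerminalMinor minor public
  field
    preserve : ∀ i j → SameDist G ℓ (R i) (R j) G' ℓ' (τ i) (τ j)

-- Tree decompositions of width ≤ p.
-- The tree has nodes Fin (suc m); node 0 is the root and node (suc i)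
-- has parent (parent i) whose index is ≤ i (every finite tree admits
-- such a labelling, and every such structure is a tree).

TreeAdj : {m : ℕ} (parent : Fin m → Fin (suc m)) → Fin (suc m) → Fin (suc m) → Set
TreeAdj parent a b =
  (∃ λ i → a ≡ suc i × b ≡ parent i) ⊎ (∃ λ i → b ≡ suc i × a ≡ parent i)

record TreeDecomposition (G : Graph) (p : ℕ) : Set where
  field
    m          : ℕ
    parent     : Fin m → Fin (suc m)
    parent-<   : ∀ i → toℕ (parent i) ≤ℕ toℕ i
    bag        : Fin (suc m) → Subset (size G)
    bag-size   : ∀ t → ∣ bag t ∣ ≤ℕ suc p
    vertex-cov : ∀ v → ∃ λ t → v ∈ bag t
    edge-cov   : ∀ u v → Adj G u v → ∃ λ t → u ∈ bag t × v ∈ bag t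
    coherent   : ∀ v s t → v ∈ bag s → v ∈ bag t →
                 WalkIn (TreeAdj parent) (λ r → v ∈ bag r) s t

TW : ℕ → Graph → Set
TW p G = TreeDecomposition G p

{-# OPTIONS --safe #-}
module Submission where

-- Upper bound.  Delete every edge whose removal keeps all terminal distances, and contract or delete
-- every non-terminal of degree at most two.  In the resulting minor each edge e is forced: some pair of
-- terminals has only shortest walks through e.  If B separates a vertex set S from the terminals and from
-- the rest of the graph, the edges at S ∖ B are forced already by pairs of vertices of B.  A vertex v of
-- S ∖ B has three incident edges and a fixed shortest path uses at most two of them, so v can be charged to
-- two pairs of B: the first forces an edge v → x, and the fixed shortest path of the second visits v but
-- avoids that edge.  Two vertices charged to the same pairs could be joined by a segment of the fixed path,
-- which would replace a forced edge; hence |S ∖ B| ≤ |B|⁴.  A tree decomposition of width p cuts the minor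
-- into O(k / p) such pieces with |B| = O(p).
--
-- Lower bound.  Take n disjoint rows of m + 2 cells and, for each of m inner columns, one vertex adjacent to
-- the whole column (its top), with unit lengths; the terminals are the tops and the ends of the rows.  In a
-- distance-preserving minor a shortest walk between the ends of a row cannot visit a top, so it lifts to the
-- whole row; a shortest walk from a top to an end of a row visits the cell where row and column meet.  The
-- distances on these walks force the n m cells into distinct branch sets.

open import Defs
open import Data.Nat using (ℕ; zero; suc; z≤n; s≤s; _^_) renaming (_≤_ to _≤ℕ_; _<_ to _<ℕ_; _+_ to _+ℕ_; _*_ to _*ℕ_)
import Data.Nat as ℕ
import Data.Nat.Properties as ℕₚ
open import Data.Nat.DivMod using (m≡m%n+[m/n]*n; m%n<n; m/n*n≤m)
open import Data.Nat.Tactic.RingSolver using (solve-∀)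
import Data.Integer as ℤ
import Data.Integer.Properties as ℤₚ
open import Data.Rational using (ℚ; 0ℚ; 1ℚ; _+_; _*_; _≤_; _<_; _⊓_; *≤*; *<*; toℚᵘ)
import Data.Rational as ℚ
import Data.Rational.Properties as ℚₚ
import Data.Rational.Unnormalised as ℚᵘ
import Data.Rational.Unnormalised.Properties as ℚᵘₚ
open import Data.Fin using (Fin; zero; suc; toℕ; fromℕ; fromℕ<; inject₁; punchIn; punchOut; _↑ˡ_; _↑ʳ_; splitAt; join; combine; remQuot)
import Data.Fin.Properties as Fₚ
open import Data.Fin.Subset using (Subset; _∈_; ∣_∣)
open import Data.Vec using ([]; _∷_; lookup; tabulate)
import Data.Vec.Properties as Vecₚ
open import Data.Bool using (Bool; true; false; T; not; _∧_; _∨_)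
import Data.Bool.Properties as 𝔹ₚ
open import Data.Maybe using (Maybe; just; nothing; _>>=_; is-just)
import Data.Maybe.Properties as Maybeₚ
open import Data.Product using (Σ; _×_; _,_; proj₁; proj₂; ∃; ∃₂; uncurry)
open import Data.Sum using (_⊎_; inj₁; inj₂; [_,_]′)
import Data.Sum as Sum
open import Data.Unit using (⊤; tt)
open import Data.Empty using (⊥; ⊥-elim)
open import Function using (_∘_; id; case_of_)
open import Function.Bundles using (Equivalence)
open import Function.Definitions using (Injective)
open import Relation.Nullary using (¬_; Dec; yes; no; ⌊_⌋; contradiction)
open import Relation.Nullary.Decidable using (_×-dec_; _⊎-dec_; ¬?; toWitness; fromWitness; decidable-stable)
open import Relation.Binary.PropositionalEquality using (_≡_; _≢_; refl; sym; trans; cong; cong₂; subst; subst₂; module ≡-Reasoning)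
open import Algebra.Solver.CommutativeMonoid ℚₚ.+-0-commutativeMonoid using (solve; _⊜_; _⊕_)

-- Walks

-- A single forcing pair does not identify a vertex, since one pair can force all edges of a long
-- path. The second pair of a charge supplies a shortest connection between two candidate vertices
-- that avoids both forced edges, and this makes the charging injective. The count b⁴ for a boundary
-- of size b explains the size of the pieces: with b of order p and about k / p pieces the total is
-- of order p³k, while all terminals taken as one boundary would give order k⁴. Distances can be
-- infinite, so they are compared walk by walk, and the existence of shortest walks is proved by
-- eliminating vertices; the same elimination serves in the reduction. For the lower bound the
-- obstacle is that lengths in the minor are arbitrary: only distances between terminals are known.
-- A supposed coincidence of two cells is therefore refuted by exchanging the halves of two shortest
-- walks at the common vertex. This yields walks between other pairs of terminals, and integer
-- potentials on the grid show that these would be too short.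

module _ {n : ℕ} {E : Fin n → Fin n → Set} {S : Fin n → Set} where

  infixr 5 _++ʷ_

  _++ʷ_ : ∀ {u v w} → WalkIn E S u v → WalkIn E S v w → WalkIn E S u w
  stop _     ++ʷ q = q
  step s e p ++ʷ q = step s e (p ++ʷ q)

  start-∈ : ∀ {u v} → WalkIn E S u v → S u
  start-∈ (stop s)     = s
  start-∈ (step s _ _) = s

  end-∈ : ∀ {u v} → WalkIn E S u v → S v
  end-∈ (stop s)     = s
  end-∈ (step _ _ p) = end-∈ p

  revʷ : (∀ {x y} → E x y → E y x) → ∀ {u v} → WalkIn E S u v → WalkIn E S v u
  revʷ E-sym (stop s)     = stop s
  revʷ E-sym (step s e p) = revʷ E-sym p ++ʷ step (start-∈ p) (E-sym e) (stop s)

  _∋ʷ_ : ∀ {u v} → WalkIn E S u v → Fin n → Set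
  stop {u} _     ∋ʷ x = u ≡ x
  step {u} _ _ p ∋ʷ x = u ≡ x ⊎ p ∋ʷ x

  _∋ʷ?_ : ∀ {u v} (p : WalkIn E S u v) x → Dec (p ∋ʷ x)
  stop {u} _     ∋ʷ? x = u Fₚ.≟ x
  step {u} _ _ p ∋ʷ? x = (u Fₚ.≟ x) ⊎-dec (p ∋ʷ? x)

  ∋ʷ-start : ∀ {u v} (p : WalkIn E S u v) → p ∋ʷ u
  ∋ʷ-start (stop _)     = refl
  ∋ʷ-start (step _ _ _) = inj₁ refl

  module _ (ℓ : Fin n → Fin n → ℚ) where

    length-++ : ∀ {u v w} (p : WalkIn E S u v) (q : WalkIn E S v w) →
                walkLength ℓ (p ++ʷ q) ≡ walkLength ℓ p + walkLength ℓ q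
    length-++ (stop _) q = sym (ℚₚ.+-identityˡ _)
    length-++ (step {u} {w} _ _ p) q =
      trans (cong (ℓ u w +_) (length-++ p q))
            (sym (ℚₚ.+-assoc (ℓ u w) (walkLength ℓ p) (walkLength ℓ q)))

    length-nonneg : (∀ x y → 0ℚ ≤ ℓ x y) → ∀ {u v} (p : WalkIn E S u v) → 0ℚ ≤ walkLength ℓ p
    length-nonneg ℓ≥0 (stop _)     = ℚₚ.≤-refl
    length-nonneg ℓ≥0 (step _ _ p) = ℚₚ.+-mono-≤ (ℓ≥0 _ _) (length-nonneg ℓ≥0 p)

    length-rev : (∀ x y → ℓ x y ≡ ℓ y x) → (E-sym : ∀ {x y} → E x y → E y x) →
                 ∀ {u v} (p : WalkIn E S u v) → walkLength ℓ (revʷ E-sym p) ≡ walkLength ℓ p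
    length-rev ℓ-sym E-sym (stop _) = refl
    length-rev ℓ-sym E-sym (step {u} {w} s e p) = begin
      walkLength ℓ (revʷ E-sym p ++ʷ step (start-∈ p) (E-sym e) (stop s))
        ≡⟨ length-++ (revʷ E-sym p) _ ⟩
      walkLength ℓ (revʷ E-sym p) + (ℓ w u + 0ℚ)
        ≡⟨ cong₂ _+_ (length-rev ℓ-sym E-sym p) (trans (ℚₚ.+-identityʳ _) (ℓ-sym w u)) ⟩
      walkLength ℓ p + ℓ u w
        ≡⟨ ℚₚ.+-comm (walkLength ℓ p) (ℓ u w) ⟩
      ℓ u w + walkLength ℓ p ∎
      where open ≡-Reasoning

    splitʷ : ∀ {u v x} (p : WalkIn E S u v) → p ∋ʷ x →
             Σ (WalkIn E S u x) λ q → Σ (WalkIn E S x v) λ r →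
               (walkLength ℓ p ≡ walkLength ℓ q + walkLength ℓ r)
               × (∀ {y} → p ∋ʷ y → q ∋ʷ y ⊎ r ∋ʷ y)
    splitʷ (stop s) refl = stop s , stop s , refl , inj₁
    splitʷ p@(step s e _) (inj₁ refl) = stop s , p , sym (ℚₚ.+-identityˡ _) , inj₂
    splitʷ (step {u} {w} s e p) (inj₂ x∈p) with splitʷ p x∈p
    ... | q , r , len≡ , mem =
      step s e q , r , trans (cong (ℓ u w +_) len≡) (sym (ℚₚ.+-assoc (ℓ u w) (walkLength ℓ q) (walkLength ℓ r))) ,
      λ { (inj₁ u≡y) → inj₁ (inj₁ u≡y) ; (inj₂ y∈p) → Sum.map₁ inj₂ (mem y∈p) }

module _ {n : ℕ} {E E′ : Fin n → Fin n → Set} {S S′ : Fin n → Set}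
         (f : ∀ {x y} → E x y → E′ x y) (g : ∀ {x} → S x → S′ x) where

  mapʷ : ∀ {u v} → WalkIn E S u v → WalkIn E′ S′ u v
  mapʷ (stop s)     = stop (g s)
  mapʷ (step s e p) = step (g s) (f e) (mapʷ p)

  length-map : ∀ ℓ {u v} (p : WalkIn E S u v) → walkLength ℓ (mapʷ p) ≡ walkLength ℓ p
  length-map ℓ (stop _) = refl
  length-map ℓ (step {u} {w} _ _ p) = cong (ℓ u w +_) (length-map ℓ p)

  ∋ʷ-map : ∀ {u v x} (p : WalkIn E S u v) → p ∋ʷ x → mapʷ p ∋ʷ x
  ∋ʷ-map (stop _) x∈p = x∈p
  ∋ʷ-map (step _ _ p) = Sum.map₂ (∋ʷ-map p)

SameEdge : ∀ {n} (a b x y : Fin n) → Set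
SameEdge a b x y = (a ≡ x × b ≡ y) ⊎ (a ≡ y × b ≡ x)

sameEdge? : ∀ {n} (a b x y : Fin n) → Dec (SameEdge a b x y)
sameEdge? a b x y =
  ((a Fₚ.≟ x) ×-dec (b Fₚ.≟ y)) ⊎-dec ((a Fₚ.≟ y) ×-dec (b Fₚ.≟ x))

SameEdge-swap : ∀ {n} {a b x y : Fin n} → SameEdge a b x y → SameEdge a b y x
SameEdge-swap = Sum.swap

infix 5 _∖⟨_,_⟩

_∖⟨_,_⟩ : ∀ {n} → (Fin n → Fin n → Set) → Fin n → Fin n → Fin n → Fin n → Set
(E ∖⟨ a , b ⟩) x y = E x y × ¬ SameEdge a b x y

∖-sym : ∀ {n} {E : Fin n → Fin n → Set} {a b} → (∀ {x y} → E x y → E y x) →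
        ∀ {x y} → (E ∖⟨ a , b ⟩) x y → (E ∖⟨ a , b ⟩) y x
∖-sym E-sym (e , ne) = E-sym e , ne ∘ SameEdge-swap

module _ {n : ℕ} {E : Fin n → Fin n → Set} {S : Fin n → Set} where

  Uses : ∀ {u v} → WalkIn E S u v → Fin n → Fin n → Set
  Uses (stop _)           a b = ⊥
  Uses (step {u} {w} _ _ p) a b = SameEdge a b u w ⊎ Uses p a b

  uses? : ∀ {u v} (p : WalkIn E S u v) a b → Dec (Uses p a b)
  uses? (stop _)             a b = no λ ()
  uses? (step {u} {w} _ _ p) a b = sameEdge? a b u w ⊎-dec uses? p a b

  Uses⇒∋ : ∀ {u v a b} (p : WalkIn E S u v) → Uses p a b → p ∋ʷ a
  Uses⇒∋ (step _ _ p) (inj₁ (inj₁ (refl , _))) = inj₁ refl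
  Uses⇒∋ (step _ _ p) (inj₁ (inj₂ (refl , _))) = inj₂ (∋ʷ-start p)
  Uses⇒∋ (step _ _ p) (inj₂ uses) = inj₂ (Uses⇒∋ p uses)

  avoidʷ : ∀ {u v a b} (p : WalkIn E S u v) → ¬ Uses p a b →
           Σ (WalkIn (E ∖⟨ a , b ⟩) S u v) λ q →
             (∀ ℓ → walkLength ℓ q ≡ walkLength ℓ p) × (∀ {x} → p ∋ʷ x → q ∋ʷ x)
  avoidʷ (stop s) _ = stop s , (λ _ → refl) , id
  avoidʷ (step {u} {w} s e p) ne with avoidʷ p (ne ∘ inj₂)
  ... | q , len≡ , mem =
    step s (e , ne ∘ inj₁) q , (λ ℓ → cong (ℓ u w +_) (len≡ ℓ)) , Sum.map₂ mem

  forgetʷ : ∀ {a b u v} → WalkIn (E ∖⟨ a , b ⟩) S u v → WalkIn E S u v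
  forgetʷ = mapʷ proj₁ id

Adj-sym : ∀ (G : Graph) {x y} → Adj G x y → Adj G y x
Adj-sym G {x} {y} = subst T (adj-sym G x y)

Adj-irrefl : ∀ (G : Graph) {x y} → Adj G x y → x ≢ y
Adj-irrefl G {x} e refl = subst T (adj-irrefl G x) e

Minimal : ∀ {n} {E : Fin n → Fin n → Set} {S} (ℓ : Fin n → Fin n → ℚ) {u v} →
          WalkIn E S u v → Set
Minimal {E = E} {S} ℓ {u} {v} p = ∀ (q : WalkIn E S u v) → walkLength ℓ p ≤ walkLength ℓ q

-- Counting

∑ : ∀ {n} → (Fin n → ℕ) → ℕ
∑ {zero}  f = 0
∑ {suc n} f = f zero +ℕ ∑ (f ∘ suc)

∑-mono : ∀ {n} {f g : Fin n → ℕ} → (∀ i → f i ≤ℕ g i) → ∑ f ≤ℕ ∑ g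
∑-mono {zero}  f≤g = z≤n
∑-mono {suc n} f≤g = ℕₚ.+-mono-≤ (f≤g zero) (∑-mono (f≤g ∘ suc))

∑-mono-< : ∀ {n} {f g : Fin n → ℕ} → (∀ i → f i ≤ℕ g i) → ∀ i → f i <ℕ g i → ∑ f <ℕ ∑ g
∑-mono-< f≤g zero    f<g = ℕₚ.+-mono-<-≤ f<g (∑-mono (f≤g ∘ suc))
∑-mono-< f≤g (suc i) f<g = ℕₚ.+-mono-≤-< (f≤g zero) (∑-mono-< (f≤g ∘ suc) i f<g)

∑-+ : ∀ {n} (f g : Fin n → ℕ) → ∑ (λ i → f i +ℕ g i) ≡ ∑ f +ℕ ∑ g
∑-+ {zero}  f g = refl
∑-+ {suc n} f g rewrite ∑-+ (f ∘ suc) (g ∘ suc) =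
  interchange (f zero) (g zero) (∑ (f ∘ suc)) (∑ (g ∘ suc))
  where
  interchange : ∀ a b c d → (a +ℕ b) +ℕ (c +ℕ d) ≡ (a +ℕ c) +ℕ (b +ℕ d)
  interchange = solve-∀

# : Bool → ℕ
# true  = 1
# false = 0

#-mono : ∀ {a b} → (T a → T b) → # a ≤ℕ # b
#-mono {false} {b}     a⇒b = z≤n
#-mono {true}  {true}  a⇒b = s≤s z≤n
#-mono {true}  {false} a⇒b = ⊥-elim (a⇒b tt)

count : ∀ {n} → (Fin n → Bool) → ℕ
count f = ∑ (# ∘ f)

count-mono : ∀ {n} {f g : Fin n → Bool} → (∀ i → T (f i) → T (g i)) → count f ≤ℕ count g
count-mono f⇒g = ∑-mono (λ i → #-mono (f⇒g i))

count-mono-+ : ∀ {n} {f g h k : Fin n → Bool} →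
               (∀ i → # (f i) +ℕ # (g i) ≤ℕ # (h i) +ℕ # (k i)) →
               count f +ℕ count g ≤ℕ count h +ℕ count k
count-mono-+ {f = f} {g} {h} {k} le =
  subst₂ _≤ℕ_ (∑-+ (# ∘ f) (# ∘ g)) (∑-+ (# ∘ h) (# ∘ k)) (∑-mono le)

count-∨ : ∀ {n} {f g h : Fin n → Bool} → (∀ i → T (f i) → T (g i) ⊎ T (h i)) →
          count f ≤ℕ count g +ℕ count h
count-∨ {f = f} {g} {h} f⇒g∨h =
  subst (count f ≤ℕ_) (∑-+ (# ∘ g) (# ∘ h)) (∑-mono λ i → le (f⇒g∨h i))
  where
  le : ∀ {a b c} → (T a → T b ⊎ T c) → # a ≤ℕ # b +ℕ # c
  le {false} _ = z≤n
  le {true} {true}  _ = s≤s z≤n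
  le {true} {false} {true}  _ = s≤s z≤n
  le {true} {false} {false} a⇒ = ⊥-elim ([ id , id ]′ (a⇒ tt))

count-all : ∀ n → count {n} (λ _ → true) ≡ n
count-all zero    = refl
count-all (suc n) = cong suc (count-all n)

∣∣≡count : ∀ {n} (s : Subset n) → ∣ s ∣ ≡ count (lookup s)
∣∣≡count []          = refl
∣∣≡count (true  ∷ s) = cong suc (∣∣≡count s)
∣∣≡count (false ∷ s) = ∣∣≡count s

∣tabulate∣≡count : ∀ {n} (f : Fin n → Bool) → ∣ tabulate f ∣ ≡ count f
∣tabulate∣≡count {zero} f = refl
∣tabulate∣≡count {suc n} f with f zero
... | true  = cong suc (∣tabulate∣≡count (f ∘ suc))
... | false = ∣tabulate∣≡count (f ∘ suc)

count-injection : ∀ {n N} (f : Fin n → Bool) (g : ∀ i → T (f i) → Fin N) →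
                  (∀ i j fi fj → g i fi ≡ g j fj → i ≡ j) → count f ≤ℕ N
count-injection {zero} f g g-inj = z≤n
count-injection {suc n} f g g-inj with f zero in eq
... | false = count-injection (f ∘ suc) (g ∘ suc)
                (λ i j fi fj e → Fₚ.suc-injective (g-inj (suc i) (suc j) fi fj e))
count-injection {suc n} {zero}  f g g-inj | true = ⊥-elim (Fₚ.¬Fin0 (g zero (subst T (sym eq) tt)))
count-injection {suc n} {suc N} f g g-inj | true =
  s≤s (count-injection (f ∘ suc) (λ i fi → punchOut (g₀≢g i fi))
    (λ i j fi fj e → Fₚ.suc-injective
      (g-inj (suc i) (suc j) fi fj (Fₚ.punchOut-injective (g₀≢g i fi) (g₀≢g j fj) e))))
  where
  f₀ : T (f zero)
  f₀ = subst T (sym eq) tt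
  g₀≢g : ∀ i fi → g zero f₀ ≢ g (suc i) fi
  g₀≢g i fi e = Fₚ.0≢1+n (g-inj zero (suc i) f₀ fi e)

rank : ∀ {n} (f : Fin n → Bool) → ∀ i → T (f i) → Fin (count f)
rank f zero fi with f zero
... | true = zero
rank f (suc i) fi with f zero
... | true  = suc (rank (f ∘ suc) i fi)
... | false = rank (f ∘ suc) i fi

rank-injective : ∀ {n} (f : Fin n → Bool) i j fi fj → rank f i fi ≡ rank f j fj → i ≡ j
rank-injective f zero zero fi fj e = refl
rank-injective f zero (suc j) fi fj e with f zero
rank-injective f zero (suc j) fi fj () | true
rank-injective f (suc i) zero fi fj e with f zero
rank-injective f (suc i) zero fi fj () | true
rank-injective f (suc i) (suc j) fi fj e with f zero
... | true  = cong suc (rank-injective (f ∘ suc) i j fi fj (Fₚ.suc-injective e))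
... | false = cong suc (rank-injective (f ∘ suc) i j fi fj e)

T-∧⁻ : ∀ {a b} → T (a ∧ b) → T a × T b
T-∧⁻ = Equivalence.to 𝔹ₚ.T-∧

T-∧⁺ : ∀ {a b} → T a × T b → T (a ∧ b)
T-∧⁺ = Equivalence.from 𝔹ₚ.T-∧

T-∨⁻ : ∀ {a b} → T (a ∨ b) → T a ⊎ T b
T-∨⁻ = Equivalence.to 𝔹ₚ.T-∨

T-∨⁺ : ∀ {a b} → T a ⊎ T b → T (a ∨ b)
T-∨⁺ = Equivalence.from 𝔹ₚ.T-∨

∈-tabulate⁺ : ∀ {n} (f : Fin n → Bool) {v} → T (f v) → v ∈ tabulate f
∈-tabulate⁺ f {v} fv =
  Vecₚ.lookup⇒[]= v (tabulate f) (trans (Vecₚ.lookup∘tabulate f v) (Equivalence.to 𝔹ₚ.T-≡ fv))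

∈-tabulate⁻ : ∀ {n} (f : Fin n → Bool) {v} → v ∈ tabulate f → T (f v)
∈-tabulate⁻ f {v} v∈ =
  Equivalence.from 𝔹ₚ.T-≡ (trans (sym (Vecₚ.lookup∘tabulate f v)) (Vecₚ.[]=⇒lookup v∈))

⌊⌋-cong : ∀ {P Q : Set} (P? : Dec P) (Q? : Dec Q) → (P → Q) → (Q → P) → ⌊ P? ⌋ ≡ ⌊ Q? ⌋
⌊⌋-cong (yes p) (yes q) f g = refl
⌊⌋-cong (yes p) (no ¬q) f g = contradiction (f p) ¬q
⌊⌋-cong (no ¬p) (yes q) f g = contradiction (g q) ¬p
⌊⌋-cong (no ¬p) (no ¬q) f g = refl

-- Vertex elimination and shortest walks

Full : ∀ {n} → Fin n → Set
Full _ = ⊤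

-- Junk value q when both flags are false.
detour : Bool → Bool → ℚ → ℚ → ℚ
detour true  true  p q = p ⊓ q
detour true  false p q = p
detour false _     p q = q

detour-sel : ∀ b c {p q} → T (b ∨ c) → (T b × detour b c p q ≡ p) ⊎ (T c × detour b c p q ≡ q)
detour-sel true  true  {p} {q} _ = Sum.map (tt ,_) (tt ,_) (ℚₚ.⊓-sel p q)
detour-sel true  false _ = inj₁ (tt , refl)
detour-sel false true  _ = inj₂ (tt , refl)

detour≤ˡ : ∀ b c {p q} → T b → detour b c p q ≤ p
detour≤ˡ true true  {p} {q} _ = ℚₚ.p⊓q≤p p q
detour≤ˡ true false _ = ℚₚ.≤-refl

detour≤ʳ : ∀ b c {p q} → T c → detour b c p q ≤ q
detour≤ʳ true  true {p} {q} _ = ℚₚ.p⊓q≤q p q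
detour≤ʳ false true _ = ℚₚ.≤-refl

detour-nonneg : ∀ b c {p q} → 0ℚ ≤ p → 0ℚ ≤ q → 0ℚ ≤ detour b c p q
detour-nonneg true  true  0≤p 0≤q = ℚₚ.⊓-glb 0≤p 0≤q
detour-nonneg true  false 0≤p 0≤q = 0≤p
detour-nonneg false _     0≤p 0≤q = 0≤q

-- Replacing z by a clique on its neighbours preserves all other distances.
module Eliminate {n : ℕ} (a : Fin (suc n) → Fin (suc n) → Bool)
                 (ℓ : Fin (suc n) → Fin (suc n) → ℚ) (z : Fin (suc n)) where

  private
    ι : Fin n → Fin (suc n)
    ι = punchIn z

  E : Fin (suc n) → Fin (suc n) → Set
  E x y = T (a x y)

  joined : Fin n → Fin n → Bool
  joined x y = a (ι x) (ι y) ∨ (a (ι x) z ∧ a z (ι y))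

  adj′ : Fin n → Fin n → Bool
  adj′ x y = not ⌊ x Fₚ.≟ y ⌋ ∧ joined x y

  len′ : Fin n → Fin n → ℚ
  len′ x y = detour (a (ι x) (ι y)) (a (ι x) z ∧ a z (ι y)) (ℓ (ι x) (ι y)) (ℓ (ι x) z + ℓ z (ι y))

  E′ : Fin n → Fin n → Set
  E′ x y = T (adj′ x y)

  adj′-intro : ∀ {x y} → x ≢ y → T (joined x y) → E′ x y
  adj′-intro {x} {y} x≢y j with x Fₚ.≟ y
  ... | yes x≡y = contradiction x≡y x≢y
  ... | no  _   = j

  adj′-elim : ∀ {x y} → E′ x y → x ≢ y × T (joined x y)
  adj′-elim {x} {y} e with x Fₚ.≟ y
  ... | no x≢y = x≢y , e

  z-or-ι : ∀ u → u ≡ z ⊎ ∃ λ x → u ≡ ι x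
  z-or-ι u with z Fₚ.≟ u
  ... | yes z≡u = inj₁ (sym z≡u)
  ... | no  z≢u = inj₂ (punchOut z≢u , sym (Fₚ.punchIn-punchOut z≢u))

  -- Every new edge expands to the direct edge or to the two steps through `z`, whichever `detour`
  -- selected, so the lengths agree exactly.
  up : ∀ {x y} (p : WalkIn E′ Full x y) →
       Σ (WalkIn E Full (ι x) (ι y)) λ q → walkLength ℓ q ≡ walkLength len′ p
  up (stop _) = stop tt , refl
  up (step {x} {w} _ e p) with up p | detour-sel (a (ι x) (ι w)) (a (ι x) z ∧ a z (ι w))
                                                 {ℓ (ι x) (ι w)} {ℓ (ι x) z + ℓ z (ι w)}
                                                 (proj₂ (adj′-elim e))
  ... | q , q≡p | inj₁ (direct , len≡) =
    step tt direct q , cong₂ _+_ (sym len≡) q≡p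
  ... | q , q≡p | inj₂ (via-z , len≡) with T-∧⁻ via-z
  ...   | e₁ , e₂ = step tt e₁ (step tt e₂ q) ,
          trans (sym (ℚₚ.+-assoc (ℓ (ι x) z) (ℓ z (ι w)) (walkLength ℓ q)))
                (cong₂ _+_ (sym len≡) q≡p)

  module _ (irrefl : ∀ {x y} → E x y → x ≢ y) (ℓ≥0 : ∀ x y → 0ℚ ≤ ℓ x y) where

    -- The second component treats a walk that stands at `z` and remembers its predecessor `x`. If
    -- the walk returns from `z` to `x`, the excursion is dropped, which is where nonnegativity of
    -- lengths enters.
    down-aux : ∀ {u v y} (p : WalkIn E Full u v) → v ≡ ι y →
      (∀ x → u ≡ ι x → Σ (WalkIn E′ Full x y) λ q → walkLength len′ q ≤ walkLength ℓ p) ×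
      (u ≡ z → ∀ x → E (ι x) z →
         Σ (WalkIn E′ Full x y) λ q → walkLength len′ q ≤ ℓ (ι x) z + walkLength ℓ p)
    down-aux {y = y} (stop _) v≡ =
      (λ x u≡ → subst (λ y → Σ (WalkIn E′ Full x y) λ q → walkLength len′ q ≤ 0ℚ)
                      (Fₚ.punchIn-injective z x y (trans (sym u≡) v≡)) (stop tt , ℚₚ.≤-refl)) ,
      (λ u≡z _ _ → contradiction (trans (sym v≡) u≡z) (Fₚ.punchInᵢ≢i z y))
    down-aux {y = y} (step {_} {w} _ e p) v≡ with down-aux p v≡ | z-or-ι w
    ... | from-ι , from-z | inj₁ refl =
      (λ { x refl → from-z refl x e }) ,
      (λ { refl _ _ → contradiction refl (irrefl e) })
    ... | from-ι , from-z | inj₂ (w′ , refl) with from-ι w′ refl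
    ...   | q , q≤p = direct , bypass
      where
      direct : ∀ x → _ ≡ ι x → _
      direct x refl =
        step tt (adj′-intro (irrefl e ∘ cong ι) (T-∨⁺ (inj₁ e))) q ,
        ℚₚ.+-mono-≤ (detour≤ˡ (a (ι x) (ι w′)) _ e) q≤p
      bypass : _ ≡ z → ∀ x → E (ι x) z → _
      bypass refl x e₀ with x Fₚ.≟ w′
      ... | yes refl = q , (begin
              walkLength len′ q ≤⟨ q≤p ⟩
              walkLength ℓ p ≡⟨ trans (cong (_+ walkLength ℓ p) (ℚₚ.+-identityˡ 0ℚ)) (ℚₚ.+-identityˡ _) ⟨
              (0ℚ + 0ℚ) + walkLength ℓ p
                ≤⟨ ℚₚ.+-monoˡ-≤ (walkLength ℓ p) (ℚₚ.+-mono-≤ (ℓ≥0 (ι x) z) (ℓ≥0 z (ι x))) ⟩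
              (ℓ (ι x) z + ℓ z (ι x)) + walkLength ℓ p ≡⟨ ℚₚ.+-assoc (ℓ (ι x) z) (ℓ z (ι x)) _ ⟩
              ℓ (ι x) z + (ℓ z (ι x) + walkLength ℓ p) ∎)
        where open ℚₚ.≤-Reasoning
      ... | no x≢w′ = step tt (adj′-intro x≢w′ (T-∨⁺ {a (ι x) (ι w′)} (inj₂ e₀e))) q , (begin
              len′ x w′ + walkLength len′ q
                ≤⟨ ℚₚ.+-mono-≤ (detour≤ʳ (a (ι x) (ι w′)) (a (ι x) z ∧ a z (ι w′)) e₀e) q≤p ⟩
              (ℓ (ι x) z + ℓ z (ι w′)) + walkLength ℓ p ≡⟨ ℚₚ.+-assoc (ℓ (ι x) z) (ℓ z (ι w′)) _ ⟩
              ℓ (ι x) z + (ℓ z (ι w′) + walkLength ℓ p) ∎)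
        where
        open ℚₚ.≤-Reasoning
        e₀e : T (a (ι x) z ∧ a z (ι w′))
        e₀e = T-∧⁺ (e₀ , e)

    down : ∀ {x y} (p : WalkIn E Full (ι x) (ι y)) →
           Σ (WalkIn E′ Full x y) λ q → walkLength len′ q ≤ walkLength ℓ p
    down p = proj₁ (down-aux p refl) _ refl

    len′-nonneg : ∀ x y → 0ℚ ≤ len′ x y
    len′-nonneg x y = detour-nonneg (a (ι x) (ι y)) _ (ℓ≥0 _ _) (ℚₚ.+-mono-≤ (ℓ≥0 _ _) (ℓ≥0 _ _))

-- Induction on the number of vertices: any vertex other than `u` and `v` is eliminated. When none
-- is left, a walk between distinct ends must begin with the edge from `u` to `v`.
shortest : ∀ {n} (a : Fin n → Fin n → Bool) (ℓ : Fin n → Fin n → ℚ) →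
           (∀ {x y} → T (a x y) → x ≢ y) → (∀ x y → 0ℚ ≤ ℓ x y) → ∀ u v →
           ¬ WalkIn (λ x y → T (a x y)) Full u v ⊎ Σ (WalkIn (λ x y → T (a x y)) Full u v) (Minimal ℓ)
shortest a ℓ irrefl ℓ≥0 u v with Fₚ.any? (λ z → ¬? (z Fₚ.≟ u) ×-dec ¬? (z Fₚ.≟ v))
shortest {suc n} a ℓ irrefl ℓ≥0 u v | yes (z , z≢u , z≢v)
  with shortest adj′ len′ (proj₁ ∘ adj′-elim) (len′-nonneg irrefl ℓ≥0) (punchOut z≢u) (punchOut z≢v)
     | Fₚ.punchIn-punchOut z≢u | Fₚ.punchIn-punchOut z≢v
  where open Eliminate a ℓ z
... | inj₁ none | u≡ | v≡ = inj₁ λ p → none (proj₁ (down irrefl ℓ≥0 (subst₂ (WalkIn _ _) (sym u≡) (sym v≡) p)))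
  where open Eliminate a ℓ z
... | inj₂ (p , p-min) | u≡ | v≡ =
  inj₂ (subst₂ (λ u v → Σ (WalkIn _ _ u v) (Minimal ℓ)) u≡ v≡ (proj₁ (up p) , λ q → begin
    walkLength ℓ (proj₁ (up p)) ≡⟨ proj₂ (up p) ⟩
    walkLength len′ p ≤⟨ p-min (proj₁ (down irrefl ℓ≥0 q)) ⟩
    walkLength len′ (proj₁ (down irrefl ℓ≥0 q)) ≤⟨ proj₂ (down irrefl ℓ≥0 q) ⟩
    walkLength ℓ q ∎))
  where
  open Eliminate a ℓ z
  open ℚₚ.≤-Reasoning
shortest a ℓ irrefl ℓ≥0 u v | no others with u Fₚ.≟ v
... | yes refl = inj₂ (stop tt , length-nonneg ℓ ℓ≥0)
... | no u≢v = u≢v-case (𝔹ₚ.T? (a u v))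
  where
  to-v : ∀ {w} → T (a u w) → w ≡ v
  to-v {w} e with w Fₚ.≟ v
  ... | yes w≡v = w≡v
  ... | no  w≢v = contradiction (w , irrefl e ∘ sym , w≢v) others
  u≢v-case : Dec (T (a u v)) → _
  u≢v-case (no ¬e) = inj₁ λ { (stop _) → u≢v refl ; (step _ e _) → ¬e (subst (T ∘ a u) (to-v e) e) }
  u≢v-case (yes e) = inj₂ (step tt e (stop tt) , minimal)
    where
    minimal : Minimal ℓ (step tt e (stop tt))
    minimal (stop _) = contradiction refl u≢v
    minimal (step _ e′ q) rewrite to-v e′ = ℚₚ.+-monoʳ-≤ (ℓ u v) (length-nonneg ℓ ℓ≥0 q)

shortestWalk : ∀ (G : Graph) (ℓ : Lengths G) u v → ¬ Walk G u v ⊎ Σ (Walk G u v) (Minimal (len ℓ))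
shortestWalk G ℓ = shortest (adj G) (len ℓ) (Adj-irrefl G) (len-nonneg ℓ)

-- Distances and minors

-- Encodes that the distance in `H` is at most the distance in `G`, with value ∞ allowed on either
-- side.
Dominates : (G : Graph) (ℓ : Lengths G) (u v : Fin (size G))
            (H : Graph) (ℓ′ : Lengths H) (x y : Fin (size H)) → Set
Dominates G ℓ u v H ℓ′ x y =
  ∀ (p : Walk G u v) → Σ (Walk H x y) λ q → walkLength (len ℓ′) q ≤ walkLength (len ℓ) p

SameDist-sym : ∀ G ℓ u v H ℓ′ x y → SameDist G ℓ u v H ℓ′ x y → SameDist H ℓ′ x y G ℓ u v
SameDist-sym G ℓ u v H ℓ′ x y same d = proj₂ (same d) , proj₁ (same d)

-- `SameDist` speaks of attained minima only, so an arbitrary walk has to be compared with a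
-- shortest one first.
SameDist⇒Dominates : ∀ G ℓ u v H ℓ′ x y → SameDist G ℓ u v H ℓ′ x y → Dominates G ℓ u v H ℓ′ x y
SameDist⇒Dominates G ℓ u v H ℓ′ x y same p with shortestWalk G ℓ u v
... | inj₁ none = contradiction p none
... | inj₂ (b , b-min) with proj₁ (same (walkLength (len ℓ) b)) ((b , refl) , b-min)
...   | (q , q≡b) , _ = q , ℚₚ.≤-trans (ℚₚ.≤-reflexive q≡b) (b-min p)

Dominates⇒IsDist : ∀ G ℓ u v H ℓ′ x y →
                   Dominates G ℓ u v H ℓ′ x y → Dominates H ℓ′ x y G ℓ u v →
                   ∀ d → IsDist G ℓ u v d → IsDist H ℓ′ x y d
Dominates⇒IsDist G ℓ u v H ℓ′ x y to from d ((p , p≡d) , d-min) =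
  (q , ℚₚ.≤-antisym (ℚₚ.≤-trans q≤p (ℚₚ.≤-reflexive p≡d)) (d-min′ q)) , d-min′
  where
  q   = proj₁ (to p)
  q≤p = proj₂ (to p)
  d-min′ : ∀ r → d ≤ walkLength (len ℓ′) r
  d-min′ r = ℚₚ.≤-trans (d-min (proj₁ (from r))) (proj₂ (from r))

Dominates⇒SameDist : ∀ G ℓ u v H ℓ′ x y →
                     Dominates G ℓ u v H ℓ′ x y → Dominates H ℓ′ x y G ℓ u v →
                     SameDist G ℓ u v H ℓ′ x y
Dominates⇒SameDist G ℓ u v H ℓ′ x y to from d =
  Dominates⇒IsDist G ℓ u v H ℓ′ x y to from d , Dominates⇒IsDist H ℓ′ x y G ℓ u v from to d

SameDist-trans : ∀ G ℓ u v H ℓ′ x y K ℓ″ s t → SameDist G ℓ u v H ℓ′ x y →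
                 SameDist H ℓ′ x y K ℓ″ s t → SameDist G ℓ u v K ℓ″ s t
SameDist-trans G ℓ u v H ℓ′ x y K ℓ″ s t f g d =
  proj₁ (g d) ∘ proj₁ (f d) , proj₂ (f d) ∘ proj₂ (g d)

-- Recording the visited vertices in the type lets a lifted walk remember which vertices of the
-- minor it lies over.
withinʷ : ∀ {n} {E : Fin n → Fin n → Set} {S : Fin n → Set} {u v} (p : WalkIn E S u v) →
          WalkIn E (p ∋ʷ_) u v
withinʷ (stop _)     = stop refl
withinʷ (step _ e p) = step (inj₁ refl) e (mapʷ id inj₂ (withinʷ p))

module _ {G H : Graph} {k : ℕ} {R : Fin k → Fin (size G)} (M : TerminalMinor G H R) where
  open TerminalMinor M

  Over : (Fin (size H) → Set) → Fin (size G) → Set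
  Over S g = ∃ λ x → branch g ≡ just x × S x

  -- Each edge of the minor comes from an edge of `G`, and the gaps between consecutive ones are
  -- filled inside the connected branch sets.
  liftʷ : ∀ {S x y u v} → WalkIn (Adj H) S x y → branch u ≡ just x → branch v ≡ just y →
          WalkIn (Adj G) (Over S) u v
  liftʷ (stop {x} s) u∈ v∈ = mapʷ id (λ g∈ → x , g∈ , s) (connected x _ _ u∈ v∈)
  liftʷ (step {x} {w} s e p) u∈ v∈ with edges x w e
  ... | a , b , a∈ , b∈ , ab =
    mapʷ id (λ g∈ → x , g∈ , s) (connected x _ a u∈ a∈) ++ʷ step (x , a∈ , s) ab (liftʷ p b∈ v∈)

  splits-over : ∀ ℓ {x y} (p : Walk H x y) {g} → Over (p ∋ʷ_) g →
                ∃ λ z → branch g ≡ just z × Σ (Walk H x z) λ q → Σ (Walk H z y) λ r →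
                  walkLength ℓ p ≡ walkLength ℓ q + walkLength ℓ r
  splits-over ℓ p (z , g∈ , z∈p) with splitʷ ℓ p z∈p
  ... | q , r , len≡ , _ = z , g∈ , q , r , len≡

>>=-just : ∀ {A B : Set} {f : A → Maybe B} {z} (m : Maybe A) → (m >>= f) ≡ just z →
           ∃ λ y → m ≡ just y × f y ≡ just z
>>=-just (just y) eq = y , refl , eq

>>=-intro : ∀ {A B : Set} {f : A → Maybe B} {y z} {m : Maybe A} → m ≡ just y → f y ≡ just z → (m >>= f) ≡ just z
>>=-intro refl eq = eq

identityMinor : ∀ (G : Graph) {k} {R : Fin k → Fin (size G)} → Injective _≡_ _≡_ R → TerminalMinor G G R
identityMinor G {R = R} R-inj = record
  { branch    = just
  ; nonempty  = λ x → x , refl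
  ; connected = λ { x .x .x refl refl → stop refl }
  ; edges     = λ x y e → x , y , refl , refl , e
  ; τ         = R
  ; terminal  = λ i → refl
  ; τ-inj     = λ i j → R-inj
  }

composeMinor : ∀ {G H K : Graph} {k} {R : Fin k → Fin (size G)} (M : TerminalMinor G H R) →
               TerminalMinor H K (TerminalMinor.τ M) → TerminalMinor G K R
composeMinor {G} {H} {K} M M′ = record
  { branch    = λ g → M.branch g >>= M′.branch
  ; nonempty  = λ x → let y , y∈ = M′.nonempty x ; g , g∈ = M.nonempty y in g , >>=-intro g∈ y∈
  ; connected = connected
  ; edges     = edges
  ; τ         = M′.τ
  ; terminal  = λ i → >>=-intro (M.terminal i) (M′.terminal i)
  ; τ-inj     = M′.τ-inj
  }
  where
  module M  = TerminalMinor M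
  module M′ = TerminalMinor M′
  connected : ∀ x u v → (M.branch u >>= M′.branch) ≡ just x → (M.branch v >>= M′.branch) ≡ just x →
              WalkIn (Adj G) (λ g → (M.branch g >>= M′.branch) ≡ just x) u v
  connected x u v u∈ v∈ with >>=-just (M.branch u) u∈ | >>=-just (M.branch v) v∈
  ... | y , u∈y , y∈ | y′ , v∈y′ , y′∈ =
    mapʷ id (λ (z , g∈ , z∈) → >>=-intro g∈ z∈) (liftʷ M (M′.connected x y y′ y∈ y′∈) u∈y v∈y′)
  edges : ∀ x y → Adj K x y → ∃₂ λ u v → (M.branch u >>= M′.branch) ≡ just x ×
                                         (M.branch v >>= M′.branch) ≡ just y × Adj G u v
  edges x y e with M′.edges x y e
  ... | a , b , a∈ , b∈ , ab with M.edges a b ab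
  ...   | u , v , u∈ , v∈ , uv = u , v , >>=-intro u∈ a∈ , >>=-intro v∈ b∈ , uv

identityDPM : ∀ (G : Graph) (ℓ : Lengths G) {k} {R : Fin k → Fin (size G)} → Injective _≡_ _≡_ R → DPM G ℓ R
identityDPM G ℓ R-inj = record
  { G' = G ; ℓ' = ℓ ; minor = identityMinor G R-inj ; preserve = λ i j d → id , id }

composeDPM : ∀ {G H : Graph} {ℓ : Lengths G} {ℓ′ : Lengths H} {k} {R : Fin k → Fin (size G)}
             (M : TerminalMinor G H R) (let open TerminalMinor M) →
             (∀ i j → SameDist G ℓ (R i) (R j) H ℓ′ (τ i) (τ j)) → DPM H ℓ′ τ → DPM G ℓ R
composeDPM {G} {H} {ℓ} {ℓ′} {R = R} M same D = record
  { G' = D.G' ; ℓ' = D.ℓ' ; minor = composeMinor M D.minor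
  ; preserve = λ i j → SameDist-trans G ℓ (R i) (R j) H ℓ′ (τ i) (τ j) D.G' D.ℓ' (D.τ i) (D.τ j)
                         (same i j) (D.preserve i j) }
  where
  open TerminalMinor M
  module D = DPM D

every-or-some : ∀ {n} {P Q : Fin n → Set} → (∀ i → P i ⊎ Q i) → (∀ i → P i) ⊎ ∃ Q
every-or-some {zero}  f = inj₁ λ ()
every-or-some {suc n} f with f zero | every-or-some (f ∘ suc)
... | inj₂ q | _            = inj₂ (zero , q)
... | inj₁ p | inj₂ (i , q) = inj₂ (suc i , q)
... | inj₁ p | inj₁ ps      = inj₁ λ { zero → p ; (suc i) → ps i }

-- Edge deletion

deleteEdge : (G : Graph) (a b : Fin (size G)) → Graph
deleteEdge G a b = record
  { size = size G
  ; adj = λ x y → adj G x y ∧ not ⌊ sameEdge? a b x y ⌋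
  ; adj-sym = λ x y → cong₂ _∧_ (adj-sym G x y) (cong not
      (⌊⌋-cong (sameEdge? a b x y) (sameEdge? a b y x) SameEdge-swap SameEdge-swap))
  ; adj-irrefl = λ x → cong (_∧ not ⌊ sameEdge? a b x x ⌋) (adj-irrefl G x)
  }

deleteEdge-Adj⁻ : ∀ G {a b x y} → Adj (deleteEdge G a b) x y → (Adj G ∖⟨ a , b ⟩) x y
deleteEdge-Adj⁻ G {a} {b} {x} {y} e with T-∧⁻ {adj G x y} e
... | xy , ne = xy , λ same →
  subst T (Equivalence.to 𝔹ₚ.T-not-≡ ne) (fromWitness {a? = sameEdge? a b x y} same)

deleteEdge-Adj⁺ : ∀ G {a b x y} → (Adj G ∖⟨ a , b ⟩) x y → Adj (deleteEdge G a b) x y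
deleteEdge-Adj⁺ G {a} {b} {x} {y} (xy , ne) with sameEdge? a b x y
... | yes same = contradiction same ne
... | no _     = T-∧⁺ (xy , tt)

deleteEdge-lengths : ∀ {G} (ℓ : Lengths G) a b → Lengths (deleteEdge G a b)
deleteEdge-lengths ℓ a b = record { len = len ℓ ; len-sym = len-sym ℓ ; len-nonneg = len-nonneg ℓ }

-- Every edge counts twice, once per direction; as a termination measure only its strict decrease
-- matters.
edgeCount : Graph → ℕ
edgeCount G = ∑ λ x → count (adj G x)

deleteEdge-count : ∀ G {a b} → Adj G a b → edgeCount (deleteEdge G a b) <ℕ edgeCount G
deleteEdge-count G {a} {b} e =
  ∑-mono-< {f = λ x → count (adj (deleteEdge G a b) x)}
    (λ x → count-mono {f = adj (deleteEdge G a b) x} (λ y → proj₁ ∘ deleteEdge-Adj⁻ G {a} {b} {x} {y}))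
    a (∑-mono-< {f = λ y → # (adj (deleteEdge G a b) a y)}
        (λ y → #-mono (proj₁ ∘ deleteEdge-Adj⁻ G {a} {b} {a} {y})) b
        (gone (adj (deleteEdge G a b) a b) (λ e′ → proj₂ (deleteEdge-Adj⁻ G {a} {b} e′) (inj₁ (refl , refl))) e))
  where
  gone : ∀ x {y} → ¬ T x → T y → # x <ℕ # y
  gone true         ¬x y = contradiction tt ¬x
  gone false {true} ¬x y = s≤s z≤n

deleteEdgeMinor : ∀ G {a b k} {R : Fin k → Fin (size G)} → Injective _≡_ _≡_ R →
                  TerminalMinor G (deleteEdge G a b) R
deleteEdgeMinor G {a} {b} R-inj = record
  { TerminalMinor (identityMinor G R-inj) hiding (edges)
  ; edges = λ x y e → x , y , refl , refl , proj₁ (deleteEdge-Adj⁻ G {a} {b} e) }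

-- The quantification over avoiding walks includes the case in which the deletion disconnects the
-- pair: it is then vacuous.
Forced : ∀ (G : Graph) (ℓ : Lengths G) {k} (R : Fin k → Fin (size G)) (a b : Fin (size G)) → Set
Forced G ℓ R a b = ∃₂ λ i j → Σ (Walk G (R i) (R j)) λ p → Minimal (len ℓ) p ×
  (∀ (q : WalkIn (Adj G ∖⟨ a , b ⟩) Full (R i) (R j)) → walkLength (len ℓ) p < walkLength (len ℓ) q)

deletable-or-forced : ∀ G (ℓ : Lengths G) {k} (R : Fin k → Fin (size G)) a b →
  (∀ i j → Dominates G ℓ (R i) (R j) (deleteEdge G a b) (deleteEdge-lengths ℓ a b) (R i) (R j)) ⊎ Forced G ℓ R a b
deletable-or-forced G ℓ R a b = every-or-some λ i → every-or-some λ j → decide i j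
  where
  H  = deleteEdge G a b
  ℓᴴ = deleteEdge-lengths ℓ a b
  toH : ∀ {u v} (q : WalkIn (Adj G ∖⟨ a , b ⟩) Full u v) →
        Σ (Walk H u v) λ q′ → walkLength (len ℓ) q′ ≡ walkLength (len ℓ) q
  toH q = mapʷ (deleteEdge-Adj⁺ G) id q , length-map (deleteEdge-Adj⁺ G) id (len ℓ) q
  decide : ∀ i j → Dominates G ℓ (R i) (R j) H ℓᴴ (R i) (R j) ⊎ _
  decide i j with shortestWalk G ℓ (R i) (R j) | shortestWalk H ℓᴴ (R i) (R j)
  ... | inj₁ none | _ = inj₁ λ p → contradiction p none
  ... | inj₂ (p , p-min) | inj₁ none = inj₂ (p , p-min , λ q → contradiction (proj₁ (toH q)) none)
  ... | inj₂ (p , p-min) | inj₂ (q , q-min) with walkLength (len ℓ) q ℚₚ.≤? walkLength (len ℓ) p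
  ...   | yes q≤p = inj₁ λ r → q , ℚₚ.≤-trans q≤p (p-min r)
  ...   | no  q≰p = inj₂ (p , p-min , λ r → ℚₚ.<-≤-trans (ℚₚ.≰⇒> q≰p)
                      (ℚₚ.≤-trans (q-min (proj₁ (toH r))) (ℚₚ.≤-reflexive (proj₂ (toH r)))))

-- Elimination of a vertex with at most two neighbours

Branching : (G : Graph) → Fin (size G) → Set
Branching G v = ∃ λ x → ∃ λ y → ∃ λ z →
  Adj G v x × Adj G v y × Adj G v z × x ≢ y × x ≢ z × y ≢ z

-- Degree at most two, in the form that elimination needs: `u` is the neighbour to contract into,
-- and at most one neighbour differs from it.
LowDegree : (G : Graph) → Fin (size G) → Set
LowDegree G v = (∀ x → ¬ Adj G v x) ⊎
  (∃ λ u → Adj G v u × (∀ x y → Adj G v x → Adj G v y → x ≢ u → y ≢ u → x ≡ y))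

branching-or-low : ∀ G v → Branching G v ⊎ LowDegree G v
branching-or-low G v with Fₚ.any? (λ u → 𝔹ₚ.T? (adj G v u))
... | no none = inj₂ (inj₁ λ x e → none (x , e))
... | yes (u , vu) with Fₚ.any? (λ x → 𝔹ₚ.T? (adj G v x) ×-dec ¬? (u Fₚ.≟ x) ×-dec
                        Fₚ.any? (λ y → 𝔹ₚ.T? (adj G v y) ×-dec ¬? (u Fₚ.≟ y) ×-dec ¬? (x Fₚ.≟ y)))
...   | yes (x , vx , u≢x , y , vy , u≢y , x≢y) = inj₁ (u , x , y , vu , vx , vy , u≢x , u≢y , x≢y)
...   | no none = inj₂ (inj₂ (u , vu , unique))
  where
  unique : ∀ x y → Adj G v x → Adj G v y → x ≢ u → y ≢ u → x ≡ y
  unique x y vx vy x≢u y≢u with x Fₚ.≟ y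
  ... | yes x≡y = x≡y
  ... | no  x≢y = contradiction (x , vx , x≢u ∘ sym , y , vy , y≢u ∘ sym , x≢y) none

detour-cong : ∀ {b b′ c c′ p p′ q q′} → b ≡ b′ → c ≡ c′ → p ≡ p′ → q ≡ q′ → detour b c p q ≡ detour b′ c′ p′ q′
detour-cong refl refl refl refl = refl

record Elimination (G : Graph) (ℓ : Lengths G) {k} (R : Fin k → Fin (size G)) : Set where
  field
    H        : Graph
    ℓᴴ       : Lengths H
    smaller  : size G ≡ suc (size H)
    minor    : TerminalMinor G H R
  open TerminalMinor minor public
  field
    preserve : ∀ i j → SameDist G ℓ (R i) (R j) H ℓᴴ (τ i) (τ j)

-- With at most two neighbours, the clique built by `Eliminate` is at most one edge, and contracting
-- `v` into one neighbour realises it in a minor.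
eliminate : ∀ G (ℓ : Lengths G) {k} (R : Fin k → Fin (size G)) → Injective _≡_ _≡_ R →
            ∀ v → (∀ i → R i ≢ v) → LowDegree G v → Elimination G ℓ R
eliminate G@(record { size = suc n }) ℓ {k} R R-inj v v∉R low = record
  { H = H
  ; ℓᴴ = ℓᴴ
  ; smaller = refl
  ; minor = record
      { branch    = branch
      ; nonempty  = λ x → punchIn v x , branch-ι x
      ; connected = connected
      ; edges     = edges
      ; τ         = τ
      ; terminal  = λ i → subst (λ u → branch u ≡ just (τ i)) (ι-τ i) (branch-ι (τ i))
      ; τ-inj     = λ i j eq → R-inj (trans (sym (ι-τ i)) (trans (cong (punchIn v) eq) (ι-τ j)))
      }
  ; preserve = λ i j → Dominates⇒SameDist G ℓ (R i) (R j) H ℓᴴ (τ i) (τ j)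
      (λ p → down₀ i j p)
      (λ p → up₀ i j p)
  }
  where
  open Eliminate (adj G) (len ℓ) v
  ι : Fin n → Fin (suc n)
  ι = punchIn v
  joined-sym : ∀ x y → adj G (ι x) v ∧ adj G v (ι y) ≡ adj G (ι y) v ∧ adj G v (ι x)
  joined-sym x y = trans (cong₂ _∧_ (adj-sym G (ι x) v) (adj-sym G v (ι y))) (𝔹ₚ.∧-comm (adj G v (ι x)) _)
  H : Graph
  H = record
    { size = n
    ; adj = adj′
    ; adj-sym = λ x y → cong₂ _∧_ (cong not (⌊⌋-cong (x Fₚ.≟ y) (y Fₚ.≟ x) sym sym))
                          (cong₂ _∨_ (adj-sym G (ι x) (ι y)) (joined-sym x y))
    ; adj-irrefl = λ x → cong (λ b → not b ∧ joined x x) (⌊⌋-cong (x Fₚ.≟ x) (yes tt) (λ _ → tt) (λ _ → refl))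
    }
  ℓᴴ : Lengths H
  ℓᴴ = record
    { len = len′
    ; len-sym = λ x y → detour-cong (adj-sym G (ι x) (ι y)) (joined-sym x y) (len-sym ℓ (ι x) (ι y))
        (trans (cong₂ _+_ (len-sym ℓ (ι x) v) (len-sym ℓ v (ι y))) (ℚₚ.+-comm (len ℓ v (ι x)) (len ℓ (ι y) v)))
    ; len-nonneg = len′-nonneg (Adj-irrefl G) (len-nonneg ℓ)
    }
  τ : Fin k → Fin n
  τ i = punchOut (v∉R i ∘ sym)
  ι-τ : ∀ i → ι (τ i) ≡ R i
  ι-τ i = Fₚ.punchIn-punchOut (v∉R i ∘ sym)
  down₀ : ∀ i j → Dominates G ℓ (R i) (R j) H ℓᴴ (τ i) (τ j)
  down₀ i j = subst₂ (λ x y → Dominates G ℓ x y H ℓᴴ (τ i) (τ j)) (ι-τ i) (ι-τ j)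
                (down (Adj-irrefl G) (len-nonneg ℓ))
  up₀ : ∀ i j → Dominates H ℓᴴ (τ i) (τ j) G ℓ (R i) (R j)
  up₀ i j = subst₂ (Dominates H ℓᴴ (τ i) (τ j) G ℓ) (ι-τ i) (ι-τ j)
              (λ p → proj₁ (up p) , ℚₚ.≤-reflexive (proj₂ (up p)))
  -- The vertex v is contracted into its target, and deleted if there is none.
  target-of : LowDegree G v → ∃ λ (t : Maybe (Fin n)) → (∀ x → t ≡ just x → Adj G (ι x) v) ×
                (∀ x y → x ≢ y → Adj G v (ι x) → Adj G v (ι y) → t ≡ just x ⊎ t ≡ just y)
  target-of (inj₁ isolated) = nothing , (λ _ ()) , λ x y _ e _ → contradiction e (isolated (ι x))
  target-of (inj₂ (u , vu , unique)) = just u′ , (λ { x refl → subst (λ u → Adj G u v) (sym ι-u′) (Adj-sym G vu) }) , hit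
    where
    v≢u = Adj-irrefl G vu
    u′ = punchOut v≢u
    ι-u′ : ι u′ ≡ u
    ι-u′ = Fₚ.punchIn-punchOut v≢u
    hit : ∀ x y → x ≢ y → Adj G v (ι x) → Adj G v (ι y) → just u′ ≡ just x ⊎ just u′ ≡ just y
    hit x y x≢y vx vy with u′ Fₚ.≟ x | u′ Fₚ.≟ y
    ... | yes refl | _ = inj₁ refl
    ... | no _ | yes refl = inj₂ refl
    ... | no u′≢x | no u′≢y = contradiction (Fₚ.punchIn-injective v x y
            (unique (ι x) (ι y) vx vy (off u′≢x) (off u′≢y))) x≢y
      where
      off : ∀ {x} → u′ ≢ x → ι x ≢ u
      off u′≢x eq = u′≢x (Fₚ.punchIn-injective v _ _ (trans ι-u′ (sym eq)))
  target = target-of low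
  branch : Fin (suc n) → Maybe (Fin n)
  branch g with v Fₚ.≟ g
  ... | yes _   = proj₁ target
  ... | no  v≢g = just (punchOut v≢g)
  branch-v : branch v ≡ proj₁ target
  branch-v with v Fₚ.≟ v
  ... | yes _   = refl
  ... | no  v≢v = contradiction refl v≢v
  branch-ι : ∀ x → branch (ι x) ≡ just x
  branch-ι x with v Fₚ.≟ ι x
  ... | yes v≡ = contradiction (sym v≡) (Fₚ.punchInᵢ≢i v x)
  ... | no  v≢ = cong just (Fₚ.punchIn-injective v _ _ (Fₚ.punchIn-punchOut v≢))
  branch⁻ : ∀ {g x} → branch g ≡ just x → g ≡ ι x ⊎ (g ≡ v × proj₁ target ≡ just x)
  branch⁻ {g} eq with v Fₚ.≟ g
  ... | yes v≡g = inj₂ (sym v≡g , eq)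
  branch⁻ refl | no v≢g = inj₁ (sym (Fₚ.punchIn-punchOut v≢g))
  connected : ∀ x g h → branch g ≡ just x → branch h ≡ just x → WalkIn (Adj G) (λ w → branch w ≡ just x) g h
  connected x g h g∈ h∈ with branch⁻ g∈ | branch⁻ h∈
  ... | inj₁ refl | inj₁ refl = stop g∈
  ... | inj₁ refl | inj₂ (refl , t≡) = step g∈ (proj₁ (proj₂ target) x t≡) (stop h∈)
  ... | inj₂ (refl , t≡) | inj₁ refl = step g∈ (Adj-sym G (proj₁ (proj₂ target) x t≡)) (stop h∈)
  ... | inj₂ (refl , _) | inj₂ (refl , _) = stop g∈
  edges : ∀ x y → Adj H x y → ∃₂ λ g h → branch g ≡ just x × branch h ≡ just y × Adj G g h
  edges x y e with adj′-elim {x} {y} e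
  ... | x≢y , j with T-∨⁻ {adj G (ι x) (ι y)} j
  ...   | inj₁ direct = ι x , ι y , branch-ι x , branch-ι y , direct
  ...   | inj₂ via with T-∧⁻ via
  -- One end of the new edge is the target, whose branch set contains `v`; the edge from `v` to the
  -- other end represents the new edge.
  ...     | xv , vy with proj₂ (proj₂ target) x y x≢y (Adj-sym G xv) vy
  ...       | inj₁ t≡x = v , ι y , trans branch-v t≡x , branch-ι y , vy
  ...       | inj₂ t≡y = ι x , v , branch-ι x , trans branch-v t≡y , xv

-- Exhaustive reduction

record Reduced (G : Graph) (ℓ : Lengths G) {k} (R : Fin k → Fin (size G)) : Set where
  field
    forced    : ∀ a b → Adj G a b → Forced G ℓ R a b
    branching : ∀ v → (∃ λ i → R i ≡ v) ⊎ Branching G v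

-- The bounds `s` and `e` decrease lexicographically: eliminating a vertex lowers `s` and resets `e`
-- to the edge count of the new graph, while deleting an edge keeps `s` and lowers `e`.
reduce : ∀ s e G (ℓ : Lengths G) {k} (R : Fin k → Fin (size G)) → Injective _≡_ _≡_ R →
         size G ≤ℕ s → edgeCount G ≤ℕ e →
         Σ (DPM G ℓ R) λ D → Reduced (DPM.G' D) (DPM.ℓ' D) (DPM.τ D)
reduce s e G ℓ R R-inj size≤s edges≤e with every-or-some vertex | every-or-some (λ a → every-or-some (edge a))
  where
  vertex : ∀ v → ((∃ λ i → R i ≡ v) ⊎ Branching G v) ⊎ ((∀ i → R i ≢ v) × LowDegree G v)
  vertex v with Fₚ.any? (λ i → R i Fₚ.≟ v) | branching-or-low G v
  ... | yes v∈R | _        = inj₁ (inj₁ v∈R)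
  ... | no  _   | inj₁ br  = inj₁ (inj₂ br)
  ... | no  v∉R | inj₂ low = inj₂ ((λ i eq → v∉R (i , eq)) , low)
  edge : ∀ a b → (Adj G a b → Forced G ℓ R a b) ⊎ (Adj G a b ×
           ∀ i j → Dominates G ℓ (R i) (R j) (deleteEdge G a b) (deleteEdge-lengths ℓ a b) (R i) (R j))
  edge a b with 𝔹ₚ.T? (adj G a b) | deletable-or-forced G ℓ R a b
  ... | no ¬ab | _           = inj₁ λ ab → contradiction ab ¬ab
  ... | yes _  | inj₂ forced = inj₁ λ _ → forced
  ... | yes ab | inj₁ dom    = inj₂ (ab , dom)
... | inj₁ branching | inj₁ forced =
  identityDPM G ℓ R-inj , record { forced = forced ; branching = branching }
reduce (suc s) e G ℓ R R-inj size≤s edges≤e | inj₂ (v , v∉R , low) | _ =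
  let D , red = reduce s (edgeCount H) H ℓᴴ τ (λ {i} {j} → τ-inj i j) (ℕₚ.≤-pred (subst (_≤ℕ suc s) smaller size≤s)) ℕₚ.≤-refl
  in composeDPM minor preserve D , red
  where open Elimination (eliminate G ℓ R R-inj v v∉R low)
reduce zero e G ℓ R R-inj size≤s edges≤e | inj₂ (v , v∉R , low) | _ =
  contradiction (ℕₚ.≤-trans (ℕₚ.≤-trans (s≤s z≤n) (Fₚ.toℕ<n v)) size≤s) λ ()
reduce s (suc e) G ℓ R R-inj size≤s edges≤e | inj₁ _ | inj₂ (a , b , ab , dom) =
  let D , red = reduce s e (deleteEdge G a b) (deleteEdge-lengths ℓ a b) R R-inj size≤s
                  (ℕₚ.≤-pred (ℕₚ.<-≤-trans (deleteEdge-count G ab) edges≤e))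
  in composeDPM (deleteEdgeMinor G {a} {b} R-inj)
       (λ i j → Dominates⇒SameDist G ℓ (R i) (R j) (deleteEdge G a b) (deleteEdge-lengths ℓ a b) (R i) (R j) (dom i j)
         λ p → mapʷ (proj₁ ∘ deleteEdge-Adj⁻ G {a} {b}) id p ,
               ℚₚ.≤-reflexive (length-map (proj₁ ∘ deleteEdge-Adj⁻ G {a} {b}) id (len ℓ) p)) D , red
reduce s zero G ℓ R R-inj size≤s edges≤e | inj₁ _ | inj₂ (a , b , ab , dom) =
  contradiction (ℕₚ.<-≤-trans (deleteEdge-count G ab) edges≤e) λ ()

+-cancelˡ-≤ : ∀ x {y z} → x + y ≤ x + z → y ≤ z
+-cancelˡ-≤ x xy≤xz = ℚₚ.≮⇒≥ λ z<y → ℚₚ.<-irrefl refl (ℚₚ.<-≤-trans (ℚₚ.+-monoʳ-< x z<y) xy≤xz)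

+-cancelˡ-< : ∀ x {y z} → x + y < x + z → y < z
+-cancelˡ-< x xy<xz = ℚₚ.≰⇒> λ z≤y → ℚₚ.<-irrefl refl (ℚₚ.<-≤-trans xy<xz (ℚₚ.+-monoʳ-≤ x z≤y))

≤-+ˡ : ∀ {x y} → 0ℚ ≤ x → y ≤ x + y
≤-+ˡ {x} {y} 0≤x = ℚₚ.≤-trans (ℚₚ.≤-reflexive (sym (ℚₚ.+-identityˡ y))) (ℚₚ.+-monoˡ-≤ y 0≤x)

-- Simple walks

module _ {n : ℕ} {E : Fin n → Fin n → Set} {S : Fin n → Set} where

  Simple : ∀ {u v} → WalkIn E S u v → Set
  Simple (stop _)         = ⊤
  Simple (step {u} _ _ p) = ¬ (p ∋ʷ u) × Simple p

  -- A simple walk never returns to its start, so no step after the first touches it.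
  Simple-start-edge : ∀ {v t x} (p : WalkIn E S v t) → Simple p → Uses p v x →
                      ∃ λ w → x ≡ w × (∀ {y} → Uses p v y → y ≡ w)
  Simple-start-edge {v} (step {w = w} _ _ p) (v∉p , _) use = w , second use , second
    where
    second : ∀ {y} → SameEdge v y v w ⊎ Uses p v y → y ≡ w
    second (inj₁ (inj₁ (_ , y≡w)))  = y≡w
    second (inj₁ (inj₂ (refl , _))) = contradiction (∋ʷ-start p) v∉p
    second (inj₂ use)               = contradiction (Uses⇒∋ p use) v∉p

  Simple-start-unique : ∀ {v t x y} (p : WalkIn E S v t) → Simple p → Uses p v x → Uses p v y → x ≡ y
  Simple-start-unique p simple ux uy with Simple-start-edge p simple ux
  ... | w , x≡w , only = trans x≡w (sym (only uy))

  -- A simple walk enters and leaves `v` at most once. When the first step enters `v`, the remaining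
  -- walk starts there and uses only one further edge at `v`.
  Simple-two-edges : ∀ {u t v x y z} (p : WalkIn E S u t) → Simple p →
                     Uses p v x → Uses p v y → Uses p v z → x ≡ y ⊎ x ≡ z ⊎ y ≡ z
  Simple-two-edges {u} {v = v} (step {w = w} s e p) simple@(_ , simple-p) ux uy uz with u Fₚ.≟ v
  ... | yes refl = inj₁ (Simple-start-unique (step s e p) simple ux uy)
  ... | no u≢v   = cases (late ux) (late uy) (late uz)
    where
    late : ∀ {y} → SameEdge v y u w ⊎ Uses p v y → (v ≡ w × y ≡ u) ⊎ Uses p v y
    late (inj₁ (inj₁ (v≡u , _))) = contradiction (sym v≡u) u≢v
    late (inj₁ (inj₂ same))      = inj₁ same
    late (inj₂ use)              = inj₂ use
    cases : ∀ {x y z} → (v ≡ w × x ≡ u) ⊎ Uses p v x → (v ≡ w × y ≡ u) ⊎ Uses p v y →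
            (v ≡ w × z ≡ u) ⊎ Uses p v z → x ≡ y ⊎ x ≡ z ⊎ y ≡ z
    cases (inj₁ (_ , x≡u)) (inj₁ (_ , y≡u)) _ = inj₁ (trans x≡u (sym y≡u))
    cases (inj₁ (_ , x≡u)) (inj₂ _) (inj₁ (_ , z≡u)) = inj₂ (inj₁ (trans x≡u (sym z≡u)))
    cases (inj₂ _) (inj₁ (_ , y≡u)) (inj₁ (_ , z≡u)) = inj₂ (inj₂ (trans y≡u (sym z≡u)))
    cases (inj₁ (refl , _)) (inj₂ uy) (inj₂ uz) = inj₂ (inj₂ (Simple-start-unique p simple-p uy uz))
    cases (inj₂ ux) (inj₁ (refl , _)) (inj₂ uz) = inj₂ (inj₁ (Simple-start-unique p simple-p ux uz))
    cases (inj₂ ux) (inj₂ uy) (inj₁ (refl , _)) = inj₁ (Simple-start-unique p simple-p ux uy)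
    cases (inj₂ ux) (inj₂ uy) (inj₂ uz) = Simple-two-edges p simple-p ux uy uz

  module _ (ℓ : Fin n → Fin n → ℚ) (ℓ≥0 : ∀ x y → 0ℚ ≤ ℓ x y) where

    Simple-suffix : ∀ {u t v} (p : WalkIn E S u t) → Simple p → p ∋ʷ v →
                    Σ (WalkIn E S v t) λ q → Simple q × walkLength ℓ q ≤ walkLength ℓ p
    Simple-suffix (stop s) simple refl = stop s , simple , ℚₚ.≤-refl
    Simple-suffix p@(step _ _ _) simple (inj₁ refl) = p , simple , ℚₚ.≤-refl
    Simple-suffix (step _ _ p) (_ , simple) (inj₂ v∈p) with Simple-suffix p simple v∈p
    ... | q , simple-q , q≤p = q , simple-q , ℚₚ.≤-trans q≤p (≤-+ˡ (ℓ≥0 _ _))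

    -- If the start recurs in the already simple tail, the suffix from that visit is taken; it is no
    -- longer because lengths are nonnegative.
    eraseLoops : ∀ {u t} (p : WalkIn E S u t) → Σ (WalkIn E S u t) λ q → Simple q × walkLength ℓ q ≤ walkLength ℓ p
    eraseLoops (stop s) = stop s , tt , ℚₚ.≤-refl
    eraseLoops (step {u} {w} s e p) with eraseLoops p
    ... | q , simple , q≤p with q ∋ʷ? u
    ...   | no  u∉q = step s e q , (u∉q , simple) , ℚₚ.+-monoʳ-≤ (ℓ u w) q≤p
    ...   | yes u∈q with Simple-suffix q simple u∈q
    ...     | r , simple-r , r≤q = r , simple-r , ℚₚ.≤-trans r≤q (ℚₚ.≤-trans q≤p (≤-+ˡ (ℓ≥0 u w)))

-- Forced edges and charges

module Forcing (G : Graph) (ℓ : Lengths G) where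

  private
    V = Fin (size G)

  L : ∀ {E : V → V → Set} {S : V → Set} {u v} → WalkIn E S u v → ℚ
  L p = walkLength (len ℓ) p

  WalkAvoiding : V → V → V → V → Set
  WalkAvoiding a b = WalkIn (Adj G ∖⟨ a , b ⟩) Full

  L≥0 : ∀ {E : V → V → Set} {S : V → Set} {u v} (p : WalkIn E S u v) → 0ℚ ≤ L p
  L≥0 = length-nonneg (len ℓ) (len-nonneg ℓ)

  forget : ∀ {a b u v} (p : WalkAvoiding a b u v) → Σ (Walk G u v) λ q → L q ≡ L p
  forget p = forgetʷ p , length-map proj₁ id (len ℓ) p

  reverse : ∀ {u v} (p : Walk G u v) → Σ (Walk G v u) λ q → L q ≡ L p
  reverse p = revʷ (Adj-sym G) p , length-rev (len ℓ) (len-sym ℓ) (Adj-sym G) p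

  reverse∖ : ∀ {a b u v} (p : WalkAvoiding a b u v) → Σ (WalkAvoiding a b v u) λ q → L q ≡ L p
  reverse∖ {a} {b} p = revʷ (∖-sym {a = a} {b} (Adj-sym G)) p ,
                       length-rev (len ℓ) (len-sym ℓ) (∖-sym {a = a} {b} (Adj-sym G)) p

  -- Used with `x` and `y` the ends of the edge {`a` , `b`} in either order: a walk of length at
  -- most `d` that traverses this edge once, from `x` to `y`.
  Crossing : (a b x y u v : V) → ℚ → Set
  Crossing a b x y u v d = Σ (WalkAvoiding a b u x) λ A → Σ (WalkAvoiding a b y v) λ C →
                             L A + (len ℓ x y + L C) ≤ d

  prepend : ∀ {a b x y u v w} → Adj G u w → ¬ SameEdge a b u w → (p : Walk G w v) →
            Crossing a b x y w v (L p) → Crossing a b x y u v (len ℓ u w + L p)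
  prepend {x = x} {y} {u} {w = w} e ne p (A , C , le) = step tt (e , ne) A , C ,
    ℚₚ.≤-trans (ℚₚ.≤-reflexive (ℚₚ.+-assoc (len ℓ u w) (L A) (len ℓ x y + L C))) (ℚₚ.+-monoʳ-≤ (len ℓ u w) le)

  -- Everything between the first and a later traversal of the edge can be cut out without making
  -- the walk longer, so at most one traversal survives.
  avoid-or-cross : ∀ a b {u v} (p : Walk G u v) →
    (Σ (WalkAvoiding a b u v) λ q → L q ≤ L p) ⊎ Crossing a b a b u v (L p) ⊎ Crossing a b b a u v (L p)
  avoid-or-cross a b (stop s) = inj₁ (stop tt , ℚₚ.≤-refl)
  avoid-or-cross a b {v = v} (step {u} {w} _ e p) with sameEdge? a b u w | avoid-or-cross a b p
  ... | no ne | inj₁ (q , q≤p) = inj₁ (step tt (e , ne) q , ℚₚ.+-monoʳ-≤ (len ℓ u w) q≤p)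
  ... | no ne | inj₂ crossing = inj₂ (Sum.map (prepend e ne p) (prepend e ne p) crossing)
  ... | yes same | rec = merge same rec
    where
    fresh : ∀ {x y} (q : WalkAvoiding a b y v) → L q ≤ L p → len ℓ x y ≡ len ℓ u w → Crossing a b x y x v (len ℓ u w + L p)
    fresh {x} {y} q q≤p eq = stop tt , q ,
      ℚₚ.≤-trans (ℚₚ.≤-reflexive (trans (ℚₚ.+-identityˡ _) (cong (_+ L q) eq))) (ℚₚ.+-monoʳ-≤ (len ℓ u w) q≤p)
    tail≤ : ∀ {x y} (A : WalkAvoiding a b w x) (C : WalkAvoiding a b y v) → L A + (len ℓ x y + L C) ≤ L p → L C ≤ L p
    tail≤ {x} {y} A C le = ℚₚ.≤-trans (ℚₚ.≤-trans (≤-+ˡ (len-nonneg ℓ x y)) (≤-+ˡ (L≥0 A))) le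
    lift : ∀ {q} → q ≤ L p → q ≤ len ℓ u w + L p
    lift q≤p = ℚₚ.≤-trans q≤p (≤-+ˡ (len-nonneg ℓ u w))
    merge : SameEdge a b u w →
      (Σ (WalkAvoiding a b w v) λ q → L q ≤ L p) ⊎ Crossing a b a b w v (L p) ⊎ Crossing a b b a w v (L p) →
      (Σ (WalkAvoiding a b u v) λ q → L q ≤ len ℓ u w + L p) ⊎
      Crossing a b a b u v (len ℓ u w + L p) ⊎ Crossing a b b a u v (len ℓ u w + L p)
    -- Two traversals in the same direction become one. Two in opposite directions cancel, since the
    -- walk after the second one already starts at `u`.
    merge (inj₁ (refl , refl)) (inj₁ (q , q≤p))           = inj₂ (inj₁ (fresh q q≤p refl))
    merge (inj₁ (refl , refl)) (inj₂ (inj₁ (A , C , le))) = inj₂ (inj₁ (fresh C (tail≤ A C le) refl))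
    merge (inj₁ (refl , refl)) (inj₂ (inj₂ (A , C , le))) = inj₁ (C , lift (tail≤ A C le))
    merge (inj₂ (refl , refl)) (inj₁ (q , q≤p))           = inj₂ (inj₂ (fresh q q≤p refl))
    merge (inj₂ (refl , refl)) (inj₂ (inj₂ (A , C , le))) = inj₂ (inj₂ (fresh C (tail≤ A C le) refl))
    merge (inj₂ (refl , refl)) (inj₂ (inj₁ (A , C , le))) = inj₁ (C , lift (tail≤ A C le))

  -- All shortest walks from s to t use the edge {v , x}, and total is the distance from s to t.
  record Through (s t v x : V) : Set where
    field
      edge   : Adj G v x
      before : WalkAvoiding v x s v
      after  : WalkAvoiding v x x t
    total : ℚ
    total = L before + (len ℓ v x + L after)
    field
      shortest-total : ∀ (q : Walk G s t) → total ≤ L q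
      forced-total   : ∀ (q : WalkAvoiding v x s t) → total < L q

  -- `Through` fixes the direction from `v` to `x`; if the shortest walk crosses the other way, it
  -- is reversed and the terminals swap roles.
  Forced⇒Through : ∀ {k} {R : Fin k → V} {v x} → Adj G v x → Forced G ℓ R v x → ∃₂ λ i j → Through (R i) (R j) v x
  Forced⇒Through {v = v} {x} vx (i , j , p , p-min , avoid>p) with avoid-or-cross v x p
  ... | inj₁ (q , q≤p) = contradiction (ℚₚ.<-≤-trans (avoid>p q) q≤p) (ℚₚ.<-irrefl refl)
  ... | inj₂ (inj₁ (A , C , le)) = i , j , record
    { edge = vx ; before = A ; after = C
    ; shortest-total = λ q → ℚₚ.≤-trans le (p-min q)
    ; forced-total   = λ q → ℚₚ.≤-<-trans le (avoid>p q) }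
  ... | inj₂ (inj₂ (A , C , le)) = j , i , record
    { edge = vx ; before = proj₁ (reverse∖ C) ; after = proj₁ (reverse∖ A)
    ; shortest-total = λ q → ℚₚ.≤-trans le′ (ℚₚ.≤-trans (p-min (proj₁ (reverse q))) (ℚₚ.≤-reflexive (proj₂ (reverse q))))
    ; forced-total   = λ q → ℚₚ.≤-<-trans le′ (ℚₚ.<-≤-trans (avoid>p (proj₁ (reverse∖ q)))
                                                             (ℚₚ.≤-reflexive (proj₂ (reverse∖ q)))) }
    where
    rotate : ∀ a l c → c + (l + a) ≡ a + (l + c)
    rotate = solve 3 (λ a l c → c ⊕ (l ⊕ a) ⊜ a ⊕ (l ⊕ c)) refl
    le′ : L (proj₁ (reverse∖ C)) + (len ℓ v x + L (proj₁ (reverse∖ A))) ≤ L p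
    le′ = ℚₚ.≤-trans (ℚₚ.≤-reflexive (trans
      (cong₂ (λ c a → c + (len ℓ v x + a)) (proj₂ (reverse∖ C)) (proj₂ (reverse∖ A)))
      (trans (rotate (L A) (len ℓ v x) (L C)) (cong (λ l → L A + (l + L C)) (len-sym ℓ v x))))) le

  -- The outer parts `A₁` and `C₂` avoid the edge. They extend any walk from `b` to `b′` to one from
  -- `s` to `t`, and their lengths cancel from both inequalities.
  Through-localise : ∀ {s t v x b b′} (T : Through s t v x) (let open Through T) →
                     before ∋ʷ b → after ∋ʷ b′ → Through b b′ v x
  Through-localise {s} {t} {v} {x} {b} {b′} T b∈ b′∈
    with splitʷ (len ℓ) (Through.before T) b∈ | splitʷ (len ℓ) (Through.after T) b′∈
  ... | A₁ , A₂ , A≡ , _ | C₁ , C₂ , C≡ , _ = record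
    { edge = edge ; before = A₂ ; after = C₁
    ; shortest-total = λ q → +-cancelˡ-≤ (L A₁ + L C₂)
        (subst₂ _≤_ total≡ (detour≡ (proj₁ (forget A₁)) (proj₁ (forget C₂)) q (proj₂ (forget A₁)) (proj₂ (forget C₂)))
          (shortest-total (proj₁ (forget A₁) ++ʷ q ++ʷ proj₁ (forget C₂))))
    ; forced-total = λ q → +-cancelˡ-< (L A₁ + L C₂)
        (subst₂ _<_ total≡ (detour≡ A₁ C₂ q refl refl) (forced-total (A₁ ++ʷ q ++ʷ C₂)))
    }
    where
    open Through T
    l = len ℓ v x
    shuffle : ∀ a₁ a₂ l c₁ c₂ → (a₁ + a₂) + (l + (c₁ + c₂)) ≡ (a₁ + c₂) + (a₂ + (l + c₁))
    shuffle = solve 5 (λ a₁ a₂ l c₁ c₂ → (a₁ ⊕ a₂) ⊕ (l ⊕ (c₁ ⊕ c₂)) ⊜ (a₁ ⊕ c₂) ⊕ (a₂ ⊕ (l ⊕ c₁))) refl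
    swap : ∀ a q c → a + (q + c) ≡ (a + c) + q
    swap = solve 3 (λ a q c → a ⊕ (q ⊕ c) ⊜ (a ⊕ c) ⊕ q) refl
    total≡ : total ≡ (L A₁ + L C₂) + (L A₂ + (l + L C₁))
    total≡ = trans (cong₂ (λ a c → a + (l + c)) A≡ C≡) (shuffle (L A₁) (L A₂) l (L C₁) (L C₂))
    detour≡ : ∀ {E : V → V → Set} (p : WalkIn E Full s b) (r : WalkIn E Full b′ t) (q : WalkIn E Full b b′) →
              L p ≡ L A₁ → L r ≡ L C₂ → L (p ++ʷ q ++ʷ r) ≡ (L A₁ + L C₂) + L q
    detour≡ p r q p≡ r≡ = trans (length-++ (len ℓ) p (q ++ʷ r))
      (trans (cong₂ _+_ p≡ (trans (length-++ (len ℓ) q r) (cong (L q +_) r≡))) (swap (L A₁) (L q) (L C₂)))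

  throughWalk : ∀ {s t v x} (T : Through s t v x) → Σ (Walk G s t) λ p → L p ≡ Through.total T
  throughWalk {v = v} {x} T = proj₁ (forget before) ++ʷ step tt edge (proj₁ (forget after)) ,
    trans (length-++ (len ℓ) (proj₁ (forget before)) _)
          (cong₂ (λ a c → a + (len ℓ v x + c)) (proj₂ (forget before)) (proj₂ (forget after)))
    where open Through T

  bypass : ∀ {a b c d u v} (p : WalkAvoiding a b u v) → ¬ p ∋ʷ c → Σ (WalkAvoiding c d u v) λ q → L q ≡ L p
  bypass p c∉p =
    let q , q≡p , _ = avoidʷ p (c∉p ∘ Uses⇒∋ p) in
    mapʷ (λ ((e , _) , ne) → e , ne) id q , trans (length-map (λ ((e , _) , ne) → e , ne) id (len ℓ) q) (q≡p (len ℓ))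

  -- The choice depends on the pair alone, so vertices charged to the same pair lie on the same
  -- walk.
  canonical : ∀ u v → ¬ Walk G u v ⊎ Σ (Walk G u v) λ p → Minimal (len ℓ) p × Simple p
  canonical u v with shortestWalk G ℓ u v
  ... | inj₁ none = inj₁ none
  ... | inj₂ (p , p-min) with eraseLoops (len ℓ) (len-nonneg ℓ) p
  ...   | q , simple , q≤p = inj₂ (q , (λ r → ℚₚ.≤-trans q≤p (p-min r)) , simple)

  -- Parts of shortest walks are shortest. If `p` meets `w` before `u`, the part between them is
  -- reversed.
  segment : ∀ {s t a b u w} (p : Walk G s t) → Minimal (len ℓ) p → ¬ Uses p a b → p ∋ʷ u → p ∋ʷ w →
            Σ (WalkAvoiding a b u w) λ q → ∀ (r : Walk G u w) → L q ≤ L r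
  segment {s} {t} {a} {b} {u} {w} p p-min unused u∈p w∈p with avoidʷ p unused
  ... | p̂ , p̂≡p , visits with splitʷ (len ℓ) p̂ (visits u∈p)
  ...   | p₁ , p₂ , p̂≡ , side with side (visits w∈p)
  ...     | inj₂ w∈p₂ with splitʷ (len ℓ) p₂ w∈p₂
  ...       | q , p₃ , p₂≡ , _ = q , λ r → +-cancelˡ-≤ (L p₁ + L p₃) (subst₂ _≤_
      (trans (trans (sym (p̂≡p (len ℓ))) (trans p̂≡ (cong (L p₁ +_) p₂≡))) (swap (L p₁) (L q) (L p₃)))
      (trans (length-++ (len ℓ) (proj₁ (forget p₁)) (r ++ʷ proj₁ (forget p₃)))
        (trans (cong₂ _+_ (proj₂ (forget p₁)) (trans (length-++ (len ℓ) r (proj₁ (forget p₃))) (cong (L r +_) (proj₂ (forget p₃)))))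
               (swap (L p₁) (L r) (L p₃))))
      (p-min (proj₁ (forget p₁) ++ʷ r ++ʷ proj₁ (forget p₃))))
    where
    swap : ∀ a q c → a + (q + c) ≡ (a + c) + q
    swap = solve 3 (λ a q c → a ⊕ (q ⊕ c) ⊜ (a ⊕ c) ⊕ q) refl
  segment {s} {t} {a} {b} {u} {w} p p-min unused u∈p w∈p | p̂ , p̂≡p , visits | p₁ , p₂ , p̂≡ , side | inj₁ w∈p₁
    with splitʷ (len ℓ) p₁ w∈p₁
  ... | p₀ , q , p₁≡ , _ = proj₁ (reverse∖ q) , λ r → ℚₚ.≤-trans (ℚₚ.≤-reflexive (proj₂ (reverse∖ q)))
      (+-cancelˡ-≤ (L p₀ + L p₂) (subst₂ _≤_
        (trans (trans (sym (p̂≡p (len ℓ))) (trans p̂≡ (cong (_+ L p₂) p₁≡))) (swap (L p₀) (L q) (L p₂)))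
        (trans (length-++ (len ℓ) (proj₁ (forget p₀)) (proj₁ (reverse r) ++ʷ proj₁ (forget p₂)))
          (trans (cong₂ _+_ (proj₂ (forget p₀)) (trans (length-++ (len ℓ) (proj₁ (reverse r)) (proj₁ (forget p₂)))
                                                       (cong₂ _+_ (proj₂ (reverse r)) (proj₂ (forget p₂)))))
                 (swap′ (L p₀) (L r) (L p₂))))
        (p-min (proj₁ (forget p₀) ++ʷ proj₁ (reverse r) ++ʷ proj₁ (forget p₂)))))
    where
    swap : ∀ a q c → (a + q) + c ≡ (a + c) + q
    swap = solve 3 (λ a q c → (a ⊕ q) ⊕ c ⊜ (a ⊕ c) ⊕ q) refl
    swap′ : ∀ a q c → a + (q + c) ≡ (a + c) + q
    swap′ = solve 3 (λ a q c → a ⊕ (q ⊕ c) ⊜ (a ⊕ c) ⊕ q) refl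

  -- Otherwise rerouting along the segment gives a walk that avoids {v , x} and is no longer.
  no-rejoin : ∀ {s t v x w} (T : Through s t v x) → Through.after T ∋ʷ w →
              ¬ Σ (WalkAvoiding v x v w) λ q → ∀ (r : Walk G v w) → L q ≤ L r
  no-rejoin {v = v} {x} {w} T w∈ (q , q-min) with splitʷ (len ℓ) (Through.after T) w∈
  ... | X , Y , C≡ , _ = ℚₚ.<-irrefl refl (ℚₚ.<-≤-trans (forced-total (before ++ʷ q ++ʷ Y)) (begin
    L (before ++ʷ q ++ʷ Y)                   ≡⟨ trans (length-++ (len ℓ) before (q ++ʷ Y))
                                                      (cong (L before +_) (length-++ (len ℓ) q Y)) ⟩
    L before + (L q + L Y)                   ≤⟨ ℚₚ.+-monoʳ-≤ (L before) (ℚₚ.+-monoˡ-≤ (L Y) q≤) ⟩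
    L before + ((len ℓ v x + L X) + L Y)     ≡⟨ cong (L before +_) (ℚₚ.+-assoc (len ℓ v x) (L X) (L Y)) ⟩
    L before + (len ℓ v x + (L X + L Y))     ≡⟨ cong (λ c → L before + (len ℓ v x + c)) C≡ ⟨
    total                                    ∎))
    where
    open Through T
    open ℚₚ.≤-Reasoning
    q≤ : L q ≤ len ℓ v x + L X
    q≤ = ℚₚ.≤-trans (q-min (step tt edge (proj₁ (forget X)))) (ℚₚ.≤-reflexive (cong (len ℓ v x +_) (proj₂ (forget X))))

  OffCanonical : ∀ {s t} → ¬ Walk G s t ⊎ (Σ (Walk G s t) λ p → Minimal (len ℓ) p × Simple p) → V → V → Set
  OffCanonical (inj₁ _)       v x = ⊥
  OffCanonical (inj₂ (p , _)) v x = p ∋ʷ v × ¬ Uses p v x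

  Charge : V → V → V → V → V → Set
  Charge v b b′ c c′ = ∃ λ x → Through b b′ v x × OffCanonical (canonical c c′) v x

  -- Suppose `v` and `w` differ. Both forced walks are shortest from `b` to `b′`, and `no-rejoin`
  -- keeps `w` out of `T.after` and `v` out of `U.after`. If `T.before` misses `w` as well, the walk
  -- of `T` avoids the edge forced at `w`. Otherwise the route along `T.before` to `w` and on along
  -- `U` avoids the edge forced at `v`. Either walk is too short for the edge it avoids.
  Charge-injective : ∀ {v w b b′ c c′} → Charge v b b′ c c′ → Charge w b b′ c c′ → v ≡ w
  Charge-injective {v} {w} {b} {b′} {c} {c′} (x , T , offT) (y , U , offU) with v Fₚ.≟ w | canonical c c′
  ... | yes v≡w | _ = v≡w
  ... | no  v≢w | inj₂ (p , p-min , _) = ⊥-elim contra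
    where
    module T = Through T
    module U = Through U
    w∉after : ¬ T.after ∋ʷ w
    w∉after w∈ = no-rejoin T w∈ (segment p p-min (proj₂ offT) (proj₁ offT) (proj₁ offU))
    v∉after : ¬ U.after ∋ʷ v
    v∉after v∈ = no-rejoin U v∈ (segment p p-min (proj₂ offU) (proj₁ offU) (proj₁ offT))
    T≤U : T.total ≤ U.total
    T≤U = ℚₚ.≤-trans (T.shortest-total (proj₁ (throughWalk U))) (ℚₚ.≤-reflexive (proj₂ (throughWalk U)))
    U≤T : U.total ≤ T.total
    U≤T = ℚₚ.≤-trans (U.shortest-total (proj₁ (throughWalk T))) (ℚₚ.≤-reflexive (proj₂ (throughWalk T)))
    contra : ⊥
    contra with T.before ∋ʷ? w
    ... | no w∉before = ℚₚ.<-irrefl refl (ℚₚ.<-≤-trans (U.forced-total W) (ℚₚ.≤-trans (ℚₚ.≤-reflexive W≡T) T≤U))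
      where
      A = bypass {d = y} T.before w∉before
      C = bypass {d = y} T.after w∉after
      W : WalkAvoiding w y b b′
      W = proj₁ A ++ʷ step tt (T.edge , λ { (inj₁ (w≡v , _)) → v≢w (sym w≡v)
                                          ; (inj₂ (refl , _)) → w∉after (∋ʷ-start T.after) }) (proj₁ C)
      W≡T : L W ≡ T.total
      W≡T = trans (length-++ (len ℓ) (proj₁ A) _) (cong₂ (λ a c → a + (len ℓ v x + c)) (proj₂ A) (proj₂ C))
    ... | yes w∈before with splitʷ (len ℓ) T.before w∈before
    ...   | A₁ , A₂ , A≡ , _ = ℚₚ.<-irrefl refl (ℚₚ.<-≤-trans (T.forced-total W) (ℚₚ.≤-trans W≤U U≤T))
      where
      C = bypass {d = x} U.after v∉after
      W : WalkAvoiding v x b b′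
      W = A₁ ++ʷ step tt (U.edge , λ { (inj₁ (v≡w , _)) → v≢w v≡w
                                     ; (inj₂ (refl , _)) → v∉after (∋ʷ-start U.after) }) (proj₁ C)
      W′ : Walk G b b′
      W′ = proj₁ (forget U.before) ++ʷ proj₁ (forget A₂) ++ʷ step tt T.edge (proj₁ (forget T.after))
      rest = L A₂ + (len ℓ v x + L T.after)
      W′≡ : L W′ ≡ rest + L U.before
      W′≡ = trans (length-++ (len ℓ) (proj₁ (forget U.before)) _) (trans (cong₂ _+_ (proj₂ (forget U.before))
              (trans (length-++ (len ℓ) (proj₁ (forget A₂)) _)
                (cong₂ (λ a c → a + (len ℓ v x + c)) (proj₂ (forget A₂)) (proj₂ (forget T.after)))))
              (ℚₚ.+-comm (L U.before) rest))
      T≡ : T.total ≡ rest + L A₁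
      T≡ = trans (cong (_+ (len ℓ v x + L T.after)) A≡)
             (trans (ℚₚ.+-assoc (L A₁) (L A₂) (len ℓ v x + L T.after)) (ℚₚ.+-comm (L A₁) rest))
      -- `A₁` is a prefix of a shortest walk, so `U.before` cannot reach `w` on a shorter route.
      A₁≤ : L A₁ ≤ L U.before
      A₁≤ = +-cancelˡ-≤ rest (subst₂ _≤_ T≡ W′≡ (T.shortest-total W′))
      W≤U : L W ≤ U.total
      W≤U = ℚₚ.≤-trans (ℚₚ.≤-reflexive (trans (length-++ (len ℓ) A₁ _) (cong (λ c → L A₁ + (len ℓ w y + c)) (proj₂ C))))
              (ℚₚ.+-monoˡ-≤ (len ℓ w y + L U.after) A₁≤)

-- Counting the vertices behind a boundary

module Piece (G : Graph) (ℓ : Lengths G) {k : ℕ} (R : Fin k → Fin (size G)) (reduced : Reduced G ℓ R)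
             (S B : Fin (size G) → Bool)
             (closed : ∀ v → T (S v) → ¬ T (B v) → (∀ i → R i ≢ v) × (∀ x → Adj G v x → T (S x))) where
  open Forcing G ℓ
  open Reduced reduced

  private
    V = Fin (size G)

  -- Followed backwards from its end, the walk cannot leave `S` before it meets `B`. For a walk from
  -- a terminal, `terminal-not-inside` rules out the second alternative.
  hits-B-before : ∀ {a b u v} (p : WalkAvoiding a b u v) → T (S v) → (∃ λ x → T (B x) × p ∋ʷ x) ⊎ (T (S u) × ¬ T (B u))
  hits-B-before {u = u} (stop _) v∈S with 𝔹ₚ.T? (B u)
  ... | yes u∈B = inj₁ (u , u∈B , refl)
  ... | no  u∉B = inj₂ (v∈S , u∉B)
  hits-B-before {u = u} (step {w = w} _ (e , _) p) v∈S with hits-B-before p v∈S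
  ... | inj₁ (x , x∈B , x∈p) = inj₁ (x , x∈B , inj₂ x∈p)
  ... | inj₂ (w∈S , w∉B) with 𝔹ₚ.T? (B u)
  ...   | yes u∈B = inj₁ (u , u∈B , inj₁ refl)
  ...   | no  u∉B = inj₂ (proj₂ (closed w w∈S w∉B) u (Adj-sym G e) , u∉B)

  hits-B-after : ∀ {a b u v} (p : WalkAvoiding a b u v) → T (S u) → (∃ λ x → T (B x) × p ∋ʷ x) ⊎ (T (S v) × ¬ T (B v))
  hits-B-after {u = u} p u∈S with 𝔹ₚ.T? (B u)
  ... | yes u∈B = inj₁ (u , u∈B , ∋ʷ-start p)
  hits-B-after (stop _) u∈S | no u∉B = inj₂ (u∈S , u∉B)
  hits-B-after {u = u} (step {w = w} _ (e , _) p) u∈S | no u∉B =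
    Sum.map₁ (λ (x , x∈B , x∈p) → x , x∈B , inj₂ x∈p) (hits-B-after p (proj₂ (closed u u∈S u∉B) w e))

  terminal-not-inside : ∀ i → ¬ (T (S (R i)) × ¬ T (B (R i)))
  terminal-not-inside i (∈S , ∉B) = proj₁ (closed (R i) ∈S ∉B) i refl

  Local : V → V → Set
  Local v x = ∃₂ λ b b′ → T (B b) × T (B b′) × Through b b′ v x

  -- Both ends of the edge lie in `S` and no terminal lies in `S ∖ B`, so each half of the forced
  -- walk meets `B` and can be cut there.
  localise : ∀ {v x} → T (S v) → ¬ T (B v) → Adj G v x → Local v x
  localise {v} {x} v∈S v∉B e with Forced⇒Through {R = R} e (forced v x e)
  ... | i , j , T₀ with hits-B-before (Through.before T₀) v∈S | hits-B-after (Through.after T₀) (proj₂ (closed v v∈S v∉B) x e)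
  ... | inj₂ inside | _ = ⊥-elim (terminal-not-inside i inside)
  ... | inj₁ _ | inj₂ inside = ⊥-elim (terminal-not-inside j inside)
  ... | inj₁ (b , b∈B , b∈) | inj₁ (b′ , b′∈B , b′∈) = b , b′ , b∈B , b′∈B , Through-localise T₀ b∈ b′∈

  Charged : V → Set
  Charged v = ∃ λ b → ∃ λ b′ → ∃ λ c → ∃ λ c′ → (T (B b) × T (B b′) × T (B c) × T (B c′)) × Charge v b b′ c c′

  canonical-uses : ∀ {c c′ v x} → Through c c′ v x → (o : ¬ Walk G c c′ ⊎ (Σ (Walk G c c′) λ p → Minimal (len ℓ) p × Simple p)) →
                   Σ (Walk G c c′) λ p → Σ (Minimal (len ℓ) p × Simple p) λ q → o ≡ inj₂ (p , q) × Uses p v x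
  canonical-uses U (inj₁ none) = contradiction (proj₁ (throughWalk U)) none
  canonical-uses {v = v} {x} U (inj₂ (p , p-min , simple)) with uses? p v x
  ... | yes use = p , (p-min , simple) , refl , use
  ... | no unused with avoidʷ p unused
  ...   | q , q≡p , _ = ⊥-elim (ℚₚ.<-irrefl refl (ℚₚ.<-≤-trans (Through.forced-total U q)
          (ℚₚ.≤-trans (ℚₚ.≤-reflexive (q≡p (len ℓ)))
            (ℚₚ.≤-trans (p-min (proj₁ (throughWalk U))) (ℚₚ.≤-reflexive (proj₂ (throughWalk U)))))))

  -- The canonical walk of the pair that forces `v x` must use this edge and hence visits `v`. Being
  -- simple, it misses `v y` or `v z`; the missed edge and the pair forcing it complete the charge.
  charge : ∀ v → T (S v) → ¬ T (B v) → Charged v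
  charge v v∈S v∉B with branching v
  ... | inj₁ (i , Ri≡v) = contradiction Ri≡v (proj₁ (closed v v∈S v∉B) i)
  ... | inj₂ (x , y , z , vx , vy , vz , x≢y , x≢z , y≢z)
    with localise v∈S v∉B vx | localise v∈S v∉B vy | localise v∈S v∉B vz
  ...   | c , c′ , c∈B , c′∈B , U | b , b′ , b∈B , b′∈B , Ty | d , d′ , d∈B , d′∈B , Tz
    with canonical-uses U (canonical c c′)
  ...     | p , pq , p≡ , use-x with uses? p v y | uses? p v z
  ...       | no unused-y | _ = b , b′ , c , c′ , (b∈B , b′∈B , c∈B , c′∈B) , y , Ty ,
                subst (λ o → OffCanonical o v y) (sym p≡) (Uses⇒∋ p use-x , unused-y)
  ...       | yes _ | no unused-z = d , d′ , c , c′ , (d∈B , d′∈B , c∈B , c′∈B) , z , Tz ,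
                subst (λ o → OffCanonical o v z) (sym p≡) (Uses⇒∋ p use-x , unused-z)
  ...       | yes use-y | yes use-z with Simple-two-edges p (proj₂ pq) use-x use-y use-z
  ...         | inj₁ x≡y        = contradiction x≡y x≢y
  ...         | inj₂ (inj₁ x≡z) = contradiction x≡z x≢z
  ...         | inj₂ (inj₂ y≡z) = contradiction y≡z y≢z

  private
    inside : V → Bool
    inside v = S v ∧ not (B v)

    inside⁻ : ∀ {v} → T (inside v) → T (S v) × ¬ T (B v)
    inside⁻ {v} v∈ with S v | B v
    inside⁻ v∈ | true | false = tt , id

    b = count B

    code : ∀ v → T (inside v) → Fin ((b *ℕ b) *ℕ (b *ℕ b))
    code v v∈ with charge v (proj₁ (inside⁻ v∈)) (proj₂ (inside⁻ {v} v∈))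
    ... | s , s′ , t , t′ , (s∈B , s′∈B , t∈B , t′∈B) , _ =
      combine (combine (rank B s s∈B) (rank B s′ s′∈B)) (combine (rank B t t∈B) (rank B t′ t′∈B))

    code-injective : ∀ v w v∈ w∈ → code v v∈ ≡ code w w∈ → v ≡ w
    code-injective v w v∈ w∈ eq
      with charge v (proj₁ (inside⁻ v∈)) (proj₂ (inside⁻ {v} v∈)) | charge w (proj₁ (inside⁻ w∈)) (proj₂ (inside⁻ {w} w∈))
    ... | s , s′ , t , t′ , (s∈ , s′∈ , t∈ , t′∈) , charge-v | u , u′ , r , r′ , (u∈ , u′∈ , r∈ , r′∈) , charge-w
      with Fₚ.combine-injective (combine (rank B s s∈) (rank B s′ s′∈)) (combine (rank B t t∈) (rank B t′ t′∈)) _ _ eq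
    ... | eq₁ , eq₂ with Fₚ.combine-injective (rank B s s∈) (rank B s′ s′∈) _ _ eq₁
                       | Fₚ.combine-injective (rank B t t∈) (rank B t′ t′∈) _ _ eq₂
    ... | e₁ , e₂ | e₃ , e₄
      with rank-injective B s u s∈ u∈ e₁ | rank-injective B s′ u′ s′∈ u′∈ e₂
         | rank-injective B t r t∈ r∈ e₃ | rank-injective B t′ r′ t′∈ r′∈ e₄
    ... | refl | refl | refl | refl = Charge-injective charge-v charge-w

  inside-bound : count (λ v → S v ∧ not (B v)) ≤ℕ (count B *ℕ count B) *ℕ (count B *ℕ count B)
  inside-bound = count-injection inside code code-injective

  piece-bound : count S ≤ℕ (count B *ℕ count B) *ℕ (count B *ℕ count B) +ℕ count B
  piece-bound = ℕₚ.≤-trans (count-∨ {f = S} {inside} {B} split) (ℕₚ.+-monoˡ-≤ (count B) inside-bound)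
    where
    split : ∀ v → T (S v) → T (inside v) ⊎ T (B v)
    split v v∈S with B v
    ... | true  = inj₂ tt
    ... | false = inj₁ (T-∧⁺ (v∈S , tt))

-- Tree decompositions

-- A bag of `H` holds the vertices whose branch sets meet the bag of `G`; branch sets are disjoint,
-- so bags do not grow. For coherence, the subtrees of the vertices on a walk inside a branch set
-- are chained, as consecutive vertices share a bag.
TW-minor : ∀ {p G H k} {R : Fin k → Fin (size G)} → TerminalMinor G H R → TW p G → TW p H
TW-minor {p} {G} {H} M td = record
  { m          = m
  ; parent     = parent
  ; parent-<   = parent-<
  ; bag        = λ t → tabulate (bagᴴ t)
  ; bag-size   = bag-sizeᴴ
  ; vertex-cov = λ x → let v , v∈x = nonempty x ; t , v∈t = vertex-cov v in t , ∈bagᴴ⁺ v∈t v∈x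
  ; edge-cov   = λ x y e → let u , v , u∈x , v∈y , uv = edges x y e ; t , u∈t , v∈t = edge-cov u v uv in
                   t , ∈bagᴴ⁺ u∈t u∈x , ∈bagᴴ⁺ v∈t v∈y
  ; coherent   = λ x s t x∈s x∈t → let u , u∈s , u∈x = ∈bagᴴ⁻ x∈s ; v , v∈t , v∈x = ∈bagᴴ⁻ x∈t in
                   coherentᴴ (connected x u v u∈x v∈x) u∈s v∈t
  }
  where
  open TreeDecomposition td
  open TerminalMinor M
  inBag? : ∀ t x → Dec (∃ λ v → T (lookup (bag t) v) × branch v ≡ just x)
  inBag? t x = Fₚ.any? λ v → 𝔹ₚ.T? (lookup (bag t) v) ×-dec Maybeₚ.≡-dec Fₚ._≟_ (branch v) (just x)
  bagᴴ : Fin (suc m) → Fin (size H) → Bool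
  bagᴴ t x = ⌊ inBag? t x ⌋
  ∈bagᴴ⁺ : ∀ {t x v} → v ∈ bag t → branch v ≡ just x → x ∈ tabulate (bagᴴ t)
  ∈bagᴴ⁺ {t} {x} {v} v∈t v∈x = ∈-tabulate⁺ (bagᴴ t) (fromWitness {a? = inBag? t x}
    (v , Equivalence.from 𝔹ₚ.T-≡ (Vecₚ.[]=⇒lookup v∈t) , v∈x))
  ∈bagᴴ⁻ : ∀ {t x} → x ∈ tabulate (bagᴴ t) → ∃ λ v → v ∈ bag t × branch v ≡ just x
  ∈bagᴴ⁻ {t} {x} x∈ with toWitness {a? = inBag? t x} (∈-tabulate⁻ (bagᴴ t) x∈)
  ... | v , v∈t , v∈x = v , Vecₚ.lookup⇒[]= v (bag t) (Equivalence.to 𝔹ₚ.T-≡ v∈t) , v∈x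
  bag-sizeᴴ : ∀ t → ∣ tabulate (bagᴴ t) ∣ ≤ℕ suc p
  bag-sizeᴴ t = subst (_≤ℕ suc p) (sym (∣tabulate∣≡count (bagᴴ t)))
    (ℕₚ.≤-trans (count-injection (bagᴴ t) code code-injective) (subst (_≤ℕ suc p) (∣∣≡count (bag t)) (bag-size t)))
    where
    code : ∀ x → T (bagᴴ t x) → Fin (count (lookup (bag t)))
    code x x∈ = let v , v∈t , _ = toWitness {a? = inBag? t x} x∈ in rank (lookup (bag t)) v v∈t
    code-injective : ∀ x y x∈ y∈ → code x x∈ ≡ code y y∈ → x ≡ y
    code-injective x y x∈ y∈ eq with toWitness {a? = inBag? t x} x∈ | toWitness {a? = inBag? t y} y∈
    ... | v , v∈t , v∈x | w , w∈t , w∈y with rank-injective (lookup (bag t)) v w v∈t w∈t eq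
    ... | refl = Maybeₚ.just-injective (trans (sym v∈x) w∈y)
  coherentᴴ : ∀ {x u v s t} → WalkIn (Adj G) (λ w → branch w ≡ just x) u v → u ∈ bag s → v ∈ bag t →
              WalkIn (TreeAdj parent) (λ r → x ∈ tabulate (bagᴴ r)) s t
  coherentᴴ (stop {u} u∈x) u∈s u∈t = mapʷ id (λ u∈r → ∈bagᴴ⁺ u∈r u∈x) (coherent u _ _ u∈s u∈t)
  coherentᴴ (step {u} {w} u∈x e p) u∈s v∈t with edge-cov u w e
  ... | r , u∈r , w∈r = mapʷ id (λ u∈r → ∈bagᴴ⁺ u∈r u∈x) (coherent u _ _ u∈s u∈r) ++ʷ coherentᴴ p w∈r v∈t

-- Cutting a tree decomposition into pieces

module _ {m : ℕ} (parent : Fin m → Fin (suc m)) (parent-< : ∀ i → toℕ (parent i) ≤ℕ toℕ i) where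

  data Descendant (t : Fin (suc m)) : Fin (suc m) → Set where
    here  : Descendant t t
    there : ∀ {i} → Descendant t (parent i) → Descendant t (suc i)

  Descendant-≤ : ∀ {t u} → Descendant t u → toℕ t ≤ℕ toℕ u
  Descendant-≤ here          = ℕₚ.≤-refl
  Descendant-≤ (there {i} d) = ℕₚ.m≤n⇒m≤1+n (ℕₚ.≤-trans (Descendant-≤ d) (parent-< i))

  -- All nodes below `suc i` have index at least `suc i`, so the walk must leave this subtree, and
  -- its only exit is the edge to `parent i`.
  leaves-through-parent : ∀ {P : Fin (suc m) → Set} {i u s} → WalkIn (TreeAdj parent) P u s →
                          Descendant (suc i) u → toℕ s ≤ℕ toℕ i → P (parent i)
  leaves-through-parent (stop _) d s≤i = contradiction (ℕₚ.≤-trans (Descendant-≤ d) s≤i) ℕₚ.1+n≰n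
  leaves-through-parent (step _ (inj₁ (j , refl , refl)) p) here      s≤i = start-∈ p
  leaves-through-parent (step _ (inj₁ (j , refl , refl)) p) (there d) s≤i = leaves-through-parent p d s≤i
  leaves-through-parent (step _ (inj₂ (j , refl , refl)) p) d         s≤i = leaves-through-parent p (there d) s≤i

-- The leaf of largest index is repeatedly merged into its parent; whenever the boundary W collected
-- at a node exceeds 2s, everything hanging there is cut off as a piece, and the bag becomes boundary.
module Peel (G : Graph) {p : ℕ} (td : TreeDecomposition G p) {k : ℕ} (R : Fin k → Fin (size G)) (K : ℕ)
            (bound : ∀ (S B : Fin (size G) → Bool) →
                     (∀ v → T (S v) → ¬ T (B v) → (∀ i → R i ≢ v) × (∀ x → Adj G v x → T (S x))) →
                     count B ≤ℕ 5 *ℕ suc p → count S ≤ℕ K) where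
  open TreeDecomposition td

  private
    V    = Fin (size G)
    Node = Fin (suc m)
    s    = suc p

  β : Node → V → Bool
  β t = lookup (bag t)

  β-size : ∀ t → count (β t) ≤ℕ s
  β-size t = subst (_≤ℕ s) (∣∣≡count (bag t)) (bag-size t)

  β⁺ : ∀ {t v} → v ∈ bag t → T (β t v)
  β⁺ v∈ = Equivalence.from 𝔹ₚ.T-≡ (Vecₚ.[]=⇒lookup v∈)

  β⁻ : ∀ {t v} → T (β t v) → v ∈ bag t
  β⁻ {t} {v} v∈ = Vecₚ.lookup⇒[]= v (bag t) (Equivalence.to 𝔹ₚ.T-≡ v∈)

  -- Among the nodes of index at most `suc i`, the node `suc i` is a leaf: what its bag shares with
  -- the other bags passes through its parent.
  β-parent : ∀ {i t v} → toℕ t ≤ℕ toℕ i → T (β (suc i) v) → T (β t v) → T (β (parent i) v)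
  β-parent {i} {t} {v} t≤i v∈i v∈t =
    β⁺ (leaves-through-parent parent parent-< (coherent v (suc i) t (β⁻ v∈i) (β⁻ v∈t)) here t≤i)

  -- O t is the part of the graph hanging at t; w assigns boundary vertices to nodes.
  record Valid (j : ℕ) (O : Node → V → Bool) (w : V → Maybe Node) : Set where
    field
      low       : ∀ {v t} → w v ≡ just t → toℕ t ≤ℕ j
      closed    : ∀ {t v} → toℕ t ≤ℕ j → T (O t v) → ¬ T (β t v) → w v ≢ just t →
                  (∀ i → R i ≢ v) × (∀ x → Adj G v x → T (O t x) ⊎ T (β t x))
      covered   : ∀ {t v} → toℕ t ≤ℕ j → T (β t v) → w v ≡ nothing → ∀ {x} → Adj G v x →
                  ∃ λ r → toℕ r ≤ℕ j × T (β r v) × (T (O r x) ⊎ T (β r x))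
      settled   : ∀ {v t r} → w v ≡ just t → toℕ r ≤ℕ j → T (β r v) → T (β t v)
      terminals : ∀ {i t} → toℕ t ≤ℕ j → T (β t (R i)) → w (R i) ≢ nothing

  at? : (w : V → Maybe Node) (t : Node) (v : V) → Dec (w v ≡ just t)
  at? w t v = Maybeₚ.≡-dec Fₚ._≟_ (w v) (just t)

  at : (V → Maybe Node) → Node → V → Bool
  at w t v = ⌊ at? w t v ⌋

  assigned : (V → Maybe Node) → V → Bool
  assigned w v = is-just (w v)

  weight : (V → Maybe Node) → ℕ
  weight w = count (assigned w)

  alive? : ∀ j (O : Node → V → Bool) v → Dec (∃ λ t → toℕ t ≤ℕ j × (T (O t v) ⊎ T (β t v)))
  alive? j O v = Fₚ.any? λ t → (toℕ t ℕₚ.≤? j) ×-dec (𝔹ₚ.T? (O t v) ⊎-dec 𝔹ₚ.T? (β t v))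

  alive : ℕ → (Node → V → Bool) → V → Bool
  alive j O v = ⌊ alive? j O v ⌋

  alive⁺ : ∀ {j O v t} → toℕ t ≤ℕ j → T (O t v) ⊎ T (β t v) → T (alive j O v)
  alive⁺ {j} {O} {v} {t} t≤j v∈t = fromWitness {a? = alive? j O v} (t , t≤j , v∈t)

  alive⁻ : ∀ {j O v} → T (alive j O v) → ∃ λ t → toℕ t ≤ℕ j × (T (O t v) ⊎ T (β t v))
  alive⁻ {j} {O} {v} = toWitness {a? = alive? j O v}

  hanging : (Node → V → Bool) → Node → V → Bool
  hanging O t v = O t v ∨ β t v

  -- The boundary consists of the vertices assigned to `t` and the bag of `t`, which accounts for
  -- the 4s + s = 5s allowed by `bound`.
  piece-size : ∀ {j O w} → Valid j O w → ∀ {t} → toℕ t ≤ℕ j → count (at w t) ≤ℕ 4 *ℕ s → count (hanging O t) ≤ℕ K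
  piece-size {j} {O} {w} valid {t} t≤j at≤ = bound (hanging O t) boundary closed′ boundary-size
    where
    open Valid valid
    boundary : V → Bool
    boundary v = at w t v ∨ β t v
    closed′ : ∀ v → T (hanging O t v) → ¬ T (boundary v) →
              (∀ i → R i ≢ v) × (∀ x → Adj G v x → T (hanging O t x))
    closed′ v v∈ v∉ with T-∨⁻ {O t v} v∈
    ... | inj₂ v∈β = contradiction (T-∨⁺ {at w t v} (inj₂ v∈β)) v∉
    ... | inj₁ v∈O with closed t≤j v∈O (λ v∈β → v∉ (T-∨⁺ {at w t v} (inj₂ v∈β)))
                          (λ eq → v∉ (T-∨⁺ (inj₁ (fromWitness {a? = at? w t v} eq))))
    ...   | not-terminal , nbrs = not-terminal , λ x e → T-∨⁺ (nbrs x e)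
    boundary-size : count boundary ≤ℕ 5 *ℕ s
    boundary-size = ℕₚ.≤-trans (count-∨ {f = boundary} {at w t} {β t} (λ v → T-∨⁻ {at w t v}))
      (ℕₚ.≤-trans (ℕₚ.+-mono-≤ at≤ (β-size t)) (ℕₚ.≤-reflexive (ℕₚ.+-comm (4 *ℕ s) s)))

  module Merge (i : Fin m) (O : Node → V → Bool) (w : V → Maybe Node) (valid : Valid (toℕ (suc i)) O w) where
    open Valid valid

    private
      leaf = suc i
      q    = parent i
      j    = toℕ i

    O′ : Node → V → Bool
    O′ t v = O t v ∨ (⌊ t Fₚ.≟ q ⌋ ∧ hanging O leaf v)

    move : Maybe Node → Maybe Node
    move nothing = nothing
    move (just t) with t Fₚ.≟ leaf
    ... | yes _ = just q
    ... | no  _ = just t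

    w′ : V → Maybe Node
    w′ v = move (w v)

    O⊆O′ : ∀ {t v} → T (O t v) → T (O′ t v)
    O⊆O′ = T-∨⁺ ∘ inj₁

    leaf⊆O′ : ∀ {v} → T (O leaf v) ⊎ T (β leaf v) → T (O′ q v)
    leaf⊆O′ {v} v∈ = T-∨⁺ {O q v} (inj₂ (T-∧⁺ (fromWitness {a? = q Fₚ.≟ q} refl , T-∨⁺ v∈)))

    O′⁻ : ∀ {t v} → T (O′ t v) → T (O t v) ⊎ (t ≡ q × (T (O leaf v) ⊎ T (β leaf v)))
    O′⁻ {t} {v} v∈ with T-∨⁻ {O t v} v∈
    ... | inj₁ v∈O = inj₁ v∈O
    ... | inj₂ v∈l with T-∧⁻ {⌊ t Fₚ.≟ q ⌋} v∈l
    ...   | t≡q , v∈h = inj₂ (toWitness {a? = t Fₚ.≟ q} t≡q , T-∨⁻ {O leaf v} v∈h)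

    move-just : ∀ {y t} → move y ≡ just t → (y ≡ just leaf × t ≡ q) ⊎ (y ≡ just t × t ≢ leaf)
    move-just {just r} eq with r Fₚ.≟ leaf
    move-just {just r} refl | yes refl = inj₁ (refl , refl)
    move-just {just r} refl | no r≢    = inj₂ (refl , r≢)

    move-nothing : ∀ {y} → move y ≡ nothing → y ≡ nothing
    move-nothing {nothing} _ = refl
    move-nothing {just r} eq with r Fₚ.≟ leaf
    move-nothing {just r} () | yes _
    move-nothing {just r} () | no _

    move-keep : ∀ {t} → t ≢ leaf → move (just t) ≡ just t
    move-keep {t} t≢ with t Fₚ.≟ leaf
    ... | yes t≡ = contradiction t≡ t≢
    ... | no _   = refl

    move-leaf : move (just leaf) ≡ just q
    move-leaf with leaf Fₚ.≟ leaf
    ... | yes _ = refl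
    ... | no l≢ = contradiction refl l≢

    up : ∀ {t : Node} → toℕ t ≤ℕ j → toℕ t ≤ℕ suc j
    up = ℕₚ.m≤n⇒m≤1+n

    leaf-or-below : ∀ {t : Node} → toℕ t ≤ℕ suc j → t ≡ leaf ⊎ toℕ t ≤ℕ j
    leaf-or-below t≤ with ℕₚ.m≤n⇒m<n∨m≡n t≤
    ... | inj₁ t<  = inj₂ (ℕₚ.≤-pred t<)
    ... | inj₂ t≡  = inj₁ (Fₚ.toℕ-injective t≡)

    below≢leaf : ∀ {t : Node} → toℕ t ≤ℕ j → t ≢ leaf
    below≢leaf t≤j refl = ℕₚ.1+n≰n t≤j

    leaf-only : ∀ {t v} → T (β leaf v) → ¬ T (β q v) → toℕ t ≤ℕ suc j → T (β t v) → t ≡ leaf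
    leaf-only v∈l v∉q t≤ v∈t with leaf-or-below t≤
    ... | inj₁ t≡leaf = t≡leaf
    ... | inj₂ t≤j    = contradiction (β-parent t≤j v∈l v∈t) v∉q

    valid′ : Valid j O′ w′
    valid′ = record
      { low       = low′
      ; closed    = closed′
      ; covered   = covered′
      ; settled   = settled′
      ; terminals = λ t≤j v∈t eq → terminals (up t≤j) v∈t (move-nothing eq)
      }
      where
      low′ : ∀ {v t} → w′ v ≡ just t → toℕ t ≤ℕ j
      low′ {v} eq with move-just {w v} eq
      ... | inj₁ (_ , refl) = parent-< i
      ... | inj₂ (eq′ , t≢leaf) with leaf-or-below (low eq′)
      ...   | inj₁ t≡leaf = contradiction t≡leaf t≢leaf
      ...   | inj₂ t≤j    = t≤j
      weaken : ∀ {t x} → T (O t x) ⊎ T (β t x) → T (O′ t x) ⊎ T (β t x)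
      weaken = Sum.map₁ O⊆O′
      -- By `settled`, a vertex of the leaf bag that is assigned anywhere also lies in the bag of
      -- its node. A vertex outside the parent bag leaves only the leaf as that node.
      unassigned : ∀ {v} → T (β leaf v) → ¬ T (β q v) → w v ≢ just leaf → w v ≡ nothing
      unassigned {v} v∈l v∉q ≢leaf with w v in eq
      ... | nothing = refl
      ... | just t with leaf-only v∈l v∉q (low eq) (settled eq ℕₚ.≤-refl v∈l)
      ...   | refl = contradiction refl ≢leaf
      closed′ : ∀ {t v} → toℕ t ≤ℕ j → T (O′ t v) → ¬ T (β t v) → w′ v ≢ just t →
                (∀ i → R i ≢ v) × (∀ x → Adj G v x → T (O′ t x) ⊎ T (β t x))
      closed′ {t} {v} t≤j v∈ v∉β w≢ with O′⁻ {t} {v} v∈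
      ... | inj₁ v∈O with closed (up t≤j) v∈O v∉β (λ eq → w≢ (trans (cong move eq) (move-keep (below≢leaf t≤j))))
      ...   | not-terminal , nbrs = not-terminal , λ x e → weaken (nbrs x e)
      closed′ {t} {v} t≤j v∈ v∉β w≢ | inj₂ (refl , v∈h) with 𝔹ₚ.T? (β leaf v) | v∈h
      ... | no v∉l  | inj₂ v∈l = contradiction v∈l v∉l
      ... | no v∉l  | inj₁ v∈O with closed ℕₚ.≤-refl v∈O v∉l (λ eq → w≢ (trans (cong move eq) move-leaf))
      ...   | not-terminal , nbrs = not-terminal , λ x e → inj₁ (leaf⊆O′ (nbrs x e))
      -- Here `v` drops out of the remaining bags. It is unassigned, hence no terminal by
      -- `terminals`, and `covered` finds all its edges at the leaf.
      closed′ {t} {v} t≤j v∈ v∉β w≢ | inj₂ (refl , v∈h) | yes v∈l | _ = not-terminal , nbrs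
        where
        w≡nothing : w v ≡ nothing
        w≡nothing = unassigned v∈l v∉β (λ eq → w≢ (trans (cong move eq) move-leaf))
        not-terminal : ∀ i → R i ≢ v
        not-terminal i refl = terminals ℕₚ.≤-refl v∈l w≡nothing
        nbrs : ∀ x → Adj G v x → T (O′ q x) ⊎ T (β q x)
        nbrs x e with covered ℕₚ.≤-refl v∈l w≡nothing e
        ... | r , r≤ , v∈r , x∈r with leaf-only v∈l v∉β r≤ v∈r
        ...   | refl = inj₁ (leaf⊆O′ x∈r)
      covered′ : ∀ {t v} → toℕ t ≤ℕ j → T (β t v) → w′ v ≡ nothing → ∀ {x} → Adj G v x →
                 ∃ λ r → toℕ r ≤ℕ j × T (β r v) × (T (O′ r x) ⊎ T (β r x))
      covered′ {t} {v} t≤j v∈t eq e with covered (up t≤j) v∈t (move-nothing eq) e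
      ... | r , r≤ , v∈r , x∈r with leaf-or-below r≤
      ...   | inj₁ refl = q , parent-< i , β-parent t≤j v∈r v∈t , inj₁ (leaf⊆O′ x∈r)
      ...   | inj₂ r≤j  = r , r≤j , v∈r , weaken x∈r
      settled′ : ∀ {v t r} → w′ v ≡ just t → toℕ r ≤ℕ j → T (β r v) → T (β t v)
      settled′ {v} eq r≤j v∈r with move-just {w v} eq
      ... | inj₁ (eq′ , refl) = β-parent r≤j (settled eq′ (up r≤j) v∈r) v∈r
      ... | inj₂ (eq′ , _)    = settled eq′ (up r≤j) v∈r

    weight-≤ : weight w′ ≤ℕ weight w
    weight-≤ = count-mono λ v → keeps (w v)
      where
      keeps : ∀ y → T (is-just (move y)) → T (is-just y)
      keeps (just _) _ = tt

    at-≤ : ∀ {t} → t ≢ q → count (at w′ t) ≤ℕ count (at w t)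
    at-≤ {t} t≢q = count-mono λ v v∈ → case move-just {w v} (toWitness {a? = at? w′ t v} v∈) of λ
      { (inj₁ (_ , t≡q)) → contradiction t≡q t≢q
      ; (inj₂ (eq , _))  → fromWitness {a? = at? w t v} eq }

    at-q : count (at w′ q) ≤ℕ count (at w q) +ℕ count (at w leaf)
    at-q = count-∨ λ v v∈ → case move-just {w v} (toWitness {a? = at? w′ q v} v∈) of λ
      { (inj₁ (eq , _)) → inj₂ (fromWitness {a? = at? w leaf v} eq)
      ; (inj₂ (eq , _)) → inj₁ (fromWitness {a? = at? w q v} eq) }

    alive-≤ : ∀ v → T (alive (suc j) O v) → T (alive j O′ v)
    alive-≤ v v∈ with alive⁻ {suc j} {O} {v} v∈
    ... | t , t≤ , v∈t with leaf-or-below t≤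
    ...   | inj₁ refl = alive⁺ {O = O′} (parent-< i) (inj₁ (leaf⊆O′ v∈t))
    ...   | inj₂ t≤j  = alive⁺ {O = O′} t≤j (Sum.map₁ O⊆O′ v∈t)

  module Cut (j : ℕ) (q : Node) (q≤j : toℕ q ≤ℕ j)
             (O : Node → V → Bool) (w : V → Maybe Node) (valid : Valid j O w) where
    open Valid valid

    O′ : Node → V → Bool
    O′ t v = O t v ∧ not ⌊ t Fₚ.≟ q ⌋

    -- The flag tells whether the vertex is in the bag of `q`. All of this bag becomes boundary at
    -- `q`, wherever it was assigned before; other vertices held at `q` go with the piece.
    settle : Bool → Maybe Node → Maybe Node
    settle true  _ = just q
    settle false nothing = nothing
    settle false (just t) with t Fₚ.≟ q
    ... | yes _ = nothing
    ... | no  _ = just t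

    w′ : V → Maybe Node
    w′ v = settle (β q v) (w v)

    O′⁻ : ∀ {t v} → T (O′ t v) → T (O t v) × t ≢ q
    O′⁻ {t} {v} v∈ with T-∧⁻ {O t v} v∈
    ... | v∈O , ne = v∈O , λ t≡q → subst T (Equivalence.to 𝔹ₚ.T-not-≡ ne) (fromWitness {a? = t Fₚ.≟ q} t≡q)

    O′⁺ : ∀ {t v} → t ≢ q → T (O t v) → T (O′ t v)
    O′⁺ {t} t≢q v∈O with t Fₚ.≟ q
    ... | yes t≡q = contradiction t≡q t≢q
    ... | no _    = T-∧⁺ (v∈O , tt)

    settle-just : ∀ {b y t} → settle b y ≡ just t → (T b × t ≡ q) ⊎ (¬ T b × y ≡ just t × t ≢ q)
    settle-just {true} refl = inj₁ (tt , refl)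
    settle-just {false} {just r} eq with r Fₚ.≟ q
    settle-just {false} {just r} refl | no r≢q = inj₂ (id , refl , r≢q)

    settle-nothing : ∀ {b y} → settle b y ≡ nothing → ¬ T b × (y ≡ nothing ⊎ y ≡ just q)
    settle-nothing {false} {nothing} _ = id , inj₁ refl
    settle-nothing {false} {just r} eq with r Fₚ.≟ q
    ... | yes refl = id , inj₂ refl

    settle-keep : ∀ {b t} → ¬ T b → t ≢ q → settle b (just t) ≡ just t
    settle-keep {true}  ¬b _ = contradiction tt ¬b
    settle-keep {false} {t} _ t≢q with t Fₚ.≟ q
    ... | yes t≡q = contradiction t≡q t≢q
    ... | no _    = refl

    -- A vertex held at `q` but outside its bag lies in no remaining bag, by `settled`; the vertices
    -- released by the cut are therefore never met again.
    unassigned : ∀ {t v} → toℕ t ≤ℕ j → T (β t v) → w′ v ≡ nothing → ¬ T (β q v) × w v ≡ nothing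
    unassigned {t} {v} t≤j v∈t eq with settle-nothing {β q v} {w v} eq
    ... | v∉q , inj₁ w≡nothing = v∉q , w≡nothing
    ... | v∉q , inj₂ w≡q       = contradiction (settled w≡q t≤j v∈t) v∉q

    valid′ : Valid j O′ w′
    valid′ = record
      { low       = low′
      ; closed    = closed′
      ; covered   = covered′
      ; settled   = settled′
      ; terminals = λ t≤j v∈t eq → terminals t≤j v∈t (proj₂ (unassigned t≤j v∈t eq))
      }
      where
      low′ : ∀ {v t} → w′ v ≡ just t → toℕ t ≤ℕ j
      low′ {v} eq with settle-just {β q v} {w v} eq
      ... | inj₁ (_ , refl)    = q≤j
      ... | inj₂ (_ , eq′ , _) = low eq′
      closed′ : ∀ {t v} → toℕ t ≤ℕ j → T (O′ t v) → ¬ T (β t v) → w′ v ≢ just t →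
                (∀ i → R i ≢ v) × (∀ x → Adj G v x → T (O′ t x) ⊎ T (β t x))
      closed′ {t} {v} t≤j v∈ v∉β w≢ with O′⁻ {t} {v} v∈
      ... | v∈O , t≢q with closed t≤j v∈O v∉β w≢′
        where
        w≢′ : w v ≢ just t
        w≢′ eq = w≢ (trans (cong (settle (β q v)) eq) (settle-keep (λ v∈q → v∉β (settled eq q≤j v∈q)) t≢q))
      ...   | not-terminal , nbrs = not-terminal , λ x e → Sum.map₁ (O′⁺ t≢q) (nbrs x e)
      covered′ : ∀ {t v} → toℕ t ≤ℕ j → T (β t v) → w′ v ≡ nothing → ∀ {x} → Adj G v x →
                 ∃ λ r → toℕ r ≤ℕ j × T (β r v) × (T (O′ r x) ⊎ T (β r x))
      covered′ {t} {v} t≤j v∈t eq e with unassigned t≤j v∈t eq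
      ... | v∉q , w≡nothing with covered t≤j v∈t w≡nothing e
      -- The covering node `r` differs from `q`, whose bag omits `v`, so what hangs at `r` survives
      -- the cut.
      ...   | r , r≤j , v∈r , x∈r = r , r≤j , v∈r , Sum.map₁ (O′⁺ λ { refl → v∉q v∈r }) x∈r
      settled′ : ∀ {v t r} → w′ v ≡ just t → toℕ r ≤ℕ j → T (β r v) → T (β t v)
      settled′ {v} eq r≤j v∈r with settle-just {β q v} {w v} eq
      ... | inj₁ (v∈q , refl)  = v∈q
      ... | inj₂ (_ , eq′ , _) = settled eq′ r≤j v∈r

    weight-drops : weight w′ +ℕ count (at w q) ≤ℕ weight w +ℕ count (β q)
    weight-drops = count-mono-+ {f = assigned w′} {at w q} {assigned w} {β q} pointwise
      where
      pointwise : ∀ v → # (assigned w′ v) +ℕ # (at w q v) ≤ℕ # (assigned w v) +ℕ # (β q v)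
      pointwise v with β q v | w v
      ... | true  | nothing = s≤s z≤n
      ... | true  | just t with t Fₚ.≟ q
      ...   | yes _ = s≤s (s≤s z≤n)
      ...   | no _  = s≤s z≤n
      pointwise v | false | nothing = z≤n
      pointwise v | false | just t with t Fₚ.≟ q
      ...   | yes _ = s≤s z≤n
      ...   | no _  = s≤s z≤n

    at-q : count (at w′ q) ≤ℕ s
    at-q = ℕₚ.≤-trans (count-mono λ v v∈ → case settle-just {β q v} {w v} (toWitness {a? = at? w′ q v} v∈) of λ
      { (inj₁ (v∈q , _)) → v∈q ; (inj₂ (_ , _ , q≢q)) → contradiction refl q≢q }) (β-size q)

    at-≤ : ∀ {t} → t ≢ q → count (at w′ t) ≤ℕ count (at w t)
    at-≤ {t} t≢q = count-mono λ v v∈ → case settle-just {β q v} {w v} (toWitness {a? = at? w′ t v} v∈) of λ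
      { (inj₁ (_ , t≡q)) → contradiction t≡q t≢q ; (inj₂ (_ , eq , _)) → fromWitness {a? = at? w t v} eq }

    alive-≤ : ∀ v → T (alive j O v) → T (hanging O q v) ⊎ T (alive j O′ v)
    alive-≤ v v∈ with alive⁻ {j} {O} {v} v∈
    ... | t , t≤j , v∈t with t Fₚ.≟ q
    ...   | yes refl = inj₁ (T-∨⁺ v∈t)
    ...   | no t≢q   = inj₂ (alive⁺ {O = O′} t≤j (Sum.map₁ (O′⁺ t≢q) v∈t))

  -- Every cut removes at most `K` vertices and lowers the weight by at least s, so the lost weight
  -- pays for the pieces. The additional s pays for the last piece, at the root.
  Peelable : ℕ → Set
  Peelable j = ∀ {O w} → Valid j O w → (∀ {r} → toℕ r ≤ℕ j → count (at w r) ≤ℕ 2 *ℕ s) →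
               s *ℕ count (alive j O) ≤ℕ K *ℕ (weight w +ℕ s)

  peel-step : ∀ i → Peelable (toℕ i) → Peelable (suc (toℕ i))
  peel-step i rec {O} {w} valid at≤ with count (at (Merge.w′ i O w valid) (parent i)) ℕₚ.≤? 2 *ℕ s
  ... | yes small = begin
    s *ℕ count (alive (suc j) O) ≤⟨ ℕₚ.*-monoʳ-≤ s (count-mono {f = alive (suc j) O} M.alive-≤) ⟩
    s *ℕ count (alive j M.O′)    ≤⟨ rec M.valid′ at≤′ ⟩
    K *ℕ (weight M.w′ +ℕ s)      ≤⟨ ℕₚ.*-monoʳ-≤ K (ℕₚ.+-monoˡ-≤ s M.weight-≤) ⟩
    K *ℕ (weight w +ℕ s)         ∎
    where
    open ℕₚ.≤-Reasoning
    module M = Merge i O w valid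
    j = toℕ i
    at≤′ : ∀ {r} → toℕ r ≤ℕ j → count (at M.w′ r) ≤ℕ 2 *ℕ s
    at≤′ {r} r≤j with r Fₚ.≟ parent i
    ... | yes refl = small
    ... | no r≢q   = ℕₚ.≤-trans (M.at-≤ r≢q) (at≤ (ℕₚ.m≤n⇒m≤1+n r≤j))
  ... | no large = begin
    s *ℕ count (alive (suc j) O)
      ≤⟨ ℕₚ.*-monoʳ-≤ s (ℕₚ.≤-trans (count-mono {f = alive (suc j) O} M.alive-≤)
                                    (count-∨ {f = alive j M.O′} {hanging M.O′ q} {alive j C.O′} C.alive-≤)) ⟩
    s *ℕ (count (hanging M.O′ q) +ℕ count (alive j C.O′))
      ≡⟨ ℕₚ.*-distribˡ-+ s (count (hanging M.O′ q)) _ ⟩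
    s *ℕ count (hanging M.O′ q) +ℕ s *ℕ count (alive j C.O′)
      ≤⟨ ℕₚ.+-mono-≤ (ℕₚ.*-monoʳ-≤ s (piece-size M.valid′ {q} (parent-< i) at-q≤4))
                     (rec C.valid′ at≤″) ⟩
    s *ℕ K +ℕ K *ℕ (weight C.w′ +ℕ s)
      ≡⟨ rearrange s K (weight C.w′) ⟩
    K *ℕ (weight C.w′ +ℕ s +ℕ s)
      ≤⟨ ℕₚ.*-monoʳ-≤ K (ℕₚ.+-monoˡ-≤ s (ℕₚ.≤-trans drop M.weight-≤)) ⟩
    K *ℕ (weight w +ℕ s) ∎
    where
    open ℕₚ.≤-Reasoning
    j = toℕ i
    q = parent i
    module M = Merge i O w valid
    module C = Cut j q (parent-< i) M.O′ M.w′ M.valid′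
    rearrange : ∀ s K x → s *ℕ K +ℕ K *ℕ (x +ℕ s) ≡ K *ℕ (x +ℕ s +ℕ s)
    rearrange = solve-∀
    double : ∀ s → 2 *ℕ s +ℕ 2 *ℕ s ≡ 4 *ℕ s
    double = solve-∀
    at-q≤4 : count (at M.w′ q) ≤ℕ 4 *ℕ s
    at-q≤4 = ℕₚ.≤-trans M.at-q (ℕₚ.≤-trans (ℕₚ.+-mono-≤ (at≤ (ℕₚ.m≤n⇒m≤1+n (parent-< i))) (at≤ ℕₚ.≤-refl))
                                           (ℕₚ.≤-reflexive (double s)))
    at≤′ : ∀ {r} → r ≢ q → toℕ r ≤ℕ j → count (at M.w′ r) ≤ℕ 2 *ℕ s
    at≤′ r≢q r≤j = ℕₚ.≤-trans (M.at-≤ r≢q) (at≤ (ℕₚ.m≤n⇒m≤1+n r≤j))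
    s≤2s : s ≤ℕ 2 *ℕ s
    s≤2s = ℕₚ.m≤m+n s _
    at≤″ : ∀ {r} → toℕ r ≤ℕ j → count (at C.w′ r) ≤ℕ 2 *ℕ s
    at≤″ {r} r≤j with r Fₚ.≟ q
    ... | yes refl = ℕₚ.≤-trans C.at-q s≤2s
    ... | no r≢q   = ℕₚ.≤-trans (C.at-≤ r≢q) (at≤′ r≢q r≤j)
    -- More than 2s boundary vertices are exchanged for a bag of at most s, which explains the
    -- threshold 2s.
    drop : weight C.w′ +ℕ s ≤ℕ weight M.w′
    drop = ℕₚ.+-cancelʳ-≤ s _ _ (begin
      weight C.w′ +ℕ s +ℕ s                ≡⟨ assoc (weight C.w′) s ⟩
      weight C.w′ +ℕ 2 *ℕ s                ≤⟨ ℕₚ.+-monoʳ-≤ (weight C.w′) (ℕₚ.<⇒≤ (ℕₚ.≰⇒> large)) ⟩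
      weight C.w′ +ℕ count (at M.w′ q)     ≤⟨ C.weight-drops ⟩
      weight M.w′ +ℕ count (β q)           ≤⟨ ℕₚ.+-monoʳ-≤ (weight M.w′) (β-size q) ⟩
      weight M.w′ +ℕ s                     ∎)
      where
      assoc : ∀ x s → x +ℕ s +ℕ s ≡ x +ℕ 2 *ℕ s
      assoc = solve-∀

  -- The node `t` turns a successor index into an element of `Fin m`, which `peel-step` needs. At
  -- index 0 everything left hangs at the root and forms one piece.
  peel : ∀ j (t : Node) → toℕ t ≡ j → Peelable j
  peel zero t _ {O} {w} valid at≤ = begin
    s *ℕ count (alive 0 O)     ≤⟨ ℕₚ.*-monoʳ-≤ s (ℕₚ.≤-trans (count-mono {f = alive 0 O} root) (piece-size valid {zero} z≤n at≤4)) ⟩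
    s *ℕ K                     ≡⟨ ℕₚ.*-comm s K ⟩
    K *ℕ s                     ≤⟨ ℕₚ.*-monoʳ-≤ K (ℕₚ.m≤n+m s (weight w)) ⟩
    K *ℕ (weight w +ℕ s)       ∎
    where
    open ℕₚ.≤-Reasoning
    at≤4 : count (at w zero) ≤ℕ 4 *ℕ s
    at≤4 = ℕₚ.≤-trans (at≤ z≤n) (ℕₚ.*-monoˡ-≤ s {2} {4} (s≤s (s≤s z≤n)))
    root : ∀ v → T (alive 0 O v) → T (hanging O zero v)
    root v v∈ with alive⁻ {0} {O} {v} v∈
    ... | zero , _ , v∈t = T-∨⁺ v∈t
  peel (suc .(toℕ i)) (suc i) refl = peel-step i (peel (toℕ i) (inject₁ i) (Fₚ.toℕ-inject₁ i))

  private
    terminal? : ∀ v → Dec (∃ λ i → R i ≡ v)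
    terminal? v = Fₚ.any? λ i → R i Fₚ.≟ v

    -- The initial boundary: the terminals, each held at one bag containing it.
    home : V → Maybe Node
    home v with terminal? v
    ... | yes _ = just (proj₁ (vertex-cov v))
    ... | no  _ = nothing

    home-just : ∀ {v t} → home v ≡ just t → T (β t v)
    home-just {v} eq with terminal? v
    home-just {v} refl | yes _ = β⁺ (proj₂ (vertex-cov v))

    home-terminal : ∀ i → home (R i) ≢ nothing
    home-terminal i eq with terminal? (R i)
    ... | no ∉R = ∉R (i , refl)

    home-source : ∀ v → T (assigned home v) → ∃ λ i → R i ≡ v
    home-source v v∈ with terminal? v
    ... | yes v∈R = v∈R

    initial : Valid m (λ _ _ → false) home
    initial = record
      { low       = λ {v} {t} _ → ℕₚ.≤-pred (Fₚ.toℕ<n t)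
      ; closed    = λ _ ()
      ; covered   = λ {t} {v} _ _ _ {x} e → let r , v∈r , x∈r = edge-cov v x e in
                      r , ℕₚ.≤-pred (Fₚ.toℕ<n r) , β⁺ v∈r , inj₂ (β⁺ x∈r)
      ; settled   = λ eq _ _ → home-just eq
      ; terminals = λ {i} _ _ → home-terminal i
      }

    weight-home : weight home ≤ℕ k
    weight-home = count-injection (assigned home) (λ v v∈ → proj₁ (home-source v v∈))
      λ v w v∈ w∈ eq → trans (sym (proj₂ (home-source v v∈))) (trans (cong R eq) (proj₂ (home-source w w∈)))

  size-bound : s *ℕ size G ≤ℕ K *ℕ (k +ℕ s)
  size-bound = begin
    s *ℕ size G                           ≡⟨ cong (s *ℕ_) (count-all (size G)) ⟨
    s *ℕ count {size G} (λ _ → true)      ≤⟨ ℕₚ.*-monoʳ-≤ s (count-mono {g = alive m (λ _ _ → false)} everything) ⟩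
    s *ℕ count (alive m (λ _ _ → false))  ≤⟨ peel m (fromℕ m) (Fₚ.toℕ-fromℕ m) initial at≤ ⟩
    K *ℕ (weight home +ℕ s)               ≤⟨ ℕₚ.*-monoʳ-≤ K (ℕₚ.+-monoˡ-≤ s weight-home) ⟩
    K *ℕ (k +ℕ s)                         ∎
    where
    open ℕₚ.≤-Reasoning
    everything : ∀ v → T true → T (alive m (λ _ _ → false) v)
    everything v _ = let t , v∈t = vertex-cov v in
      alive⁺ {O = λ _ _ → false} (ℕₚ.≤-pred (Fₚ.toℕ<n t)) (inj₂ (β⁺ v∈t))
    at≤ : ∀ {t} → toℕ t ≤ℕ m → count (at home t) ≤ℕ 2 *ℕ s
    at≤ {t} _ = ℕₚ.≤-trans (ℕₚ.≤-trans (count-mono {f = at home t} λ v v∈ → home-just (toWitness {a? = at? home t v} v∈)) (β-size t))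
                           (ℕₚ.m≤m+n s _)

-- Natural numbers as rationals

private
  ℕ→ℚᵘ : ℕ → ℚᵘ.ℚᵘ
  ℕ→ℚᵘ n = ℚᵘ.mkℚᵘ (ℤ.+ n) 0

  toℚᵘ-ℕ→ℚ : ∀ n → toℚᵘ (ℕ→ℚ n) ℚᵘ.≃ ℕ→ℚᵘ n
  toℚᵘ-ℕ→ℚ n = ℚₚ.toℚᵘ-fromℚᵘ (ℕ→ℚᵘ n)

ℕ→ℚ-+ : ∀ a b → ℕ→ℚ (a +ℕ b) ≡ ℕ→ℚ a + ℕ→ℚ b
ℕ→ℚ-+ a b = ℚₚ.toℚᵘ-injective (begin
  toℚᵘ (ℕ→ℚ (a +ℕ b))             ≈⟨ toℚᵘ-ℕ→ℚ (a +ℕ b) ⟩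
  ℕ→ℚᵘ (a +ℕ b)                   ≈⟨ ℚᵘ.*≡* (cong (ℤ._* ℤ.+ 1)
                                        (sym (cong₂ ℤ._+_ (ℤₚ.*-identityʳ (ℤ.+ a)) (ℤₚ.*-identityʳ (ℤ.+ b))))) ⟩
  ℕ→ℚᵘ a ℚᵘ.+ ℕ→ℚᵘ b              ≈⟨ ℚᵘₚ.+-cong (toℚᵘ-ℕ→ℚ a) (toℚᵘ-ℕ→ℚ b) ⟨
  toℚᵘ (ℕ→ℚ a) ℚᵘ.+ toℚᵘ (ℕ→ℚ b)  ≈⟨ ℚₚ.toℚᵘ-homo-+ (ℕ→ℚ a) (ℕ→ℚ b) ⟨
  toℚᵘ (ℕ→ℚ a + ℕ→ℚ b)            ∎)
  where open ℚᵘₚ.≃-Reasoning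

ℕ→ℚ-* : ∀ a b → ℕ→ℚ (a *ℕ b) ≡ ℕ→ℚ a * ℕ→ℚ b
ℕ→ℚ-* a b = ℚₚ.toℚᵘ-injective (begin
  toℚᵘ (ℕ→ℚ (a *ℕ b))             ≈⟨ toℚᵘ-ℕ→ℚ (a *ℕ b) ⟩
  ℕ→ℚᵘ (a *ℕ b)                   ≈⟨ ℚᵘ.*≡* (cong (ℤ._* ℤ.+ 1) (ℤₚ.pos-* a b)) ⟩
  ℕ→ℚᵘ a ℚᵘ.* ℕ→ℚᵘ b              ≈⟨ ℚᵘₚ.*-cong (toℚᵘ-ℕ→ℚ a) (toℚᵘ-ℕ→ℚ b) ⟨
  toℚᵘ (ℕ→ℚ a) ℚᵘ.* toℚᵘ (ℕ→ℚ b)  ≈⟨ ℚₚ.toℚᵘ-homo-* (ℕ→ℚ a) (ℕ→ℚ b) ⟨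
  toℚᵘ (ℕ→ℚ a * ℕ→ℚ b)            ∎)
  where open ℚᵘₚ.≃-Reasoning

ℕ→ℚ-mono : ∀ {a b} → a ≤ℕ b → ℕ→ℚ a ≤ ℕ→ℚ b
ℕ→ℚ-mono {a} {b} a≤b = ℚₚ.toℚᵘ-cancel-≤ (begin
  toℚᵘ (ℕ→ℚ a) ≃⟨ toℚᵘ-ℕ→ℚ a ⟩
  ℕ→ℚᵘ a       ≤⟨ ℚᵘ.*≤* (ℤₚ.*-monoʳ-≤-nonNeg (ℤ.+ 1) (ℤ.+≤+ a≤b)) ⟩
  ℕ→ℚᵘ b       ≃⟨ toℚᵘ-ℕ→ℚ b ⟨
  toℚᵘ (ℕ→ℚ b) ∎)
  where open ℚᵘₚ.≤-Reasoning

ℕ→ℚ-cancel-≤ : ∀ {a b} → ℕ→ℚ a ≤ ℕ→ℚ b → a ≤ℕ b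
ℕ→ℚ-cancel-≤ {a} {b} a≤b = ℤₚ.drop‿+≤+ (subst₂ ℤ._≤_ (ℤₚ.*-identityʳ (ℤ.+ a)) (ℤₚ.*-identityʳ (ℤ.+ b)) (ℚᵘₚ.drop-*≤* lemma))
  where
  open ℚᵘₚ.≤-Reasoning
  lemma : ℕ→ℚᵘ a ℚᵘ.≤ ℕ→ℚᵘ b
  lemma = begin
    ℕ→ℚᵘ a       ≃⟨ toℚᵘ-ℕ→ℚ a ⟨
    toℚᵘ (ℕ→ℚ a) ≤⟨ ℚₚ.toℚᵘ-mono-≤ a≤b ⟩
    toℚᵘ (ℕ→ℚ b) ≃⟨ toℚᵘ-ℕ→ℚ b ⟩
    ℕ→ℚᵘ b       ∎

interchange-ℚ : ∀ a b c d → (a + b) + (c + d) ≡ (a + c) + (b + d)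
interchange-ℚ = solve 4 (λ a b c d → (a ⊕ b) ⊕ (c ⊕ d) ⊜ (a ⊕ c) ⊕ (b ⊕ d)) refl

ℕ→ℚ-add-≤ : ∀ a a′ b b′ B {q r} → ℕ→ℚ a ≤ ℕ→ℚ a′ + q → ℕ→ℚ b ≤ ℕ→ℚ b′ + r → q + r ≤ ℕ→ℚ B →
            a +ℕ b ≤ℕ a′ +ℕ b′ +ℕ B
ℕ→ℚ-add-≤ a a′ b b′ B {q} {r} a≤ b≤ q+r≤B = ℕ→ℚ-cancel-≤ (begin
  ℕ→ℚ (a +ℕ b)                 ≡⟨ ℕ→ℚ-+ a b ⟩
  ℕ→ℚ a + ℕ→ℚ b                ≤⟨ ℚₚ.+-mono-≤ a≤ b≤ ⟩
  (ℕ→ℚ a′ + q) + (ℕ→ℚ b′ + r)  ≡⟨ interchange-ℚ (ℕ→ℚ a′) q (ℕ→ℚ b′) r ⟩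
  (ℕ→ℚ a′ + ℕ→ℚ b′) + (q + r)  ≤⟨ ℚₚ.+-monoʳ-≤ (ℕ→ℚ a′ + ℕ→ℚ b′) q+r≤B ⟩
  (ℕ→ℚ a′ + ℕ→ℚ b′) + ℕ→ℚ B    ≡⟨ cong (_+ ℕ→ℚ B) (ℕ→ℚ-+ a′ b′) ⟨
  ℕ→ℚ (a′ +ℕ b′) + ℕ→ℚ B       ≡⟨ ℕ→ℚ-+ (a′ +ℕ b′) B ⟨
  ℕ→ℚ (a′ +ℕ b′ +ℕ B)          ∎)
  where open ℚₚ.≤-Reasoning

ℕ→ℚ-cross-≤ : ∀ B B′ q r q′ r′ {x y} → x ≡ q + r′ → y ≡ q′ + r → q + r ≤ ℕ→ℚ B → q′ + r′ ≤ ℕ→ℚ B′ →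
              x + y ≤ ℕ→ℚ (B +ℕ B′)
ℕ→ℚ-cross-≤ B B′ q r q′ r′ {x} {y} x≡ y≡ q+r≤ q′+r′≤ = begin
  x + y                  ≡⟨ cong₂ _+_ x≡ y≡ ⟩
  (q + r′) + (q′ + r)    ≡⟨ rearrange q r′ q′ r ⟩
  (q + r) + (q′ + r′)    ≤⟨ ℚₚ.+-mono-≤ q+r≤ q′+r′≤ ⟩
  ℕ→ℚ B + ℕ→ℚ B′         ≡⟨ ℕ→ℚ-+ B B′ ⟨
  ℕ→ℚ (B +ℕ B′)          ∎
  where
  open ℚₚ.≤-Reasoning
  rearrange : ∀ a b c d → (a + b) + (c + d) ≡ (a + d) + (c + b)
  rearrange = solve 4 (λ a b c d → (a ⊕ b) ⊕ (c ⊕ d) ⊜ (a ⊕ d) ⊕ (c ⊕ b)) refl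

-- Rows with tops

↑ˡ≢↑ʳ : ∀ {a b} (i : Fin a) (j : Fin b) → i ↑ˡ b ≢ a ↑ʳ j
↑ˡ≢↑ʳ zero    j ()
↑ˡ≢↑ʳ (suc i) j eq = ↑ˡ≢↑ʳ i j (Fₚ.suc-injective eq)

-- n disjoint rows of m + 2 cells; top c is joined to all cells of column c + 1.
module GridGraph (n m : ℕ) where

  data Vertex : Set where
    cell : Fin n → Fin (suc (suc m)) → Vertex
    top  : Fin m → Vertex

  AdjV : Vertex → Vertex → Set
  AdjV (cell i b) (cell j c) = i ≡ j × (toℕ c ≡ suc (toℕ b) ⊎ toℕ b ≡ suc (toℕ c))
  AdjV (cell i b) (top t)    = toℕ b ≡ suc (toℕ t)
  AdjV (top t)    (cell i b) = toℕ b ≡ suc (toℕ t)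
  AdjV (top _)    (top _)    = ⊥

  adjV? : ∀ v w → Dec (AdjV v w)
  adjV? (cell i b) (cell j c) =
    (i Fₚ.≟ j) ×-dec ((toℕ c ℕₚ.≟ suc (toℕ b)) ⊎-dec (toℕ b ℕₚ.≟ suc (toℕ c)))
  adjV? (cell i b) (top t)    = toℕ b ℕₚ.≟ suc (toℕ t)
  adjV? (top t)    (cell i b) = toℕ b ℕₚ.≟ suc (toℕ t)
  adjV? (top _)    (top _)    = no id

  AdjV-sym : ∀ v w → AdjV v w → AdjV w v
  AdjV-sym (cell _ _) (cell _ _) (i≡j , next) = sym i≡j , Sum.swap next
  AdjV-sym (cell _ _) (top _)    e = e
  AdjV-sym (top _)    (cell _ _) e = e

  AdjV-irrefl : ∀ v → ¬ AdjV v v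
  AdjV-irrefl (cell i b) (_ , next) = [ b≢1+b , b≢1+b ]′ next
    where
    b≢1+b : toℕ b ≢ suc (toℕ b)
    b≢1+b = ℕₚ.1+n≢n ∘ sym

  N : ℕ
  N = n *ℕ suc (suc m) +ℕ m

  decode-sum : Fin (n *ℕ suc (suc m)) ⊎ Fin m → Vertex
  decode-sum (inj₁ x) = uncurry cell (remQuot (suc (suc m)) x)
  decode-sum (inj₂ t) = top t

  decode : Fin N → Vertex
  decode x = decode-sum (splitAt (n *ℕ suc (suc m)) x)

  encode : Vertex → Fin N
  encode (cell i b) = combine i b ↑ˡ m
  encode (top t)    = (n *ℕ suc (suc m)) ↑ʳ t

  decode-encode : ∀ v → decode (encode v) ≡ v
  decode-encode (cell i b)
    rewrite Fₚ.splitAt-↑ˡ (n *ℕ suc (suc m)) (combine i b) m =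
    cong (uncurry cell) (Fₚ.remQuot-combine {n} i b)
  decode-encode (top t) rewrite Fₚ.splitAt-↑ʳ (n *ℕ suc (suc m)) m t = refl

  encode-decode : ∀ x → encode (decode x) ≡ x
  encode-decode x = trans (lemma (splitAt (n *ℕ suc (suc m)) x)) (Fₚ.join-splitAt (n *ℕ suc (suc m)) m x)
    where
    lemma : ∀ s → encode (decode-sum s) ≡ join (n *ℕ suc (suc m)) m s
    lemma (inj₁ y) = cong (_↑ˡ m) (Fₚ.combine-remQuot {n} (suc (suc m)) y)
    lemma (inj₂ t) = refl

  decode-injective : ∀ {x y} → decode x ≡ decode y → x ≡ y
  decode-injective {x} {y} eq = trans (sym (encode-decode x)) (trans (cong encode eq) (encode-decode y))

  encode-injective : ∀ {v w} → encode v ≡ encode w → v ≡ w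
  encode-injective {v} {w} eq = trans (sym (decode-encode v)) (trans (cong decode eq) (decode-encode w))

  grid : Graph
  grid = record
    { size = N
    ; adj = λ x y → ⌊ adjV? (decode x) (decode y) ⌋
    ; adj-sym = λ x y → ⌊⌋-cong (adjV? (decode x) (decode y)) (adjV? (decode y) (decode x))
                          (AdjV-sym (decode x) (decode y)) (AdjV-sym (decode y) (decode x))
    ; adj-irrefl = λ x → ⌊⌋-cong (adjV? (decode x) (decode x)) (no id) (AdjV-irrefl (decode x)) λ ()
    }

  unit : Lengths grid
  unit = record { len = λ _ _ → 1ℚ ; len-sym = λ _ _ → refl ; len-nonneg = λ _ _ → *≤* (ℤ.+≤+ z≤n) }

  Adj⇒AdjV : ∀ {x y} → Adj grid x y → AdjV (decode x) (decode y)
  Adj⇒AdjV {x} {y} = toWitness {a? = adjV? (decode x) (decode y)}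

  AdjV⇒Adj : ∀ {v w} → AdjV v w → Adj grid (encode v) (encode w)
  AdjV⇒Adj {v} {w} e = fromWitness {a? = adjV? (decode (encode v)) (decode (encode w))}
    (subst₂ AdjV (sym (decode-encode v)) (sym (decode-encode w)) e)

  -- A path decomposition: bag `t` holds the columns t and t + 1 together with the top over column
  -- t, at most 2n + 1 vertices.
  InBag : Fin (suc m) → Vertex → Set
  InBag t (cell i b) = toℕ b ≡ toℕ t ⊎ toℕ b ≡ suc (toℕ t)
  InBag t (top c)    = toℕ t ≡ suc (toℕ c)

  inBag? : ∀ t v → Dec (InBag t v)
  inBag? t (cell i b) = (toℕ b ℕₚ.≟ toℕ t) ⊎-dec (toℕ b ℕₚ.≟ suc (toℕ t))
  inBag? t (top c)    = toℕ t ℕₚ.≟ suc (toℕ c)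

  slot : ∀ t v → InBag t v → Fin (suc (n +ℕ n))
  slot t (cell i b) (inj₁ _) = suc (i ↑ˡ n)
  slot t (cell i b) (inj₂ _) = suc (n ↑ʳ i)
  slot t (top c)    _        = zero

  slot-injective : ∀ t v w v∈ w∈ → slot t v v∈ ≡ slot t w w∈ → v ≡ w
  slot-injective t (cell i b) (cell j c) (inj₁ p) (inj₁ q) eq =
    cong₂ cell (Fₚ.↑ˡ-injective n i j (Fₚ.suc-injective eq)) (Fₚ.toℕ-injective (trans p (sym q)))
  slot-injective t (cell i b) (cell j c) (inj₂ p) (inj₂ q) eq =
    cong₂ cell (Fₚ.↑ʳ-injective n i j (Fₚ.suc-injective eq)) (Fₚ.toℕ-injective (trans p (sym q)))
  slot-injective t (cell i b) (cell j c) (inj₁ _) (inj₂ _) eq =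
    contradiction (Fₚ.suc-injective eq) (↑ˡ≢↑ʳ i j)
  slot-injective t (cell i b) (cell j c) (inj₂ _) (inj₁ _) eq =
    contradiction (sym (Fₚ.suc-injective eq)) (↑ˡ≢↑ʳ j i)
  slot-injective t (top c) (top d) p q eq =
    cong top (Fₚ.toℕ-injective (ℕₚ.suc-injective (trans (sym p) q)))
  slot-injective t (cell i b) (top d) (inj₁ _) _ ()
  slot-injective t (cell i b) (top d) (inj₂ _) _ ()
  slot-injective t (top c) (cell j d) _ (inj₁ _) ()
  slot-injective t (top c) (cell j d) _ (inj₂ _) ()

  inBagᵇ : Fin (suc m) → Fin N → Bool
  inBagᵇ t x = ⌊ inBag? t (decode x) ⌋

  bag : Fin (suc m) → Subset N
  bag t = tabulate (inBagᵇ t)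

  ∈bag⁺ : ∀ {t x} → InBag t (decode x) → x ∈ bag t
  ∈bag⁺ {t} {x} = ∈-tabulate⁺ (inBagᵇ t) ∘ fromWitness {a? = inBag? t (decode x)}

  ∈bag⁻ : ∀ {t x} → x ∈ bag t → InBag t (decode x)
  ∈bag⁻ {t} {x} = toWitness {a? = inBag? t (decode x)} ∘ ∈-tabulate⁻ (inBagᵇ t)

  vertex-covV : ∀ v → ∃ λ t → InBag t v
  vertex-covV (cell i zero)    = zero , inj₁ refl
  vertex-covV (cell i (suc b)) = b , inj₂ refl
  vertex-covV (top c)          = suc c , refl

  edge-covV : ∀ v w → AdjV v w → ∃ λ t → InBag t v × InBag t w
  edge-covV (cell i b) (cell j (suc c)) (_ , inj₁ eq) = c , inj₁ (sym (ℕₚ.suc-injective eq)) , inj₂ refl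
  edge-covV (cell i (suc b)) (cell j c) (_ , inj₂ eq) = b , inj₂ refl , inj₁ (sym (ℕₚ.suc-injective eq))
  edge-covV (cell i b) (top c) eq = suc c , inj₁ eq , refl
  edge-covV (top c) (cell i b) eq = suc c , refl , inj₁ eq

  consecutive : ∀ {s t} v → InBag s v → InBag t v →
                toℕ s ≡ toℕ t ⊎ toℕ s ≡ suc (toℕ t) ⊎ toℕ t ≡ suc (toℕ s)
  consecutive (cell i b) (inj₁ p) (inj₁ q) = inj₁ (trans (sym p) q)
  consecutive (cell i b) (inj₁ p) (inj₂ q) = inj₂ (inj₁ (trans (sym p) q))
  consecutive (cell i b) (inj₂ p) (inj₁ q) = inj₂ (inj₂ (trans (sym q) p))
  consecutive (cell i b) (inj₂ p) (inj₂ q) = inj₁ (ℕₚ.suc-injective (trans (sym p) q))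
  consecutive (top c) p q = inj₁ (trans p (sym q))

  next-node : ∀ {s t : Fin (suc m)} → toℕ s ≡ suc (toℕ t) → ∃ λ i → s ≡ suc i × t ≡ inject₁ i
  next-node {suc i} eq = i , refl , Fₚ.toℕ-injective (trans (sym (ℕₚ.suc-injective eq)) (sym (Fₚ.toℕ-inject₁ i)))

  grid-TW : ∀ {p} → n +ℕ n ≤ℕ p → TW p grid
  grid-TW {p} 2n≤p = record
    { m = m
    ; parent = inject₁
    ; parent-< = λ i → ℕₚ.≤-reflexive (Fₚ.toℕ-inject₁ i)
    ; bag = bag
    ; bag-size = λ t → subst (_≤ℕ suc p) (sym (∣tabulate∣≡count (inBagᵇ t))) (ℕₚ.≤-trans
        (count-injection (inBagᵇ t)
          (λ x x∈ → slot t (decode x) (toWitness x∈))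
          (λ x y x∈ y∈ eq → decode-injective (slot-injective t _ _ _ _ eq)))
        (s≤s 2n≤p))
    ; vertex-cov = λ x → let t , x∈ = vertex-covV (decode x) in t , ∈bag⁺ x∈
    ; edge-cov = λ x y e → let t , x∈ , y∈ = edge-covV _ _ (Adj⇒AdjV e) in t , ∈bag⁺ x∈ , ∈bag⁺ y∈
    ; coherent = λ x s t x∈s x∈t → coherent x s t x∈s x∈t (consecutive (decode x) (∈bag⁻ x∈s) (∈bag⁻ x∈t))
    }
    where
    coherent : ∀ x s t → x ∈ bag s → x ∈ bag t →
               toℕ s ≡ toℕ t ⊎ toℕ s ≡ suc (toℕ t) ⊎ toℕ t ≡ suc (toℕ s) →
               WalkIn (TreeAdj inject₁) (λ r → x ∈ bag r) s t
    coherent x s t x∈s x∈t (inj₁ eq) rewrite Fₚ.toℕ-injective eq = stop x∈t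
    coherent x s t x∈s x∈t (inj₂ (inj₁ eq)) = step x∈s (inj₁ (next-node eq)) (stop x∈t)
    coherent x s t x∈s x∈t (inj₂ (inj₂ eq)) = step x∈s (inj₂ (next-node eq)) (stop x∈t)

-- Distance-preserving minors of the grid

suc-+-suc : ∀ a b → suc (b +ℕ 0 +ℕ suc a) ≡ suc a +ℕ suc b
suc-+-suc = solve-∀

module GridBound (n m : ℕ) where
  open GridGraph n m

  -- A potential whose differences bound distances from below; adjacency is symmetric, so one
  -- inequality covers both directions.
  Lipschitz : (Vertex → ℕ) → Set
  Lipschitz φ = ∀ v w → AdjV v w → φ v ≤ℕ suc (φ w)

  descend : ∀ {φ} → Lipschitz φ → ∀ {u v} (p : Walk grid u v) →
            ℕ→ℚ (φ (decode u)) ≤ ℕ→ℚ (φ (decode v)) + walkLength (len unit) p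
  descend {φ} lip {u} (stop _) = ℚₚ.≤-reflexive (sym (ℚₚ.+-identityʳ (ℕ→ℚ (φ (decode u)))))
  descend {φ} lip {u} {v} (step {w = w} _ e p) = begin
    ℕ→ℚ (φ (decode u))             ≤⟨ ℕ→ℚ-mono (lip (decode u) (decode w) (Adj⇒AdjV e)) ⟩
    ℕ→ℚ (1 +ℕ φ (decode w))        ≡⟨ ℕ→ℚ-+ 1 (φ (decode w)) ⟩
    1ℚ + ℕ→ℚ (φ (decode w))        ≤⟨ ℚₚ.+-monoʳ-≤ 1ℚ (descend lip p) ⟩
    1ℚ + (ℕ→ℚ (φ (decode v)) + L)  ≡⟨ swap 1ℚ (ℕ→ℚ (φ (decode v))) L ⟩
    ℕ→ℚ (φ (decode v)) + (1ℚ + L)  ∎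
    where
    open ℚₚ.≤-Reasoning
    L = walkLength (len unit) p
    swap : ∀ a b c → a + (b + c) ≡ b + (a + c)
    swap = solve 3 (λ a b c → a ⊕ (b ⊕ c) ⊜ b ⊕ (a ⊕ c)) refl

  ascend : ∀ {φ} → Lipschitz φ → ∀ {u v} (p : Walk grid u v) →
           ℕ→ℚ (φ (decode v)) ≤ ℕ→ℚ (φ (decode u)) + walkLength (len unit) p
  ascend {φ} lip {u} {v} p =
    subst (λ L → ℕ→ℚ (φ (decode v)) ≤ ℕ→ℚ (φ (decode u)) + L)
          (length-rev (len unit) (len-sym unit) (Adj-sym grid) p) (descend lip (revʷ (Adj-sym grid) p))

  last : Fin (suc (suc m))
  last = fromℕ (suc m)

  col : Fin m → Fin (suc (suc m))
  col c = suc (inject₁ c)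

  toℕ-col : ∀ c → toℕ (col c) ≡ suc (toℕ c)
  toℕ-col c = cong suc (Fₚ.toℕ-inject₁ c)

  col-unique : ∀ {b c} → toℕ b ≡ suc (toℕ c) → b ≡ col c
  col-unique {c = c} eq = Fₚ.toℕ-injective (trans eq (sym (toℕ-col c)))

  rowWalk : ∀ i d b e → toℕ b +ℕ d ≡ toℕ e →
            Σ (Walk grid (encode (cell i b)) (encode (cell i e))) λ p → walkLength (len unit) p ≡ ℕ→ℚ d
  rowWalk i zero b e eq
    rewrite Fₚ.toℕ-injective (trans (sym (ℕₚ.+-identityʳ (toℕ b))) eq) = stop tt , refl
  rowWalk i (suc d) b e eq =
    let p , len≡ = rowWalk i d b⁺ e (trans (cong (_+ℕ d) toℕ-b⁺) 1+b+d≡e) in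
    step tt (AdjV⇒Adj {cell i b} {cell i b⁺} (refl , inj₁ toℕ-b⁺)) p ,
    trans (cong (1ℚ +_) len≡) (sym (ℕ→ℚ-+ 1 d))
    where
    1+b+d≡e : suc (toℕ b) +ℕ d ≡ toℕ e
    1+b+d≡e = trans (sym (ℕₚ.+-suc (toℕ b) d)) eq
    b⁺< : suc (toℕ b) <ℕ suc (suc m)
    b⁺< = ℕₚ.≤-<-trans (ℕₚ.≤-trans (ℕₚ.m≤m+n (suc (toℕ b)) d) (ℕₚ.≤-reflexive 1+b+d≡e)) (Fₚ.toℕ<n e)
    b⁺ : Fin (suc (suc m))
    b⁺ = fromℕ< b⁺<
    toℕ-b⁺ : toℕ b⁺ ≡ suc (toℕ b)
    toℕ-b⁺ = Fₚ.toℕ-fromℕ< b⁺<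

  k : ℕ
  k = n +ℕ (n +ℕ m)

  label : Fin k → Vertex
  label x = [ (λ i → cell i zero) , (λ y → [ (λ i → cell i last) , top ]′ (splitAt n y)) ]′ (splitAt n x)

  topT : Fin m → Fin k
  topT c = n ↑ʳ (n ↑ʳ c)

  label-topT : ∀ c → label (topT c) ≡ top c
  label-topT c rewrite Fₚ.splitAt-↑ʳ n (n +ℕ m) (n ↑ʳ c) | Fₚ.splitAt-↑ʳ n m c = refl

  R : Fin k → Fin N
  R = encode ∘ label

  label-injective : ∀ {x y} → label x ≡ label y → x ≡ y
  label-injective {x} {y} eq
    with splitAt n x in ex | splitAt n y in ey
  label-injective refl | inj₁ i | inj₁ j = trans (sym (Fₚ.splitAt⁻¹-↑ˡ ex)) (Fₚ.splitAt⁻¹-↑ˡ ey)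
  ... | inj₁ i | inj₂ y′ with splitAt n y′
  label-injective () | inj₁ i | inj₂ y′ | inj₁ _
  label-injective () | inj₁ i | inj₂ y′ | inj₂ _
  label-injective eq | inj₂ x′ | inj₁ j with splitAt n x′
  label-injective () | inj₂ x′ | inj₁ j | inj₁ _
  label-injective () | inj₂ x′ | inj₁ j | inj₂ _
  label-injective eq | inj₂ x′ | inj₂ y′ =
    trans (sym (Fₚ.splitAt⁻¹-↑ʳ ex)) (trans (cong (n ↑ʳ_) (inner eq)) (Fₚ.splitAt⁻¹-↑ʳ ey))
    where
    inner : ∀ {x y} → [ (λ i → cell i last) , top ]′ (splitAt n x) ≡ [ (λ i → cell i last) , top ]′ (splitAt n y) → x ≡ y
    inner {x} {y} eq with splitAt n x in ex | splitAt n y in ey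
    inner refl | inj₁ _ | inj₁ _ = trans (sym (Fₚ.splitAt⁻¹-↑ˡ ex)) (Fₚ.splitAt⁻¹-↑ˡ ey)
    inner refl | inj₂ _ | inj₂ _ = trans (sym (Fₚ.splitAt⁻¹-↑ʳ ex)) (Fₚ.splitAt⁻¹-↑ʳ ey)

  R-injective : Injective _≡_ _≡_ R
  R-injective eq = label-injective (encode-injective eq)

  -- One of the two ends of the rows, with the distance κ to it measured along a row.
  record Side : Set where
    field
      κ         : Fin (suc (suc m)) → ℕ
      κ-lip     : ∀ b c → toℕ c ≡ suc (toℕ b) ⊎ toℕ b ≡ suc (toℕ c) → κ b ≤ℕ suc (κ c)
      e         : Fin (suc (suc m))
      κ-e       : κ e ≡ 0
      end       : Fin n → Fin k
      label-end : ∀ i → label (end i) ≡ cell i e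
      topWalk   : ∀ i c → Σ (Walk grid (encode (top c)) (encode (cell i e))) λ p →
                    walkLength (len unit) p ≡ ℕ→ℚ (suc (κ (col c)))

  extend-top : ∀ i c d {e} (p : Walk grid (encode (cell i (col c))) e) → walkLength (len unit) p ≡ ℕ→ℚ d →
               Σ (Walk grid (encode (top c)) e) λ q → walkLength (len unit) q ≡ ℕ→ℚ (suc d)
  extend-top i c d p len≡ =
    step tt (AdjV⇒Adj {top c} {cell i (col c)} (toℕ-col c)) p , trans (cong (1ℚ +_) len≡) (sym (ℕ→ℚ-+ 1 d))

  left : Side
  left = record
    { κ = toℕ
    ; κ-lip = λ { b c (inj₁ eq) → ℕₚ.≤-trans (ℕₚ.n≤1+n _) (ℕₚ.≤-trans (ℕₚ.≤-reflexive (sym eq)) (ℕₚ.n≤1+n _))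
                ; b c (inj₂ eq) → ℕₚ.≤-reflexive eq }
    ; e = zero
    ; κ-e = refl
    ; end = λ i → i ↑ˡ (n +ℕ m)
    ; label-end = label-end
    ; topWalk = λ i c → let p , len≡ = rowWalk i (toℕ (col c)) zero (col c) refl in
        extend-top i c (toℕ (col c)) (revʷ (Adj-sym grid) p)
          (trans (length-rev (len unit) (len-sym unit) (Adj-sym grid) p) len≡)
    }
    where
    label-end : ∀ i → label (i ↑ˡ (n +ℕ m)) ≡ cell i zero
    label-end i rewrite Fₚ.splitAt-↑ˡ n i (n +ℕ m) = refl

  right : Side
  right = record
    { κ = κ
    ; κ-lip = λ { b c (inj₁ eq) → subst (λ x → κ b ≤ℕ suc (suc m ℕ.∸ x)) (sym eq) (suc-∸ m (toℕ b))
                ; b c (inj₂ eq) → ℕₚ.≤-trans (ℕₚ.∸-monoʳ-≤ (suc m) (ℕₚ.≤-trans (ℕₚ.n≤1+n _) (ℕₚ.≤-reflexive (sym eq))))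
                                             (ℕₚ.n≤1+n _) }
    ; e = last
    ; κ-e = trans (cong (suc m ℕ.∸_) (Fₚ.toℕ-fromℕ (suc m))) (ℕₚ.n∸n≡0 (suc m))
    ; end = λ i → n ↑ʳ (i ↑ˡ m)
    ; label-end = label-end
    ; topWalk = λ i c → let p , len≡ = rowWalk i (κ (col c)) (col c) last
                                         (trans (ℕₚ.m+[n∸m]≡n (ℕₚ.≤-pred (Fₚ.toℕ<n (col c)))) (sym (Fₚ.toℕ-fromℕ (suc m)))) in
        extend-top i c (κ (col c)) p len≡
    }
    where
    κ : Fin (suc (suc m)) → ℕ
    κ b = suc m ℕ.∸ toℕ b
    suc-∸ : ∀ m b → suc m ℕ.∸ b ≤ℕ suc (m ℕ.∸ b)
    suc-∸ m       zero    = ℕₚ.≤-refl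
    suc-∸ zero    (suc b) = ℕₚ.≤-trans (ℕₚ.≤-reflexive (ℕₚ.0∸n≡0 b)) z≤n
    suc-∸ (suc m) (suc b) = suc-∸ m b
    label-end : ∀ i → label (n ↑ʳ (i ↑ˡ m)) ≡ cell i last
    label-end i rewrite Fₚ.splitAt-↑ʳ n (n +ℕ m) (i ↑ˡ m) | Fₚ.splitAt-↑ˡ n i m = refl

  module _ (s : Side) where
    open Side s

    -- A lower bound for the distance to the end of row `i`: a change of row passes through a top,
    -- which costs two further steps.
    fromEnd : Fin n → Vertex → ℕ
    fromEnd i (cell j b) with j Fₚ.≟ i
    ... | yes _ = κ b
    ... | no  _ = suc (suc (κ b))
    fromEnd i (top c) = suc (κ (col c))

    fromEnd-lip : ∀ i → Lipschitz (fromEnd i)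
    fromEnd-lip i (cell j b) (cell .j c) (refl , next) with j Fₚ.≟ i
    ... | yes _ = κ-lip b c next
    ... | no  _ = s≤s (s≤s (κ-lip b c next))
    fromEnd-lip i (cell j b) (top c) eq with j Fₚ.≟ i | col-unique {b} {c} eq
    ... | yes _ | refl = ℕₚ.≤-trans (ℕₚ.n≤1+n _) (ℕₚ.n≤1+n _)
    ... | no  _ | refl = ℕₚ.≤-refl
    fromEnd-lip i (top c) (cell j b) eq with j Fₚ.≟ i | col-unique {b} {c} eq
    ... | yes _ | refl = ℕₚ.≤-refl
    ... | no  _ | refl = s≤s (ℕₚ.≤-trans (ℕₚ.n≤1+n _) (ℕₚ.n≤1+n _))

    -- Separates top c from the other tops.
    lifted : Fin m → Vertex → ℕ
    lifted c (cell j b) = κ b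
    lifted c (top t) with t Fₚ.≟ c
    ... | yes _ = suc (κ (col t))
    ... | no  _ = κ (col t)

    lifted-lip : ∀ c → Lipschitz (lifted c)
    lifted-lip c (cell j b) (cell .j b′) (refl , next) = κ-lip b b′ next
    lifted-lip c (cell j b) (top t) eq with t Fₚ.≟ c | col-unique {b} {t} eq
    ... | yes _ | refl = ℕₚ.≤-trans (ℕₚ.n≤1+n _) (ℕₚ.n≤1+n _)
    ... | no  _ | refl = ℕₚ.n≤1+n _
    lifted-lip c (top t) (cell j b) eq with t Fₚ.≟ c | col-unique {b} {t} eq
    ... | yes _ | refl = ℕₚ.≤-refl
    ... | no  _ | refl = ℕₚ.n≤1+n _

    fromEnd-end : ∀ i → fromEnd i (label (end i)) ≡ 0
    fromEnd-end i rewrite label-end i with i Fₚ.≟ i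
    ... | yes _  = κ-e
    ... | no i≢i = contradiction refl i≢i

    fromEnd-topT : ∀ i c → fromEnd i (label (topT c)) ≡ suc (κ (col c))
    fromEnd-topT i c rewrite label-topT c = refl

    lifted-self : ∀ c → lifted c (label (topT c)) ≡ suc (κ (col c))
    lifted-self c rewrite label-topT c with c Fₚ.≟ c
    ... | yes _  = refl
    ... | no c≢c = contradiction refl c≢c

    lifted-other : ∀ {c t} → t ≢ c → lifted c (label (topT t)) ≡ κ (col t)
    lifted-other {c} {t} t≢c rewrite label-topT t with t Fₚ.≟ c
    ... | yes t≡c = contradiction t≡c t≢c
    ... | no _    = refl

  module _ (D : DPM grid unit R) where
    open DPM D renaming (G' to H; ℓ' to ℓ)

    push : ∀ x y → Dominates grid unit (R x) (R y) H ℓ (τ x) (τ y)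
    push x y = SameDist⇒Dominates grid unit (R x) (R y) H ℓ (τ x) (τ y) (preserve x y)

    pull : ∀ x y → Dominates H ℓ (τ x) (τ y) grid unit (R x) (R y)
    pull x y = SameDist⇒Dominates H ℓ (τ x) (τ y) grid unit (R x) (R y)
                 (SameDist-sym grid unit (R x) (R y) H ℓ (τ x) (τ y) (preserve x y))

    -- Potentials live on the grid and lengths inside the minor are arbitrary. Between terminals,
    -- however, a walk of the minor is matched by one of the grid that is no longer.
    descendᴴ : ∀ {φ} → Lipschitz φ → ∀ x y (p : Walk H (τ x) (τ y)) →
               ℕ→ℚ (φ (label x)) ≤ ℕ→ℚ (φ (label y)) + walkLength (len ℓ) p
    descendᴴ {φ} lip x y p = let q , q≤p = pull x y p in ℚₚ.≤-trans
      (subst₂ (λ v w → ℕ→ℚ (φ v) ≤ ℕ→ℚ (φ w) + walkLength (len unit) q)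
              (decode-encode (label x)) (decode-encode (label y)) (descend lip q))
      (ℚₚ.+-monoʳ-≤ (ℕ→ℚ (φ (label y))) q≤p)

    ascendᴴ : ∀ {φ} → Lipschitz φ → ∀ x y (p : Walk H (τ x) (τ y)) →
              ℕ→ℚ (φ (label y)) ≤ ℕ→ℚ (φ (label x)) + walkLength (len ℓ) p
    ascendᴴ {φ} lip x y p = let q , q≤p = pull x y p in ℚₚ.≤-trans
      (subst₂ (λ v w → ℕ→ℚ (φ w) ≤ ℕ→ℚ (φ v) + walkLength (len unit) q)
              (decode-encode (label x)) (decode-encode (label y)) (ascend lip q))
      (ℚₚ.+-monoʳ-≤ (ℕ→ℚ (φ (label x))) q≤p)

    combine-bounds : ∀ a a′ b b′ B {u v x y} (q : Walk H u v) (r : Walk H x y) →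
                     ℕ→ℚ a ≤ ℕ→ℚ a′ + walkLength (len ℓ) q → ℕ→ℚ b ≤ ℕ→ℚ b′ + walkLength (len ℓ) r →
                     walkLength (len ℓ) q + walkLength (len ℓ) r ≤ ℕ→ℚ B → a +ℕ b ≤ℕ a′ +ℕ b′ +ℕ B
    combine-bounds a a′ b b′ B q r = ℕ→ℚ-add-≤ a a′ b b′ B

    -- Used with `B` the distance between the terminals `x` and `y`, so that `z` lies on a shortest
    -- walk; the halves are kept apart in order to be recombined.
    record Via (x y : Fin k) (B : ℕ) (z : Fin (size H)) : Set where
      constructor via
      field
        into   : Walk H (τ x) z
        out    : Walk H z (τ y)
        length : walkLength (len ℓ) into + walkLength (len ℓ) out ≤ ℕ→ℚ B

    Near : Fin k → Fin k → ℕ → Vertex → Set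
    Near x y B v = ∃ λ z → branch (encode v) ≡ just z × Via x y B z

    via-terminal : ∀ {x y B} t → Near x y B (label t) → Via x y B (τ t)
    via-terminal t (z , z∈ , v) with trans (sym z∈) (terminal t)
    ... | refl = v

    via-top : ∀ {x y B} c → Near x y B (top c) → Via x y B (τ (topT c))
    via-top {x} {y} {B} c near = via-terminal {x} {y} {B} (topT c) (subst (Near x y B) (sym (label-topT c)) near)

    -- A shortest walk of the minor, lifted to the grid and read as an induction principle.
    lift-induction : ∀ x y {v w} B → label x ≡ v → label y ≡ w →
                     (p : Walk grid (encode v) (encode w)) → walkLength (len unit) p ≤ ℕ→ℚ B →
                     (P : Vertex → Set) →
                     (∀ a b → Near x y B a → AdjV a b → Near x y B b → P b → P a) →
                     (Near x y B w → P w) → P v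
    lift-induction x y {v} {w} B refl refl p p≤B P ind base =
      subst P (decode-encode v) (go (liftʷ minor (withinʷ q) (terminal x) (terminal y)))
      where
      q   = proj₁ (push x y p)
      q≤B : walkLength (len ℓ) q ≤ ℕ→ℚ B
      q≤B = ℚₚ.≤-trans (proj₂ (push x y p)) p≤B
      near : ∀ {g} → Over minor (q ∋ʷ_) g → Near x y B (decode g)
      near {g} over with splits-over minor (len ℓ) q over
      ... | z , g∈ , q₁ , q₂ , len≡ =
        z , trans (cong branch (encode-decode g)) g∈ , via q₁ q₂ (subst (_≤ ℕ→ℚ B) len≡ q≤B)
      go : ∀ {u} → WalkIn (Adj grid) (Over minor (q ∋ʷ_)) u (encode w) → P (decode u)
      go (stop s)     = subst P (sym (decode-encode w)) (base (subst (Near x y B) (decode-encode w) (near s)))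
      go (step s e p) = ind _ _ (near s) (Adj⇒AdjV e) (near (start-∈ p)) (go p)

    -- The summand `ℕ→ℚ 0` is the potential at the end of the row, kept in the shape that
    -- `combine-bounds` expects.
    top-to-end : ∀ s i c (p : Walk H (τ (topT c)) (τ (Side.end s i))) →
                 ℕ→ℚ (suc (Side.κ s (col c))) ≤ ℕ→ℚ 0 + walkLength (len ℓ) p
    top-to-end s i c p = subst₂ (λ a b → ℕ→ℚ a ≤ ℕ→ℚ b + walkLength (len ℓ) p)
      (fromEnd-topT s i c) (fromEnd-end s i) (descendᴴ (fromEnd-lip s i) (topT c) (Side.end s i) p)

    end-to-top : ∀ s i c (p : Walk H (τ (Side.end s i)) (τ (topT c))) →
                 ℕ→ℚ (suc (Side.κ s (col c))) ≤ ℕ→ℚ 0 + walkLength (len ℓ) p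
    end-to-top s i c p = subst₂ (λ a b → ℕ→ℚ a ≤ ℕ→ℚ b + walkLength (len ℓ) p)
      (fromEnd-topT s i c) (fromEnd-end s i) (ascendᴴ (fromEnd-lip s i) (Side.end s i) (topT c) p)

    top-to-top : ∀ s {c t} → t ≢ c → (p : Walk H (τ (topT c)) (τ (topT t))) →
                 ℕ→ℚ (suc (Side.κ s (col c))) ≤ ℕ→ℚ (Side.κ s (col t)) + walkLength (len ℓ) p
    top-to-top s {c} {t} t≢c p = subst₂ (λ a b → ℕ→ℚ a ≤ ℕ→ℚ b + walkLength (len ℓ) p)
      (lifted-self s c) (lifted-other s t≢c) (descendᴴ (lifted-lip s c) (topT c) (topT t) p)

    left-to-right : ∀ {i j} → i ≢ j → (p : Walk H (τ (Side.end left i)) (τ (Side.end right j))) →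
                    ℕ→ℚ (suc (suc (suc m))) ≤ ℕ→ℚ 0 + walkLength (len ℓ) p
    left-to-right {i} {j} i≢j p = subst₂ (λ a b → ℕ→ℚ a ≤ ℕ→ℚ b + walkLength (len ℓ) p)
      far (fromEnd-end right j) (descendᴴ (fromEnd-lip right j) (Side.end left i) (Side.end right j) p)
      where
      far : fromEnd right j (label (Side.end left i)) ≡ suc (suc (suc m))
      far rewrite Side.label-end left i with i Fₚ.≟ j
      ... | yes i≡j = contradiction i≡j i≢j
      ... | no _    = refl

    κ-sum : ∀ c → Side.κ left (col c) +ℕ Side.κ right (col c) ≡ suc m
    κ-sum c = ℕₚ.m+[n∸m]≡n (ℕₚ.≤-pred (Fₚ.toℕ<n (col c)))

    -- A route between the ends through a top has length at least m + 3, against m + 1 along the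
    -- row.
    row-avoids-tops : ∀ i c → ¬ Near (Side.end left i) (Side.end right i) (suc m) (top c)
    row-avoids-tops i c near with via-top c near
    ... | via q r q+r≤ = ℕₚ.<⇒≱ excess
      (combine-bounds (suc (Side.κ left (col c))) 0 (suc (Side.κ right (col c))) 0 (suc m) q r
        (end-to-top left i c q) (top-to-end right i c r) q+r≤)
      where
      excess : suc m <ℕ suc (Side.κ left (col c)) +ℕ suc (Side.κ right (col c))
      excess = subst (_<ℕ suc (Side.κ left (col c)) +ℕ suc (Side.κ right (col c))) (κ-sum c)
        (s≤s (ℕₚ.+-monoʳ-≤ (Side.κ left (col c)) (ℕₚ.n≤1+n (Side.κ right (col c)))))

    -- The lifted walk meets no top, so it stays in row `i` and moves by one column per step. From
    -- the first to the last column it cannot skip `c`.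
    near-row : ∀ i c → Near (Side.end left i) (Side.end right i) (suc m) (cell i c)
    near-row i c = lift-induction (Side.end left i) (Side.end right i) {cell i zero} {cell i last} (suc m)
      (Side.label-end left i) (Side.label-end right i)
      (proj₁ row) (ℚₚ.≤-reflexive (proj₂ row)) P ind base refl z≤n
      where
      row = rowWalk i (suc m) zero last (sym (Fₚ.toℕ-fromℕ (suc m)))
      Near′ = Near (Side.end left i) (Side.end right i) (suc m)
      P : Vertex → Set
      P (cell j b) = j ≡ i → toℕ b ≤ℕ toℕ c → Near′ (cell i c)
      P (top _)    = ⊤
      ind : ∀ v w → Near′ v → AdjV v w → Near′ w → P w → P v
      ind (top _)    w          _  _ _  _ = tt
      ind (cell j b) (top t)    _  _ w∈ _ = contradiction w∈ (row-avoids-tops i t)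
      ind (cell j b) (cell .j b′) v∈ (refl , next) _ rest refl b≤c with ℕₚ.m≤n⇒m<n∨m≡n b≤c
      ... | inj₂ b≡c rewrite Fₚ.toℕ-injective b≡c = v∈
      ... | inj₁ b<c = rest refl (ℕₚ.≤-trans b′≤1+b b<c)
        where
        b′≤1+b : toℕ b′ ≤ℕ suc (toℕ b)
        b′≤1+b = [ ℕₚ.≤-reflexive , (λ eq → ℕₚ.≤-trans (ℕₚ.n≤1+n _) (ℕₚ.≤-trans (ℕₚ.≤-reflexive (sym eq)) (ℕₚ.n≤1+n _))) ]′ next
      base : Near′ (cell i last) → P (cell i last)
      base near _ last≤c = subst (Near′ ∘ cell i) (Fₚ.toℕ-injective (ℕₚ.≤-antisym last≤c c≤last)) near
        where
        c≤last : toℕ c ≤ℕ toℕ last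
        c≤last = ℕₚ.≤-trans (ℕₚ.≤-pred (Fₚ.toℕ<n c)) (ℕₚ.≤-reflexive (sym (Fₚ.toℕ-fromℕ (suc m))))

    -- By `lifted`, reaching the other top costs at least κ(c) + 1 - κ(t), and the end is a further
    -- κ(t) + 1 away: one step more than the distance.
    spoke-avoids-tops : ∀ s i {c t} → t ≢ c → ¬ Near (topT c) (Side.end s i) (suc (Side.κ s (col c))) (top t)
    spoke-avoids-tops s i {c} {t} t≢c near with via-top t near
    ... | via q r q+r≤ = ℕₚ.<⇒≱ (ℕₚ.≤-reflexive (suc-+-suc (Side.κ s (col c)) (Side.κ s (col t))))
      (combine-bounds (suc (Side.κ s (col c))) (Side.κ s (col t)) (suc (Side.κ s (col t))) 0 (suc (Side.κ s (col c))) q r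
        (top-to-top s t≢c q) (top-to-end s i t r) q+r≤)

    -- The only top on the lifted walk is `c`. After the last visit there the walk stays in a single
    -- row, which is row `i` because it ends there, so it leaves `c` through the cell in question.
    near-spoke : ∀ s i c → Near (topT c) (Side.end s i) (suc (Side.κ s (col c))) (cell i (col c))
    near-spoke s i c = lift-induction (topT c) (end i) {top c} {cell i e} (suc (κ (col c)))
      (label-topT c) (label-end i) (proj₁ (topWalk i c)) (ℚₚ.≤-reflexive (proj₂ (topWalk i c))) P ind (λ _ → inj₁ refl) refl
      where
      open Side s
      Near′ = Near (topT c) (end i) (suc (κ (col c)))
      P : Vertex → Set
      P (top t)    = t ≡ c → Near′ (cell i (col c))
      P (cell j b) = j ≡ i ⊎ Near′ (cell i (col c))
      ind : ∀ v w → Near′ v → AdjV v w → Near′ w → P w → P v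
      ind (cell j b) (cell .j _) _ (refl , _) _ rest = rest
      ind (cell j b) (top t) _ _ w∈ rest with t Fₚ.≟ c
      ... | yes t≡c = inj₂ (rest t≡c)
      ... | no  t≢c = contradiction w∈ (spoke-avoids-tops s i t≢c)
      ind (top t) (cell j b) _ eq w∈ (inj₁ refl) refl = subst (Near′ ∘ cell i) (col-unique eq) w∈
      ind (top t) (cell j b) _ _  _  (inj₂ near) _    = near

    abstract
      -- The row walks show in particular that no inner cell is deleted, so each has a vertex of the
      -- minor to be counted.
      spot : Fin n → Fin m → Fin (size H)
      spot i c = proj₁ (near-row i (col c))

      spot-branch : ∀ i c → branch (encode (cell i (col c))) ≡ just (spot i c)
      spot-branch i c = proj₁ (proj₂ (near-row i (col c)))

    at-spot : ∀ {x y B} i c → Near x y B (cell i (col c)) → Via x y B (spot i c)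
    at-spot {x} {y} {B} i c (z , z∈ , v) =
      subst (Via x y B) (Maybeₚ.just-injective (trans (sym z∈) (spot-branch i c))) v

    row-at-spot : ∀ i c → Via (Side.end left i) (Side.end right i) (suc m) (spot i c)
    row-at-spot i c = at-spot {Side.end left i} {Side.end right i} {suc m} i c (near-row i (col c))

    spoke-at-spot : ∀ s i c → Via (topT c) (Side.end s i) (suc (Side.κ s (col c))) (spot i c)
    spoke-at-spot s i c = at-spot {topT c} {Side.end s i} {suc (Side.κ s (col c))} i c (near-spoke s i c)

    -- The two walks exchange their second halves at `z`, which leaves the total length unchanged.
    cross : ∀ {x y x′ y′ z B B′} → Via x y B z → Via x′ y′ B′ z →
            Σ (Walk H (τ x) (τ y′)) λ p → Σ (Walk H (τ x′) (τ y)) λ p′ →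
              walkLength (len ℓ) p + walkLength (len ℓ) p′ ≤ ℕ→ℚ (B +ℕ B′)
    cross {B = B} {B′} (via q r q+r≤) (via q′ r′ q′+r′≤) = q ++ʷ r′ , q′ ++ʷ r ,
      ℕ→ℚ-cross-≤ B B′ (walkLength (len ℓ) q) (walkLength (len ℓ) r) (walkLength (len ℓ) q′) (walkLength (len ℓ) r′)
        (length-++ (len ℓ) q r′) (length-++ (len ℓ) q′ r) q+r≤ q′+r′≤

    -- The exchange at a common vertex gives two walks between ends of different rows, of length at
    -- least m + 3 each, while their total is at most 2m + 2.
    rows-disjoint : ∀ {i j z} → i ≢ j → Via (Side.end left i) (Side.end right i) (suc m) z →
                    ¬ Via (Side.end left j) (Side.end right j) (suc m) z
    rows-disjoint i≢j v v′ =
      let p , p′ , p+p′≤ = cross v v′ in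
      ℕₚ.<⇒≱ (ℕₚ.+-mono-< {suc m} {suc (suc (suc m))} {suc m} (ℕₚ.n≤1+n (suc (suc m))) (ℕₚ.n≤1+n (suc (suc m))))
        (combine-bounds (suc (suc (suc m))) 0 (suc (suc (suc m))) 0 (suc m +ℕ suc m) p p′
          (left-to-right i≢j p) (left-to-right (i≢j ∘ sym) p′) p+p′≤)

    same-row : ∀ {i j c d} → spot i c ≡ spot j d → i ≡ j
    same-row {i} {j} {c} {d} eq = decidable-stable (i Fₚ.≟ j) λ i≢j →
      rows-disjoint {i} {j} {spot i c} i≢j (row-at-spot i c)
        (subst (Via (Side.end left j) (Side.end right j) (suc m)) (sym eq) (row-at-spot j d))

    -- The exchange sends `c` to the right end and `d` to the left end. With `d` to the right of
    -- `c`, these two distances add up to more than the total available.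
    spokes-ordered : ∀ {i c d z} → Via (topT c) (Side.end left i) (suc (Side.κ left (col c))) z →
                     Via (topT d) (Side.end right i) (suc (Side.κ right (col d))) z → toℕ (col d) ≤ℕ toℕ (col c)
    spokes-ordered {i} {c} {d} v v′ = ℕₚ.≮⇒≥ λ c<d →
      let p , p′ , p+p′≤ = cross v v′ in
      ℕₚ.<⇒≱ (excess c<d)
        (combine-bounds (suc (Side.κ right (col c))) 0 (suc (Side.κ left (col d))) 0
          (suc (Side.κ left (col c)) +ℕ suc (Side.κ right (col d))) p p′
          (top-to-end right i c p) (top-to-end left i d p′) p+p′≤)
      where
      excess : toℕ (col c) <ℕ toℕ (col d) →
               suc (Side.κ left (col c)) +ℕ suc (Side.κ right (col d)) <ℕ suc (Side.κ right (col c)) +ℕ suc (Side.κ left (col d))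
      excess c<d = subst (suc (Side.κ left (col c)) +ℕ suc (Side.κ right (col d)) <ℕ_)
        (ℕₚ.+-comm (suc (Side.κ left (col d))) (suc (Side.κ right (col c))))
        (ℕₚ.+-mono-<-≤ (s≤s c<d) (s≤s (ℕₚ.∸-monoʳ-≤ (suc m) (ℕₚ.<⇒≤ c<d))))

    spoke-order : ∀ {i c d} → spot i c ≡ spot i d → toℕ (col d) ≤ℕ toℕ (col c)
    spoke-order {i} {c} {d} eq = spokes-ordered {i} {c} {d} {spot i c} (spoke-at-spot left i c)
      (subst (Via (topT d) (Side.end right i) (suc (Side.κ right (col d)))) (sym eq) (spoke-at-spot right i d))

    same-column : ∀ {i c d} → spot i c ≡ spot i d → c ≡ d
    same-column {i} {c} {d} eq = Fₚ.toℕ-injective (ℕₚ.suc-injective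
      (subst₂ _≡_ (toℕ-col c) (toℕ-col d)
        (ℕₚ.≤-antisym (spoke-order {i} {d} {c} (sym eq)) (spoke-order {i} {c} {d} eq))))

    spot-injective : ∀ i j c d → spot i c ≡ spot j d → (i , c) ≡ (j , d)
    spot-injective i j c d eq = same-cell (same-row {i} {j} {c} {d} eq) eq
      where
      same-cell : ∀ {i j} → i ≡ j → spot i c ≡ spot j d → (i , c) ≡ (j , d)
      same-cell {i} refl eq = cong (i ,_) (same-column {i} {c} {d} eq)

    rows×tops≤size : n *ℕ m ≤ℕ size H
    rows×tops≤size = Fₚ.injective⇒≤ {f = λ x → uncurry spot (remQuot m x)} λ {x} {y} eq →
      trans (sym (Fₚ.combine-remQuot {n} m x))
        (trans (cong (uncurry combine) (spot-injective _ _ _ _ eq)) (Fₚ.combine-remQuot {n} m y))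

    terminals≤size : k ≤ℕ size H
    terminals≤size = Fₚ.injective⇒≤ {f = τ} (λ {i} {j} → τ-inj i j)

-- The two bounds with explicit constants

lowerBound : ∀ p k → p ≤ℕ k → ∀ N → 11 *ℕ N <ℕ p *ℕ k →
             Σ Graph λ G → TW p G × Σ (Lengths G) λ ℓ →
               Σ (Fin k → Fin (size G)) λ R → Injective _≡_ _≡_ R × (∀ (D : DPM G ℓ R) → N <ℕ size (DPM.G' D))
lowerBound p k p≤k N 11N<pk =
  subst (λ k → Σ Graph λ G → TW p G × Σ (Lengths G) λ ℓ → Σ (Fin k → Fin (size G)) λ R →
                 Injective _≡_ _≡_ R × (∀ (D : DPM G ℓ R) → N <ℕ size (DPM.G' D))) k≡
    (grid , grid-TW 2n≤p , unit , R , R-injective , λ D → ℕₚ.*-cancelˡ-< 11 N (size (DPM.G' D)) (begin-strict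
      11 *ℕ N                                            <⟨ 11N<pk ⟩
      p *ℕ k                                             ≡⟨ cong (_*ℕ k) (m≡m%n+[m/n]*n p 4) ⟩
      (p ℕ.% 4 +ℕ n *ℕ 4) *ℕ k                           ≤⟨ ℕₚ.*-monoˡ-≤ k (ℕₚ.+-monoˡ-≤ (n *ℕ 4) (ℕₚ.≤-pred (m%n<n p 4))) ⟩
      (3 +ℕ n *ℕ 4) *ℕ k                                 ≡⟨ expand n k ⟩
      3 *ℕ k +ℕ 4 *ℕ (n *ℕ k)                            ≤⟨ ℕₚ.+-monoʳ-≤ (3 *ℕ k) (ℕₚ.*-monoʳ-≤ 4 (ℕₚ.*-monoʳ-≤ n k≤2m)) ⟩
      3 *ℕ k +ℕ 4 *ℕ (n *ℕ (2 *ℕ m))                     ≡⟨ regroup k n m ⟩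
      3 *ℕ k +ℕ 8 *ℕ (n *ℕ m)                            ≤⟨ ℕₚ.+-mono-≤
                                                              (ℕₚ.*-monoʳ-≤ 3 (subst (_≤ℕ size (DPM.G' D)) k≡ (terminals≤size D)))
                                                                   (ℕₚ.*-monoʳ-≤ 8 (rows×tops≤size D)) ⟩
      3 *ℕ size (DPM.G' D) +ℕ 8 *ℕ size (DPM.G' D)       ≡⟨ ℕₚ.*-distribʳ-+ (size (DPM.G' D)) 3 8 ⟨
      11 *ℕ size (DPM.G' D)                              ∎))
  where
  -- Since 4n ≤ p ≤ k, the row ends use at most half of the terminals and k ≤ 2m. With p ≤ 4n + 3
  -- this gives pk ≤ 3k + 8nm, and the minor has at least k and at least nm vertices; hence 11 = 3 +
  -- 8. The summand 3k also settles p < 4, where there are no rows.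
  n = p ℕ./ 4
  m = k ℕ.∸ (n +ℕ n)
  open GridGraph n m using (grid; grid-TW; unit)
  open GridBound n m using (R; R-injective; rows×tops≤size; terminals≤size)
  open ℕₚ.≤-Reasoning
  expand : ∀ n k → (3 +ℕ n *ℕ 4) *ℕ k ≡ 3 *ℕ k +ℕ 4 *ℕ (n *ℕ k)
  expand = solve-∀
  regroup : ∀ k n m → 3 *ℕ k +ℕ 4 *ℕ (n *ℕ (2 *ℕ m)) ≡ 3 *ℕ k +ℕ 8 *ℕ (n *ℕ m)
  regroup = solve-∀
  quadruple : ∀ n → (n +ℕ n) +ℕ (n +ℕ n) ≡ n *ℕ 4
  quadruple = solve-∀
  shift : ∀ a m → (a +ℕ m) +ℕ (a +ℕ m) ≡ (a +ℕ a) +ℕ 2 *ℕ m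
  shift = solve-∀
  4n≤p : (n +ℕ n) +ℕ (n +ℕ n) ≤ℕ p
  4n≤p = ℕₚ.≤-trans (ℕₚ.≤-reflexive (quadruple n)) (m/n*n≤m p 4)
  2n≤p : n +ℕ n ≤ℕ p
  2n≤p = ℕₚ.≤-trans (ℕₚ.m≤m+n (n +ℕ n) (n +ℕ n)) 4n≤p
  2n+m≡k : (n +ℕ n) +ℕ m ≡ k
  2n+m≡k = ℕₚ.m+[n∸m]≡n (ℕₚ.≤-trans 2n≤p p≤k)
  k≡ : n +ℕ (n +ℕ m) ≡ k
  k≡ = trans (sym (ℕₚ.+-assoc n n m)) 2n+m≡k
  k≤2m : k ≤ℕ 2 *ℕ m
  k≤2m = ℕₚ.+-cancelˡ-≤ k _ _ (begin
    k +ℕ k                                 ≡⟨ cong₂ _+ℕ_ 2n+m≡k 2n+m≡k ⟨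
    ((n +ℕ n) +ℕ m) +ℕ ((n +ℕ n) +ℕ m)     ≡⟨ shift (n +ℕ n) m ⟩
    ((n +ℕ n) +ℕ (n +ℕ n)) +ℕ 2 *ℕ m       ≤⟨ ℕₚ.+-monoˡ-≤ (2 *ℕ m) (ℕₚ.≤-trans 4n≤p p≤k) ⟩
    k +ℕ 2 *ℕ m                            ∎)

-- With s = p + 1, a boundary of 5s vertices allows pieces of (5s)⁴ + 5s ≤ 630s⁴ vertices. Then k +
-- s ≤ 3k and s ≤ 2p give 630 · 3 · 8 = 15120.
upperBound : ∀ p k → 1 ≤ℕ p → p ≤ℕ k → ∀ G → TW p G → ∀ (ℓ : Lengths G) (R : Fin k → Fin (size G)) →
             Injective _≡_ _≡_ R → Σ (DPM G ℓ R) λ D → size (DPM.G' D) ≤ℕ 15120 *ℕ (p ^ 3) *ℕ k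
upperBound p k 1≤p p≤k G tw ℓ R R-inj with reduce (size G) (edgeCount G) G ℓ R R-inj ℕₚ.≤-refl ℕₚ.≤-refl
... | D , reduced = D , ℕₚ.*-cancelˡ-≤ s (begin
    s *ℕ size D.G'                        ≤⟨ size-bound ⟩
    630 *ℕ (s *ℕ s *ℕ (s *ℕ s)) *ℕ (k +ℕ s)   ≤⟨ ℕₚ.*-monoʳ-≤ (630 *ℕ (s *ℕ s *ℕ (s *ℕ s))) (ℕₚ.+-monoʳ-≤ k s≤2k) ⟩
    630 *ℕ (s *ℕ s *ℕ (s *ℕ s)) *ℕ (k +ℕ 2 *ℕ k)  ≡⟨ regroup s k ⟩
    s *ℕ (1890 *ℕ (s *ℕ s *ℕ s) *ℕ k)     ≤⟨ ℕₚ.*-monoʳ-≤ s (ℕₚ.*-monoˡ-≤ k (ℕₚ.*-monoʳ-≤ 1890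
                                               (ℕₚ.*-mono-≤ (ℕₚ.*-mono-≤ s≤2p s≤2p) s≤2p))) ⟩
    s *ℕ (1890 *ℕ (2 *ℕ p *ℕ (2 *ℕ p) *ℕ (2 *ℕ p)) *ℕ k)  ≡⟨ cong (λ x → s *ℕ (x *ℕ k)) (cube p) ⟩
    s *ℕ (15120 *ℕ (p ^ 3) *ℕ k)          ∎)
  where
  module D = DPM D
  open ℕₚ.≤-Reasoning
  s = suc p
  s≤2p : s ≤ℕ 2 *ℕ p
  s≤2p = ℕₚ.≤-trans (ℕₚ.+-monoˡ-≤ p 1≤p) (ℕₚ.≤-reflexive (cong (p +ℕ_) (sym (ℕₚ.+-identityʳ p))))
  s≤2k : s ≤ℕ 2 *ℕ k
  s≤2k = ℕₚ.≤-trans s≤2p (ℕₚ.*-monoʳ-≤ 2 p≤k)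
  fourth : ∀ s → (5 *ℕ s) *ℕ (5 *ℕ s) *ℕ ((5 *ℕ s) *ℕ (5 *ℕ s)) ≡ 625 *ℕ (s *ℕ s *ℕ (s *ℕ s))
  fourth = solve-∀
  regroup : ∀ s k → 630 *ℕ (s *ℕ s *ℕ (s *ℕ s)) *ℕ (k +ℕ 2 *ℕ k) ≡ s *ℕ (1890 *ℕ (s *ℕ s *ℕ s) *ℕ k)
  regroup = solve-∀
  cube : ∀ p → 1890 *ℕ (2 *ℕ p *ℕ (2 *ℕ p) *ℕ (2 *ℕ p)) ≡ 15120 *ℕ (p *ℕ (p *ℕ (p *ℕ 1)))
  cube = solve-∀
  s≤s⁴ : s ≤ℕ s *ℕ s *ℕ (s *ℕ s)
  s≤s⁴ = ℕₚ.≤-trans (ℕₚ.m≤m*n s s) (ℕₚ.m≤m*n (s *ℕ s) (s *ℕ s))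
  open Peel D.G' (TW-minor D.minor tw) D.τ (630 *ℕ (s *ℕ s *ℕ (s *ℕ s))) (λ S B closed B≤ → begin
    count S                                                      ≤⟨ Piece.piece-bound D.G' D.ℓ' D.τ reduced S B closed ⟩
    (count B *ℕ count B) *ℕ (count B *ℕ count B) +ℕ count B      ≤⟨ ℕₚ.+-mono-≤
                                                                      (ℕₚ.*-mono-≤ (ℕₚ.*-mono-≤ B≤ B≤) (ℕₚ.*-mono-≤ B≤ B≤)) B≤ ⟩
    (5 *ℕ s) *ℕ (5 *ℕ s) *ℕ ((5 *ℕ s) *ℕ (5 *ℕ s)) +ℕ 5 *ℕ s     ≡⟨ cong (_+ℕ 5 *ℕ s) (fourth s) ⟩
    625 *ℕ (s *ℕ s *ℕ (s *ℕ s)) +ℕ 5 *ℕ s                        ≤⟨ ℕₚ.+-monoʳ-≤ (625 *ℕ (s *ℕ s *ℕ (s *ℕ s))) (ℕₚ.*-monoʳ-≤ 5 s≤s⁴) ⟩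
    625 *ℕ (s *ℕ s *ℕ (s *ℕ s)) +ℕ 5 *ℕ (s *ℕ s *ℕ (s *ℕ s))     ≡⟨ ℕₚ.*-distribʳ-+ (s *ℕ s *ℕ (s *ℕ s)) 625 5 ⟨
    630 *ℕ (s *ℕ s *ℕ (s *ℕ s))                                  ∎)

scale-< : ∀ {N p k} → ℕ→ℚ N < (ℤ.+ 1 ℚ./ 11) * ℕ→ℚ p * ℕ→ℚ k → 11 *ℕ N <ℕ p *ℕ k
scale-< {N} {p} {k} N< = ℕₚ.≰⇒> λ pk≤11N → ℚₚ.<-irrefl refl (begin-strict
  -- The closed term `c * ℕ→ℚ 11` evaluates to `1ℚ`, so the identity law applies to it.
  ℕ→ℚ N                                ≡⟨ ℚₚ.*-identityˡ (ℕ→ℚ N) ⟨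
  (c * ℕ→ℚ 11) * ℕ→ℚ N                 <⟨ ℚₚ.<-≤-trans
                                            (ℚₚ.≤-<-trans (ℚₚ.≤-reflexive (ℚₚ.*-identityˡ (ℕ→ℚ N))) N<)
                                            (ℚₚ.≤-trans (ℚₚ.≤-reflexive (ℚₚ.*-assoc c (ℕ→ℚ p) (ℕ→ℚ k)))
                                                        (ℚₚ.*-monoˡ-≤-nonNeg c (product pk≤11N))) ⟩
  c * (ℕ→ℚ 11 * ℕ→ℚ N)                 ≡⟨ ℚₚ.*-assoc c (ℕ→ℚ 11) (ℕ→ℚ N) ⟨
  (c * ℕ→ℚ 11) * ℕ→ℚ N                 ≡⟨ ℚₚ.*-identityˡ (ℕ→ℚ N) ⟩
  ℕ→ℚ N                                ∎)
  where
  open ℚₚ.≤-Reasoning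
  c = ℤ.+ 1 ℚ./ 11
  product : p *ℕ k ≤ℕ 11 *ℕ N → ℕ→ℚ p * ℕ→ℚ k ≤ ℕ→ℚ 11 * ℕ→ℚ N
  product le = subst₂ _≤_ (ℕ→ℚ-* p k) (ℕ→ℚ-* 11 N) (ℕ→ℚ-mono le)

-- The minimum f* enters through its two defining properties: no `N` below c p k suffices for all
-- graphs of the family, and C p³ k does.
theorem2 : Σ ℚ λ c → Σ ℚ λ C → 0ℚ < c × 0ℚ < C ×
    (∀ (p k : ℕ) → 1 ≤ℕ p → p ≤ℕ k →
    (∀ (N : ℕ) → ℕ→ℚ N < c * ℕ→ℚ p * ℕ→ℚ k →
    Σ Graph λ G → TW p G × Σ (Lengths G) λ ℓ →
    Σ (Fin k → Fin (size G)) λ R → Injective _≡_ _≡_ R ×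
    (∀ (D : DPM G ℓ R) → N <ℕ size (DPM.G' D)))
    ×
    (∀ (G : Graph) → TW p G → ∀ (ℓ : Lengths G) (R : Fin k → Fin (size G)) →
    Injective _≡_ _≡_ R →
    Σ (DPM G ℓ R) λ D → ℕ→ℚ (size (DPM.G' D)) ≤ C * ℕ→ℚ (p ^ 3) * ℕ→ℚ k))
theorem2 = ℤ.+ 1 ℚ./ 11 , ℕ→ℚ 15120 , *<* (ℤ.+<+ (s≤s z≤n)) , *<* (ℤ.+<+ (s≤s z≤n)) , λ p k 1≤p p≤k →
  (λ N N< → lowerBound p k p≤k N (scale-< {N} {p} {k} N<)) ,
  (λ G tw ℓ R R-inj → let D , size≤ = upperBound p k 1≤p p≤k G tw ℓ R R-inj in
    D , ℚₚ.≤-trans (ℕ→ℚ-mono size≤) (ℚₚ.≤-reflexive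
      (trans (ℕ→ℚ-* (15120 *ℕ (p ^ 3)) k) (cong (_* ℕ→ℚ k) (ℕ→ℚ-* 15120 (p ^ 3))))))
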